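{- Let $p$ be a prime, let $\epsilon>0$, and let $u\ge 0$ be an integer. For each $n$ let $M=M^{(n)}\in M_{n\times(n+u)}(\mathbb{Z}/p\mathbb{Z})$ be an $\epsilon$-balanced random matrix. Then for every non-negative integer $k$, $$\lim_{n\to\infty}\mathbb{P}(\operatorname{rank}(M)=n-k)=p^{ -k(k+u)}\prod_{i=1}^{k}(1-p^{ -i})^{ -1}\prod_{i=1}^{k+u}(1-p^{ -i})^{ -1}\prod_{i\ge 1}(1-p^{ -i}).$$
   Context: A random matrix over $\mathbb{Z}/p\mathbb{Z}$ is $\epsilon$-balanced if its entries are independent and every entry $y$ satisfies $\mathbb{P}(y=r)\le 1-\epsilon$ for every $r\in\mathbb{Z}/p\mathbb{Z}$. The entries need not be identically distributed and their distributions may vary with $n$; $\epsilon$ and $u$ do not depend on $n$. -}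

module Defs where

open import Algebra.Bundles.Raw using (RawMonoid)
import Algebra.Definitions.RawMonoid as RawMonoidDefs
open import Data.Fin.Base using (Fin; toℕ)
import Data.Fin.Properties as Fin
open import Data.Fin.Subset using (Subset; inside; outside; _∉_; ∣_∣)
open import Data.Fin.Subset.Properties using (_∈?_)
import Data.Integer.Base as ℤ
open import Data.List.Base as List using (List; []; _∷_; allFin; cartesianProductWith; filter)
open import Data.List.Extrema.Nat using (max)
open import Data.Nat.Base as ℕ using (ℕ; zero; suc; z≤n; s≤s; NonTrivial)
open import Data.Nat.DivMod using (_mod_)
import Data.Nat.Properties as ℕ
import Data.Nat.Solver as NatSolver
open import Data.Nat.Primality using (Prime; prime⇒nonZero; prime⇒nonTrivial)
open import Data.Product.Base using (∃-syntax; _×_; _,_)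
open import Data.Rational.Base as ℚ using (ℚ; 0ℚ; 1ℚ; mkℚ; Positive; positive)
import Data.Rational.Properties as ℚ
open import Data.Rational.Solver using (module +-*-Solver)
import Data.Rational.Unnormalised.Base as ℚᵘ
import Data.Rational.Unnormalised.Properties as ℚᵘ
open import Data.Sum.Base using (inj₁; inj₂)
open import Data.Vec.Base as Vec using (Vec; []; _∷_; lookup)
open import Level using (0ℓ)
open import Relation.Binary.PropositionalEquality
  using (_≡_; refl; sym; trans; cong; subst; subst₂)
open import Relation.Nullary.Decidable using (Dec; map′; ¬?; _→-dec_)
open import Relation.Unary using (Pred; Decidable)

-- Real numbers are Cauchy sequences of rationals carrying a modulus;
-- equality of reals is _≃ℝ_, not _≡_.

IsCauchy : (ℕ → ℚ) → Set
IsCauchy x = ∀ ε → 0ℚ ℚ.< ε →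
  ∃[ N ] (∀ m n → N ℕ.≤ m → N ℕ.≤ n → ℚ.∣ x m ℚ.- x n ∣ ℚ.< ε)

record ℝ : Set where
  constructor mkℝ
  field
    seq    : ℕ → ℚ
    cauchy : IsCauchy seq

open ℝ public

infix 4 _≃ℝ_ _≤ℝ_ _<ℝ_

-- Records, so that x and y can be inferred from a proof.

record _≃ℝ_ (x y : ℝ) : Set where
  constructor mk≃
  field
    ≃-close : ∀ ε → 0ℚ ℚ.< ε →
      ∃[ N ] (∀ n → N ℕ.≤ n → ℚ.∣ seq x n ℚ.- seq y n ∣ ℚ.< ε)

record _≤ℝ_ (x y : ℝ) : Set where
  constructor mk≤
  field
    ≤-close : ∀ ε → 0ℚ ℚ.< ε →
      ∃[ N ] (∀ n → N ℕ.≤ n → seq x n ℚ.< seq y n ℚ.+ ε)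

record _<ℝ_ (x y : ℝ) : Set where
  constructor mk<
  field
    gap          : ℚ
    0<gap        : 0ℚ ℚ.< gap
    <-separation : ∃[ N ] (∀ n → N ℕ.≤ n → seq x n ℚ.+ gap ℚ.< seq y n)

open _≃ℝ_ public
open _≤ℝ_ public
open _<ℝ_ public

private

  module ℕS = NatSolver.+-*-Solver

  half : ∀ ε → 0ℚ ℚ.< ε → 0ℚ ℚ.< ℚ.½ ℚ.* ε
  half ε 0<ε = ℚ.positive⁻¹ (ℚ.½ ℚ.* ε) {{ℚ.pos*pos⇒pos ℚ.½ ε {{positive 0<ε}}}}

  half+half : ∀ ε → ℚ.½ ℚ.* ε ℚ.+ ℚ.½ ℚ.* ε ≡ ε
  half+half = solve 1 (λ ε → con ℚ.½ :* ε :+ con ℚ.½ :* ε := ε) refl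
    where open +-*-Solver

  +-cauchy : ∀ x y → IsCauchy x → IsCauchy y → IsCauchy (λ n → x n ℚ.+ y n)
  +-cauchy x y cx cy ε 0<ε
    with (N , bx) ← cx _ (half ε 0<ε) | (K , by) ← cy _ (half ε 0<ε)
    = N ℕ.⊔ K , λ m n p q → begin-strict
      ℚ.∣ (x m ℚ.+ y m) ℚ.- (x n ℚ.+ y n) ∣
        ≡⟨ cong ℚ.∣_∣ (rearrange (x m) (y m) (x n) (y n)) ⟩
      ℚ.∣ (x m ℚ.- x n) ℚ.+ (y m ℚ.- y n) ∣
        ≤⟨ ℚ.∣p+q∣≤∣p∣+∣q∣ (x m ℚ.- x n) (y m ℚ.- y n) ⟩
      ℚ.∣ x m ℚ.- x n ∣ ℚ.+ ℚ.∣ y m ℚ.- y n ∣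
        <⟨ ℚ.+-mono-<
             (bx m n (ℕ.m⊔n≤o⇒m≤o N K p) (ℕ.m⊔n≤o⇒m≤o N K q))
             (by m n (ℕ.m⊔n≤o⇒n≤o N K p) (ℕ.m⊔n≤o⇒n≤o N K q)) ⟩
      ℚ.½ ℚ.* ε ℚ.+ ℚ.½ ℚ.* ε
        ≡⟨ half+half ε ⟩
      ε ∎
    where
    open ℚ.≤-Reasoning
    rearrange : ∀ a b c d →
      (a ℚ.+ b) ℚ.- (c ℚ.+ d) ≡ (a ℚ.- c) ℚ.+ (b ℚ.- d)
    rearrange = solve 4 (λ a b c d →
      (a :+ b) :- (c :+ d) := (a :- c) :+ (b :- d)) refl
      where open +-*-Solver

  neg-cauchy : ∀ x → IsCauchy x → IsCauchy (λ n → ℚ.- x n)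
  neg-cauchy x cx ε 0<ε with (N , bx) ← cx ε 0<ε
    = N , λ m n p q → subst (ℚ._< ε)
        (sym (trans (cong ℚ.∣_∣ (rearrange (x m) (x n))) (ℚ.∣-p∣≡∣p∣ (x m ℚ.- x n))))
        (bx m n p q)
    where
    rearrange : ∀ a b → (ℚ.- a) ℚ.- (ℚ.- b) ≡ ℚ.- (a ℚ.- b)
    rearrange = solve 2 (λ a b → (:- a) :- (:- b) := :- (a :- b)) refl
      where open +-*-Solver

  ∣a∣-∣b∣≤∣a-b∣ : ∀ a b → ℚ.∣ a ∣ ℚ.- ℚ.∣ b ∣ ℚ.≤ ℚ.∣ a ℚ.- b ∣
  ∣a∣-∣b∣≤∣a-b∣ a b = begin
    ℚ.∣ a ∣ ℚ.- ℚ.∣ b ∣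
      ≡⟨ cong (λ t → ℚ.∣ t ∣ ℚ.- ℚ.∣ b ∣)
           (solve 2 (λ a b → a := (a :- b) :+ b) refl a b) ⟩
    ℚ.∣ (a ℚ.- b) ℚ.+ b ∣ ℚ.- ℚ.∣ b ∣
      ≤⟨ ℚ.+-monoˡ-≤ (ℚ.- ℚ.∣ b ∣) (ℚ.∣p+q∣≤∣p∣+∣q∣ (a ℚ.- b) b) ⟩
    (ℚ.∣ a ℚ.- b ∣ ℚ.+ ℚ.∣ b ∣) ℚ.- ℚ.∣ b ∣
      ≡⟨ solve 2 (λ u v → (u :+ v) :- v := u) refl ℚ.∣ a ℚ.- b ∣ ℚ.∣ b ∣ ⟩
    ℚ.∣ a ℚ.- b ∣ ∎
    where
    open ℚ.≤-Reasoning
    open +-*-Solver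

  neg-diff : ∀ a b → ℚ.- (a ℚ.- b) ≡ b ℚ.- a
  neg-diff = solve 2 (λ a b → :- (a :- b) := b :- a) refl
    where open +-*-Solver

  ∣-∣-sym : ∀ a b → ℚ.∣ a ℚ.- b ∣ ≡ ℚ.∣ b ℚ.- a ∣
  ∣-∣-sym a b = trans (sym (ℚ.∣-p∣≡∣p∣ (a ℚ.- b))) (cong ℚ.∣_∣ (neg-diff a b))

  ∣∣-lipschitz : ∀ a b → ℚ.∣ ℚ.∣ a ∣ ℚ.- ℚ.∣ b ∣ ∣ ℚ.≤ ℚ.∣ a ℚ.- b ∣
  ∣∣-lipschitz a b with ℚ.∣p∣≡p∨∣p∣≡-p (ℚ.∣ a ∣ ℚ.- ℚ.∣ b ∣)
  ... | inj₁ eq = subst (ℚ._≤ ℚ.∣ a ℚ.- b ∣) (sym eq) (∣a∣-∣b∣≤∣a-b∣ a b)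
  ... | inj₂ eq = subst₂ ℚ._≤_
    (sym (trans eq (neg-diff ℚ.∣ a ∣ ℚ.∣ b ∣))) (∣-∣-sym b a) (∣a∣-∣b∣≤∣a-b∣ b a)

  abs-cauchy : ∀ x → IsCauchy x → IsCauchy (λ n → ℚ.∣ x n ∣)
  abs-cauchy x cx ε 0<ε with (N , bx) ← cx ε 0<ε
    = N , λ m n p q → ℚ.≤-<-trans (∣∣-lipschitz (x m) (x n)) (bx m n p q)

  eventually-bounded : ∀ x → IsCauchy x →
    ∃[ B ] (0ℚ ℚ.< B × ∃[ N ] (∀ n → N ℕ.≤ n → ℚ.∣ x n ∣ ℚ.≤ B))
  eventually-bounded x cx with (N , bx) ← cx 1ℚ (ℚ.positive⁻¹ 1ℚ)
    = 1ℚ ℚ.+ ℚ.∣ x N ∣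
    , ℚ.+-mono-<-≤ (ℚ.positive⁻¹ 1ℚ) (ℚ.0≤∣p∣ (x N))
    , N , λ n p → begin
      ℚ.∣ x n ∣
        ≡⟨ cong ℚ.∣_∣ (solve 2 (λ a b → a := (a :- b) :+ b) refl (x n) (x N)) ⟩
      ℚ.∣ (x n ℚ.- x N) ℚ.+ x N ∣
        ≤⟨ ℚ.∣p+q∣≤∣p∣+∣q∣ (x n ℚ.- x N) (x N) ⟩
      ℚ.∣ x n ℚ.- x N ∣ ℚ.+ ℚ.∣ x N ∣
        ≤⟨ ℚ.+-monoˡ-≤ ℚ.∣ x N ∣ (ℚ.<⇒≤ (bx n N p ℕ.≤-refl)) ⟩
      1ℚ ℚ.+ ℚ.∣ x N ∣ ∎
    where
    open ℚ.≤-Reasoning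
    open +-*-Solver

  split : ∀ A B ε → 0ℚ ℚ.< A → 0ℚ ℚ.< B → 0ℚ ℚ.< ε →
    ∃[ δ ] (0ℚ ℚ.< δ × A ℚ.* δ ℚ.+ B ℚ.* δ ≡ ε)
  split A B ε 0<A 0<B 0<ε = δ , 0<δ , trans (sym (ℚ.*-distribʳ-+ δ A B)) Cδ≡ε
    where
    C : ℚ
    C = A ℚ.+ B
    C>0 : Positive C
    C>0 = positive (ℚ.+-mono-< 0<A 0<B)
    C≢0 : ℚ.NonZero C
    C≢0 = ℚ.pos⇒nonZero C {{C>0}}
    C⁻¹ : ℚ
    C⁻¹ = (ℚ.1/ C) {{C≢0}}
    δ : ℚ
    δ = C⁻¹ ℚ.* ε
    0<δ : 0ℚ ℚ.< δ
    0<δ = ℚ.positive⁻¹ δ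
      {{ℚ.pos*pos⇒pos C⁻¹ {{ℚ.1/pos⇒pos C {{C>0}}}} ε {{positive 0<ε}}}}
    Cδ≡ε : C ℚ.* δ ≡ ε
    Cδ≡ε = trans (sym (ℚ.*-assoc C C⁻¹ ε))
      (trans (cong (ℚ._* ε) (ℚ.*-inverseʳ C {{C≢0}})) (ℚ.*-identityˡ ε))

  ∣ad∣<Cδ : ∀ a d C δ → 0ℚ ℚ.< C → ℚ.∣ a ∣ ℚ.≤ C → ℚ.∣ d ∣ ℚ.< δ →
    ℚ.∣ a ℚ.* d ∣ ℚ.< C ℚ.* δ
  ∣ad∣<Cδ a d C δ 0<C a≤C d<δ = subst (ℚ._< C ℚ.* δ) (sym (ℚ.∣p*q∣≡∣p∣*∣q∣ a d))
    (ℚ.≤-<-trans {ℚ.∣ a ∣ ℚ.* ℚ.∣ d ∣} {C ℚ.* ℚ.∣ d ∣} {C ℚ.* δ}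
      (ℚ.*-monoʳ-≤-nonNeg ℚ.∣ d ∣ {{ℚ.∣-∣-nonNeg d}} a≤C)
      (ℚ.*-monoʳ-<-pos C {{positive 0<C}} d<δ))

  product-diff : ∀ a b c d →
    a ℚ.* b ℚ.- c ℚ.* d ≡ a ℚ.* (b ℚ.- d) ℚ.+ d ℚ.* (a ℚ.- c)
  product-diff = solve 4 (λ a b c d →
    a :* b :- c :* d := a :* (b :- d) :+ d :* (a :- c)) refl
    where open +-*-Solver

  product-close : ∀ a b c d A B δ → 0ℚ ℚ.< A → 0ℚ ℚ.< B →
    ℚ.∣ a ∣ ℚ.≤ A → ℚ.∣ d ∣ ℚ.≤ B → ℚ.∣ b ℚ.- d ∣ ℚ.< δ → ℚ.∣ a ℚ.- c ∣ ℚ.< δ →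
    ℚ.∣ a ℚ.* b ℚ.- c ℚ.* d ∣ ℚ.< A ℚ.* δ ℚ.+ B ℚ.* δ
  product-close a b c d A B δ 0<A 0<B a≤A d≤B bd<δ ac<δ =
    subst (λ t → ℚ.∣ t ∣ ℚ.< A ℚ.* δ ℚ.+ B ℚ.* δ) (sym (product-diff a b c d))
      (ℚ.≤-<-trans (ℚ.∣p+q∣≤∣p∣+∣q∣ (a ℚ.* (b ℚ.- d)) (d ℚ.* (a ℚ.- c)))
        (ℚ.+-mono-< (∣ad∣<Cδ a (b ℚ.- d) A δ 0<A a≤A bd<δ)
                    (∣ad∣<Cδ d (a ℚ.- c) B δ 0<B d≤B ac<δ)))

  *-cauchy : ∀ x y → IsCauchy x → IsCauchy y → IsCauchy (λ n → x n ℚ.* y n)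
  *-cauchy x y cx cy ε 0<ε =
    let (A , 0<A , N₁ , ≤A) = eventually-bounded x cx
        (B , 0<B , N₂ , ≤B) = eventually-bounded y cy
        (δ , 0<δ , eq)      = split A B ε 0<A 0<B 0<ε
        (N₃ , bx)           = cx δ 0<δ
        (N₄ , by)           = cy δ 0<δ
        N₁₂ = N₁ ℕ.⊔ N₂
        N₃₄ = N₃ ℕ.⊔ N₄
    in N₁₂ ℕ.⊔ N₃₄ , λ m n p q →
      let p₁₂ = ℕ.m⊔n≤o⇒m≤o N₁₂ N₃₄ p
          q₁₂ = ℕ.m⊔n≤o⇒m≤o N₁₂ N₃₄ q
          p₃₄ = ℕ.m⊔n≤o⇒n≤o N₁₂ N₃₄ p
          q₃₄ = ℕ.m⊔n≤o⇒n≤o N₁₂ N₃₄ q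
      in subst (ℚ.∣ x m ℚ.* y m ℚ.- x n ℚ.* y n ∣ ℚ.<_) eq
        (product-close (x m) (y m) (x n) (y n) A B δ 0<A 0<B
          (≤A m (ℕ.m⊔n≤o⇒m≤o N₁ N₂ p₁₂))
          (≤B n (ℕ.m⊔n≤o⇒n≤o N₁ N₂ q₁₂))
          (by m n (ℕ.m⊔n≤o⇒n≤o N₃ N₄ p₃₄) (ℕ.m⊔n≤o⇒n≤o N₃ N₄ q₃₄))
          (bx m n (ℕ.m⊔n≤o⇒m≤o N₃ N₄ p₃₄) (ℕ.m⊔n≤o⇒m≤o N₃ N₄ q₃₄)))

fromℚ : ℚ → ℝ
seq    (fromℚ q) _ = q
cauchy (fromℚ q) ε 0<ε = 0 , λ _ _ _ _ →
  subst (ℚ._< ε) (sym (cong ℚ.∣_∣ (ℚ.+-inverseʳ q))) 0<ε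

0ℝ 1ℝ : ℝ
0ℝ = fromℚ 0ℚ
1ℝ = fromℚ 1ℚ

infixl 7 _*ℝ_
infixl 6 _+ℝ_ _-ℝ_
infix  8 -ℝ_

_+ℝ_ : ℝ → ℝ → ℝ
seq    (x +ℝ y) n = seq x n ℚ.+ seq y n
cauchy (x +ℝ y) = +-cauchy (seq x) (seq y) (cauchy x) (cauchy y)

_*ℝ_ : ℝ → ℝ → ℝ
seq    (x *ℝ y) n = seq x n ℚ.* seq y n
cauchy (x *ℝ y) = *-cauchy (seq x) (seq y) (cauchy x) (cauchy y)

-ℝ_ : ℝ → ℝ
seq    (-ℝ x) n = ℚ.- seq x n
cauchy (-ℝ x) = neg-cauchy (seq x) (cauchy x)

_-ℝ_ : ℝ → ℝ → ℝ
x -ℝ y = x +ℝ (-ℝ y)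

∣_∣ℝ : ℝ → ℝ
seq    ∣ x ∣ℝ n = ℚ.∣ seq x n ∣
cauchy ∣ x ∣ℝ = abs-cauchy (seq x) (cauchy x)

_⟶_ : (ℕ → ℝ) → ℝ → Set
a ⟶ L = ∀ ε → 0ℝ <ℝ ε → ∃[ N ] (∀ n → N ℕ.≤ n → ∣ a n -ℝ L ∣ℝ <ℝ ε)

infix 4 _⟶_

*ℝ-rawMonoid : RawMonoid 0ℓ 0ℓ
*ℝ-rawMonoid = record { Carrier = ℝ ; _≈_ = _≃ℝ_ ; _∙_ = _*ℝ_ ; ε = 1ℝ }

∏ℝ : ∀ {n} → (Fin n → ℝ) → ℝ
∏ℝ = RawMonoidDefs.sum *ℝ-rawMonoid

∑ℝ : List ℝ → ℝ
∑ℝ = List.foldr _+ℝ_ 0ℝ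

-- ∏₁ k f = f 1 * ⋯ * f k; the instance argument lets f divide by a quantity
-- that vanishes at i = 0.
∏₁ : ℕ → ((i : ℕ) .{{_ : ℕ.NonZero i}} → ℚ) → ℚ
∏₁ zero    f = 1ℚ
∏₁ (suc k) f = ∏₁ k f ℚ.* f (suc k)

private

  toℚᵘ-1/ : ∀ a → ℚ.toℚᵘ (ℤ.+ 1 ℚ./ suc a) ℚᵘ.≃ ℚᵘ.mkℚᵘ (ℤ.+ 1) a
  toℚᵘ-1/ a = ℚ.toℚᵘ-fromℚᵘ (ℚᵘ.mkℚᵘ (ℤ.+ 1) a)

  2/a≤1/b : ∀ a b .{{_ : ℕ.NonZero a}} .{{_ : ℕ.NonZero b}} → 2 ℕ.* b ℕ.≤ a →
    (ℤ.+ 1 ℚ./ a) ℚ.+ (ℤ.+ 1 ℚ./ a) ℚ.≤ ℤ.+ 1 ℚ./ b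
  2/a≤1/b a@(suc a′) b@(suc b′) 2b≤a = ℚ.toℚᵘ-cancel-≤ (begin
    ℚ.toℚᵘ ((ℤ.+ 1 ℚ./ a) ℚ.+ (ℤ.+ 1 ℚ./ a))
      ≃⟨ ℚ.toℚᵘ-homo-+ (ℤ.+ 1 ℚ./ a) (ℤ.+ 1 ℚ./ a) ⟩
    ℚ.toℚᵘ (ℤ.+ 1 ℚ./ a) ℚᵘ.+ ℚ.toℚᵘ (ℤ.+ 1 ℚ./ a)
      ≃⟨ ℚᵘ.+-cong (toℚᵘ-1/ a′) (toℚᵘ-1/ a′) ⟩
    ℚᵘ.mkℚᵘ (ℤ.+ 1) a′ ℚᵘ.+ ℚᵘ.mkℚᵘ (ℤ.+ 1) a′
      ≤⟨ ℚᵘ.*≤* (ℤ.+≤+ cross) ⟩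
    ℚᵘ.mkℚᵘ (ℤ.+ 1) b′
      ≃⟨ ℚᵘ.≃-sym (toℚᵘ-1/ b′) ⟩
    ℚ.toℚᵘ (ℤ.+ 1 ℚ./ b) ∎)
    where
    open ℚᵘ.≤-Reasoning
    cross : ((1 ℕ.* a) ℕ.+ (1 ℕ.* a)) ℕ.* b ℕ.≤ 1 ℕ.* (a ℕ.* a)
    cross = subst₂ ℕ._≤_
      (ℕS.solve 2 (λ a b → a ℕS.:* (ℕS.con 2 ℕS.:* b) ℕS.:=
        (ℕS.con 1 ℕS.:* a ℕS.:+ ℕS.con 1 ℕS.:* a) ℕS.:* b) refl a b)
      (sym (ℕ.*-identityˡ (a ℕ.* a)))
      (ℕ.*-monoʳ-≤ a 2b≤a)

  1/a<q : ∀ q → 0ℚ ℚ.< q → ∀ a .{{_ : ℕ.NonZero a}} → ℚ.↧ₙ q ℕ.< a →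
    ℤ.+ 1 ℚ./ a ℚ.< q
  1/a<q (mkℚ (ℤ.+ zero)   d c) 0<q a d<a with () ← ℚ.positive 0<q
  1/a<q (mkℚ ℤ.-[1+ n ]   d c) 0<q a d<a with () ← ℚ.positive 0<q
  1/a<q (mkℚ (ℤ.+ (suc n)) d c) 0<q a@(suc a′) d<a =
    ℚ.toℚᵘ-cancel-< (ℚᵘ.<-respˡ-≃ (ℚᵘ.≃-sym (toℚᵘ-1/ a′)) (ℚᵘ.*<* (ℤ.+<+ cross)))
    where
    cross : 1 ℕ.* suc d ℕ.< suc n ℕ.* a
    cross = subst (ℕ._< suc n ℕ.* a) (sym (ℕ.*-identityˡ (suc d)))
      (ℕ.<-≤-trans d<a (ℕ.m≤n*m a (suc n)))

  n<p^n : ∀ p n .{{_ : NonTrivial p}} → n ℕ.< p ℕ.^ n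
  n<p^n p zero    = s≤s z≤n
  n<p^n p (suc n) = ℕ.≤-<-trans (n<p^n p n)
    (ℕ.^-monoʳ-< p (ℕ.nonTrivial⇒n>1 p) (ℕ.n<1+n n))

infix 9 _^-_

_^-_ : (p : ℕ) {{_ : Prime p}} → ℕ → ℚ
_^-_ p {{isPrime}} m =
  (ℤ.+ 1 ℚ./ (p ℕ.^ m)) {{ℕ.m^n≢0 p m {{prime⇒nonZero isPrime}}}}

module _ (p : ℕ) {{isPrime : Prime p}} where

  private
    instance
      p≢0 : ℕ.NonZero p
      p≢0 = prime⇒nonZero isPrime
      p>1 : NonTrivial p
      p>1 = prime⇒nonTrivial isPrime

    p^m≢0 : ∀ m → ℕ.NonZero (p ℕ.^ m)
    p^m≢0 m = ℕ.m^n≢0 p m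

  private

    0<p^- : ∀ m → 0ℚ ℚ.< p ^- m
    0<p^- m = ℚ.positive⁻¹ (p ^- m) {{ℚ.normalize-pos 1 (p ℕ.^ m) {{p^m≢0 m}}}}

    halving : ∀ m → p ^- suc m ℚ.+ p ^- suc m ℚ.≤ p ^- m
    halving m = 2/a≤1/b (p ℕ.^ suc m) (p ℕ.^ m) {{p^m≢0 (suc m)}} {{p^m≢0 m}}
      (ℕ.*-monoˡ-≤ (p ℕ.^ m) (ℕ.nonTrivial⇒n>1 p))

    p^-[1+m]<p^-m : ∀ m → p ^- suc m ℚ.< p ^- m
    p^-[1+m]<p^-m m = ℚ.<-≤-trans
      (subst (ℚ._< p ^- suc m ℚ.+ p ^- suc m) (ℚ.+-identityʳ (p ^- suc m))
        (ℚ.+-monoʳ-< (p ^- suc m) (0<p^- (suc m))))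
      (halving m)

    p^-≤1 : ∀ m → p ^- m ℚ.≤ 1ℚ
    p^-≤1 zero    = ℚ.≤-refl
    p^-≤1 (suc m) = ℚ.≤-trans (ℚ.<⇒≤ (p^-[1+m]<p^-m m)) (p^-≤1 m)

    1-p^->0 : ∀ i .{{_ : ℕ.NonZero i}} → Positive (1ℚ ℚ.- p ^- i)
    1-p^->0 (suc m) = positive (subst (ℚ._< 1ℚ ℚ.- p ^- suc m)
      (ℚ.+-inverseʳ (p ^- suc m))
      (ℚ.+-monoˡ-< (ℚ.- p ^- suc m) (ℚ.<-≤-trans (p^-[1+m]<p^-m m) (p^-≤1 m))))

  [1-_^-_]⁻¹ : (i : ℕ) .{{_ : ℕ.NonZero i}} → ℚ
  [1-_^-_]⁻¹ i = (ℚ.1/ (1ℚ ℚ.- p ^- i)) {{ℚ.pos⇒nonZero (1ℚ ℚ.- p ^- i) {{1-p^->0 i}}}}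

  private

    P : ℕ → ℚ
    P m = ∏₁ m (λ i → 1ℚ ℚ.- p ^- i)

    0≤P : ∀ m → 0ℚ ℚ.≤ P m
    0≤P zero    = ℚ.<⇒≤ (ℚ.positive⁻¹ 1ℚ)
    0≤P (suc m) = ℚ.nonNegative⁻¹ (P (suc m)) {{ℚ.nonNeg*nonNeg⇒nonNeg (P m) {{ℚ.nonNegative (0≤P m)}}
      (1ℚ ℚ.- p ^- suc m) {{ℚ.pos⇒nonNeg (1ℚ ℚ.- p ^- suc m) {{1-p^->0 (suc m)}}}}}}

    P-step : ∀ m → P (suc m) ≡ P m ℚ.- P m ℚ.* p ^- suc m
    P-step m = solve 2 (λ x y → x :* (con 1ℚ :- y) := x :- x :* y) refl (P m) (p ^- suc m)
      where open +-*-Solver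

    P-dec : ∀ m → P (suc m) ℚ.≤ P m
    P-dec m = begin
      P (suc m)                          ≡⟨ P-step m ⟩
      P m ℚ.- P m ℚ.* p ^- suc m       ≤⟨ ℚ.+-monoʳ-≤ (P m) (ℚ.neg-antimono-≤ 0≤Pp) ⟩
      P m ℚ.+ 0ℚ                         ≡⟨ ℚ.+-identityʳ (P m) ⟩
      P m                                ∎
      where
      open ℚ.≤-Reasoning
      0≤Pp : 0ℚ ℚ.≤ P m ℚ.* p ^- suc m
      0≤Pp = ℚ.nonNegative⁻¹ (P m ℚ.* p ^- suc m) {{ℚ.nonNeg*nonNeg⇒nonNeg (P m) {{ℚ.nonNegative (0≤P m)}}
        (p ^- suc m) {{ℚ.nonNegative (ℚ.<⇒≤ (0<p^- (suc m)))}}}}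

    P≤1 : ∀ m → P m ℚ.≤ 1ℚ
    P≤1 zero    = ℚ.≤-refl
    P≤1 (suc m) = ℚ.≤-trans (P-dec m) (P≤1 m)

    Q : ℕ → ℚ
    Q m = P m ℚ.- p ^- m

    Q-inc : ∀ m → Q m ℚ.≤ Q (suc m)
    Q-inc m = begin
      P m ℚ.- p ^- m
        ≤⟨ ℚ.+-monoʳ-≤ (P m) (ℚ.neg-antimono-≤ (halving m)) ⟩
      P m ℚ.- (t ℚ.+ t)
        ≡⟨ solve 2 (λ x t → x :- (t :+ t) := (x :- con 1ℚ :* t) :- t) refl (P m) t ⟩
      (P m ℚ.- 1ℚ ℚ.* t) ℚ.- t
        ≤⟨ ℚ.+-monoˡ-≤ (ℚ.- t) (ℚ.+-monoʳ-≤ (P m) (ℚ.neg-antimono-≤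
             (ℚ.*-monoʳ-≤-nonNeg t {{ℚ.nonNegative (ℚ.<⇒≤ (0<p^- (suc m)))}} (P≤1 m)))) ⟩
      (P m ℚ.- P m ℚ.* t) ℚ.- t
        ≡⟨ cong (ℚ._- t) (sym (P-step m)) ⟩
      P (suc m) ℚ.- t ∎
      where
      t = p ^- suc m
      open ℚ.≤-Reasoning
      open +-*-Solver

    P-anti : ∀ {m n} → m ℕ.≤′ n → P n ℚ.≤ P m
    P-anti ℕ.≤′-refl     = ℚ.≤-refl
    P-anti (ℕ.≤′-step {n} q) = ℚ.≤-trans (P-dec n) (P-anti q)

    Q-mono : ∀ {m n} → m ℕ.≤′ n → Q m ℚ.≤ Q n
    Q-mono ℕ.≤′-refl     = ℚ.≤-refl
    Q-mono (ℕ.≤′-step {n} q) = ℚ.≤-trans (Q-mono q) (Q-inc n)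

    -- Q N ≤ Q m ≤ P m ≤ P N for m ≥ N, and P N - Q N = p^-N
    P-close : ∀ N m n → N ℕ.≤ m → N ℕ.≤ n → P m ℚ.- P n ℚ.≤ p ^- N
    P-close N m n N≤m N≤n = begin
      P m ℚ.- P n
        ≤⟨ ℚ.+-mono-≤ (P-anti (ℕ.≤⇒≤′ N≤m)) (ℚ.neg-antimono-≤ Q≤P) ⟩
      P N ℚ.- Q N
        ≡⟨ solve 2 (λ x t → x :- (x :- t) := t) refl (P N) (p ^- N) ⟩
      p ^- N ∎
      where
      open ℚ.≤-Reasoning
      open +-*-Solver
      Q≤P : Q N ℚ.≤ P n
      Q≤P = begin
        Q N              ≤⟨ Q-mono (ℕ.≤⇒≤′ N≤n) ⟩
        P n ℚ.- p ^- n   ≤⟨ ℚ.+-monoʳ-≤ (P n) (ℚ.neg-antimono-≤ (ℚ.<⇒≤ (0<p^- n))) ⟩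
        P n ℚ.+ 0ℚ       ≡⟨ ℚ.+-identityʳ (P n) ⟩
        P n              ∎

    P-cauchy : IsCauchy P
    P-cauchy ε 0<ε = N , λ m n N≤m N≤n → ℚ.≤-<-trans (close m n N≤m N≤n) p^-N<ε
      where
      N = ℚ.↧ₙ ε
      p^-N<ε : p ^- N ℚ.< ε
      p^-N<ε = 1/a<q ε 0<ε (p ℕ.^ N) {{p^m≢0 N}} (n<p^n p N)
      close : ∀ m n → N ℕ.≤ m → N ℕ.≤ n → ℚ.∣ P m ℚ.- P n ∣ ℚ.≤ p ^- N
      close m n N≤m N≤n with ℚ.∣p∣≡p∨∣p∣≡-p (P m ℚ.- P n)
      ... | inj₁ eq = subst (ℚ._≤ p ^- N) (sym eq) (P-close N m n N≤m N≤n)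
      ... | inj₂ eq = subst (ℚ._≤ p ^- N) (sym (trans eq (neg-diff (P m) (P n))))
                        (P-close N n m N≤n N≤m)

  -- ∏_{i ≥ 1} (1 - p⁻ⁱ), as the limit of its partial products
  ∏₁∞[1-_^-] : ℝ
  seq    ∏₁∞[1-_^-] m = ∏₁ m (λ i → 1ℚ ℚ.- p ^- i)
  cauchy ∏₁∞[1-_^-]   = P-cauchy

-- Residues modulo p are represented by Fin p.
module _ {p : ℕ} {{isPrime : Prime p}} where

  private
    instance
      p≢0 : ℕ.NonZero p
      p≢0 = prime⇒nonZero isPrime

  0ₚ : Fin p
  0ₚ = 0 mod p

  infixl 6 _+ₚ_
  infixl 7 _*ₚ_

  _+ₚ_ _*ₚ_ : Fin p → Fin p → Fin p
  a +ₚ b = (toℕ a ℕ.+ toℕ b) mod p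
  a *ₚ b = (toℕ a ℕ.* toℕ b) mod p

  +ₚ-rawMonoid : RawMonoid 0ℓ 0ℓ
  +ₚ-rawMonoid = record { Carrier = Fin p ; _≈_ = _≡_ ; _∙_ = _+ₚ_ ; ε = 0ₚ }

  ∑ₚ : ∀ {n} → (Fin n → Fin p) → Fin p
  ∑ₚ = RawMonoidDefs.sum +ₚ-rawMonoid

Matrix : ℕ → ℕ → ℕ → Set
Matrix p m n = Vec (Vec (Fin p) n) m

entry : ∀ {p m n} → Matrix p m n → Fin m → Fin n → Fin p
entry A i j = lookup (lookup A i) j

vectors : ∀ {a} {A : Set a} → List A → (n : ℕ) → List (Vec A n)
vectors xs zero    = [] ∷ []
vectors xs (suc n) = cartesianProductWith _∷_ xs (vectors xs n)

matrices : ∀ p m n → List (Matrix p m n)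
matrices p m n = vectors (vectors (allFin p) n) m

subsets : ∀ n → List (Subset n)
subsets = vectors (inside ∷ outside ∷ [])

module _ {p : ℕ} {{isPrime : Prime p}} {m n : ℕ} where

  -- Linear independence of the columns with index in S: a relation among them
  -- is a coefficient vector on all columns that vanishes outside S.
  IndependentColumns : Matrix p m n → Pred (Subset n) 0ℓ
  IndependentColumns A S =
    (c : Vec (Fin p) n) → (∀ j → j ∉ S → lookup c j ≡ 0ₚ) →
    (∀ i → ∑ₚ (λ j → lookup c j *ₚ entry A i j) ≡ 0ₚ) →
    ∀ j → lookup c j ≡ 0ₚ

  private
    allVec? : ∀ {k} {P : Pred (Vec (Fin p) k) 0ℓ} → Decidable P → Dec (∀ v → P v)
    allVec? {zero}  P? = map′ (λ { q [] → q }) (λ f → f []) (P? [])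
    allVec? {suc k} P? = map′ (λ { f (x ∷ v) → f x v }) (λ f x v → f (x ∷ v))
      (Fin.all? (λ x → allVec? (λ v → P? (x ∷ v))))

  independentColumns? : (A : Matrix p m n) → Decidable (IndependentColumns A)
  independentColumns? A S = allVec? λ c →
    Fin.all? (λ j → ¬? (j ∈? S) →-dec (lookup c j Fin.≟ 0ₚ)) →-dec
    (Fin.all? (λ i → ∑ₚ (λ j → lookup c j *ₚ entry A i j) Fin.≟ 0ₚ) →-dec
    Fin.all? (λ j → lookup c j Fin.≟ 0ₚ))

  -- The maximal number of linearly independent columns; the empty set is always
  -- independent, so the base value 0 is attained.
  rank : Matrix p m n → ℕ
  rank A = max 0 (List.map ∣_∣ (filter (independentColumns? A) (subsets n)))

-- A random variable with values in the finite set of matrices, given by its law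
record RandomMatrix (p m n : ℕ) : Set where
  field
    law    : Matrix p m n → ℝ
    nonneg : ∀ A → 0ℝ ≤ℝ law A
    total  : ∑ℝ (List.map law (matrices p m n)) ≃ℝ 1ℝ

open RandomMatrix public

module _ {p m n : ℕ} where

  ℙ : RandomMatrix p m n → {E : Pred (Matrix p m n) 0ℓ} → Decidable E → ℝ
  ℙ M E? = ∑ℝ (List.map (law M) (filter E? (matrices p m n)))

  ℙ[entry≡] : RandomMatrix p m n → Fin m → Fin n → Fin p → ℝ
  ℙ[entry≡] M i j r = ℙ M (λ A → entry A i j Fin.≟ r)

  record IsBalanced (ε : ℝ) (M : RandomMatrix p m n) : Set where
    field
      -- For discrete random variables, independence is the factorisation of
      -- the joint law into the marginals.
      independent : ∀ A → law M A ≃ℝ ∏ℝ (λ i → ∏ℝ (λ j → ℙ[entry≡] M i j (entry A i j)))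
      bounded     : ∀ i j r → ℙ[entry≡] M i j r ≤ℝ 1ℝ -ℝ ε

{-# OPTIONS --safe #-}

-- Expose the rows one at a time and follow the dimension d of their common kernel K. A new
-- row x either contains K in its orthogonal complement or lowers d by one; for a uniform x
-- the former has probability p⁻ᵈ. For a balanced x it has probability at most (1 - ε)ᵈ, so all
-- rows but the last C may be replaced by uniform ones at a cost of O((1 - ε)^C). For the
-- last C rows, counting the w ∈ K with w ∙ x = 0 gives
--
--   (p - 1) (|K| ℙ(x ⊥ K) - 1) = ∑_{0 ≠ w ∈ K} (p ℙ(w ∙ x = 0) - 1).
--
-- Here w ∙ x is nearly equidistributed if w has many nonzero entries, since each of them
-- contracts the L² distance to the uniform law on ℤ/p, and the expected number of vectors
-- w ∈ K with few nonzero entries is exponentially small in n. Hence d is distributed as for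
-- uniform matrices, where the recursion over the rows has a closed solution.
--
-- All of this happens over ℚ; the real laws enter through rational approximations.

module Submission where

open import Defs

-- The rate `decay ε` of the L² contraction may be close to 1, and the bound `(1 - ε) ^ c` on the
-- chance that a given w lies in the kernel is then too weak to sum `decay ε ^ weight w` over all w.
-- Hence the bias of `w ∙ x` is bounded by `η + C * r ^ weight w` with `r = ε / p`: the constant η
-- survives because it is averaged over K, and r is so small that the sum stays below
-- `((1 - ε) (1 + ε)) ^ n` up to a constant factor. The price is a fixed error per late row; since
-- the number of late rows is settled before η and n, this error can still be made small. Taking ε
-- at most ½ gives `p⁻¹ ≤ 1 - ε`, so that uniform rows obey the same bound as balanced ones. The
-- contraction rests on two independent samples of an entry: they differ with probability at least
-- ε, and convolution loses half the mean variation along their difference. The rational laws that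
-- stand in for the real ones change with n and with the index of the Cauchy sequences, so every
-- rational estimate has to be uniform over all balanced laws.

module RankDistribution where

  open import Algebra.Bundles using (CommutativeRing)
  import Algebra.Definitions.RawMonoid as RawMonoidDefs
  import Algebra.Properties.Ring as RingProperties
  import Algebra.Solver.Ring.NaturalCoefficients.Default as SemiringSolver
  open import Data.Bool.Base using (if_then_else_)
  open import Data.Fin.Base using (Fin; zero; suc; toℕ)
  open import Data.Fin.Permutation using (permutation)
  import Data.Fin.Properties as Fin
  open import Data.Fin.Subset using (Subset; inside; outside; _∉_) renaming (∣_∣ to card)
  import Data.Integer.Base as ℤ
  import Data.Integer.Properties as ℤ
  open import Data.List.Base as List using (List; []; _∷_; allFin; cartesianProductWith; filter; length)
  open import Data.List.Extrema.Nat using (max≈v⁺)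
  open import Data.List.Membership.Propositional using (_∈_)
  open import Data.List.Membership.Propositional.Properties
    using (∈-allFin; ∈-cartesianProductWith⁺; ∈-filter⁺; ∈-filter⁻; ∈-map⁺; ∈-map⁻)
  open import Data.List.Properties using (length-map)
  open import Data.List.Relation.Unary.All as All using (All; []; _∷_)
  open import Data.List.Relation.Unary.Any using (here; there)
  import Data.Nat.Base as ℕ
  open ℕ using (ℕ; zero; suc)
  open import Data.Nat.Coprimality using (prime⇒coprime; coprime-Bézout)
  open import Data.Nat.DivMod
    using (_%_; _mod_; %-distribˡ-+; %-distribˡ-*; m<n⇒m%n≡m; n%n≡0; m*n%n≡0; m%n<n)
  open import Data.Nat.GCD using (module Bézout)
  open import Data.Nat.Primality using (Prime; prime⇒nonZero; prime⇒nonTrivial)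
  import Data.Nat.Properties as ℕ
  open import Data.Product.Base using (∃-syntax; _×_; _,_; proj₁; proj₂)
  import Data.Rational.Base as ℚ
  import Data.Rational.Properties as ℚ
  open import Data.Rational.Solver using (module +-*-Solver)
  import Data.Rational.Unnormalised.Base as ℚᵘ
  import Data.Rational.Unnormalised.Properties as ℚᵘ
  open import Data.Sum.Base using (inj₁; inj₂)
  open import Data.Unit.Base using (⊤; tt)
  open import Data.Vec.Base as Vec using (Vec; []; _∷_; here; there; lookup; replicate; zipWith)
  open import Data.Vec.Properties using (lookup-replicate; lookup-zipWith; ≡-dec)
  open import Function.Base using (_∘_)
  open import Level using (0ℓ)
  open import Relation.Binary.PropositionalEquality hiding ([_])
  open import Relation.Nullary using (Dec; yes; no; ¬_; does; contradiction)
  open import Relation.Nullary.Decidable using (map′; ¬?; _×-dec_; decidable-stable)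
  open import Relation.Unary using (Pred; Decidable)
  open import Data.Rational.Base using (ℚ; mkℚ; 0ℚ; 1ℚ; ½; _+_; _*_; _-_; -_; _≤_; _<_; ∣_∣)
  open +-*-Solver using (solve; con; _:+_; _:*_; _:-_; :-_; _:=_)
  open import Algebra.Properties.Semiring.Exp (CommutativeRing.semiring ℚ.+-*-commutativeRing)
    using (_^_; ^-homo-*)
  open import Algebra.Properties.CommutativeSemiring.Exp (CommutativeRing.commutativeSemiring ℚ.+-*-commutativeRing)
    using (^-distrib-*)
  open import Algebra.Properties.Semiring.Sum (CommutativeRing.semiring ℚ.+-*-commutativeRing)
    using (sum; sum-cong-≗; sum-permute; ∑-comm; ∑-distrib-+; *-distribˡ-sum; *-distribʳ-sum)

  -- Rational arithmetic

  p≤q⇒0≤q-p : ∀ {p q} → p ≤ q → 0ℚ ≤ q - p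
  p≤q⇒0≤q-p {p} {q} p≤q = subst (_≤ q - p) (ℚ.+-inverseʳ p) (ℚ.+-monoˡ-≤ (- p) p≤q)

  p<q⇒0<q-p : ∀ {p q} → p < q → 0ℚ < q - p
  p<q⇒0<q-p {p} {q} p<q = subst (_< q - p) (ℚ.+-inverseʳ p) (ℚ.+-monoˡ-< (- p) p<q)

  p+r≡q⇒p≤q : ∀ {p q} r → p + r ≡ q → 0ℚ ≤ r → p ≤ q
  p+r≡q⇒p≤q {p} {q} r eq 0≤r = subst₂ _≤_ (ℚ.+-identityʳ p) eq (ℚ.+-monoʳ-≤ p 0≤r)

  p+r≡q⇒p<q : ∀ {p q} r → p + r ≡ q → 0ℚ < r → p < q
  p+r≡q⇒p<q {p} {q} r eq 0<r = subst₂ _<_ (ℚ.+-identityʳ p) eq (ℚ.+-monoʳ-< p 0<r)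

  0≤q-p⇒p≤q : ∀ {p q} → 0ℚ ≤ q - p → p ≤ q
  0≤q-p⇒p≤q {p} {q} = p+r≡q⇒p≤q (q - p) (solve 2 (λ p q → p :+ (q :- p) := q) refl p q)

  0≤1 : 0ℚ ≤ 1ℚ
  0≤1 = ℚ.nonNegative⁻¹ 1ℚ

  0<1 : 0ℚ < 1ℚ
  0<1 = ℚ.positive⁻¹ 1ℚ

  0≤p+q : ∀ {p q} → 0ℚ ≤ p → 0ℚ ≤ q → 0ℚ ≤ p + q
  0≤p+q = ℚ.+-mono-≤

  0≤p*q : ∀ {p q} → 0ℚ ≤ p → 0ℚ ≤ q → 0ℚ ≤ p * q
  0≤p*q {p} {q} 0≤p 0≤q = ℚ.nonNegative⁻¹ (p * q)
    {{ℚ.nonNeg*nonNeg⇒nonNeg p {{ℚ.nonNegative 0≤p}} q {{ℚ.nonNegative 0≤q}}}}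

  0<p*q : ∀ {p q} → 0ℚ < p → 0ℚ < q → 0ℚ < p * q
  0<p*q {p} {q} 0<p 0<q = ℚ.positive⁻¹ (p * q)
    {{ℚ.pos*pos⇒pos p {{ℚ.positive 0<p}} q {{ℚ.positive 0<q}}}}

  *-monoˡ-≤ : ∀ {p q r} → 0ℚ ≤ r → p ≤ q → r * p ≤ r * q
  *-monoˡ-≤ {r = r} 0≤r = ℚ.*-monoˡ-≤-nonNeg r {{ℚ.nonNegative 0≤r}}

  *-monoʳ-≤ : ∀ {p q r} → 0ℚ ≤ r → p ≤ q → p * r ≤ q * r
  *-monoʳ-≤ {r = r} 0≤r = ℚ.*-monoʳ-≤-nonNeg r {{ℚ.nonNegative 0≤r}}

  *-mono-≤ : ∀ {p q r s} → 0ℚ ≤ r → 0ℚ ≤ q → p ≤ q → r ≤ s → p * r ≤ q * s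
  *-mono-≤ 0≤r 0≤q p≤q r≤s = ℚ.≤-trans (*-monoʳ-≤ 0≤r p≤q) (*-monoˡ-≤ 0≤q r≤s)

  *-cancelˡ-≤ : ∀ {p q} r → 0ℚ < r → r * p ≤ r * q → p ≤ q
  *-cancelˡ-≤ r 0<r = ℚ.*-cancelˡ-≤-pos r {{ℚ.positive 0<r}}

  *-cancelˡ-≡ : ∀ {p q} r → 0ℚ < r → r * p ≡ r * q → p ≡ q
  *-cancelˡ-≡ r 0<r eq = ℚ.≤-antisym (*-cancelˡ-≤ r 0<r (ℚ.≤-reflexive eq))
    (*-cancelˡ-≤ r 0<r (ℚ.≤-reflexive (sym eq)))

  p*q≤p : ∀ {p q} → 0ℚ ≤ p → q ≤ 1ℚ → p * q ≤ p
  p*q≤p {p} {q} 0≤p q≤1 = subst (p * q ≤_) (ℚ.*-identityʳ p) (*-monoˡ-≤ 0≤p q≤1)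

  p≤q+p : ∀ {p q} → 0ℚ ≤ q → p ≤ q + p
  p≤q+p {p} {q} 0≤q = subst (_≤ q + p) (ℚ.+-identityˡ p) (ℚ.+-monoˡ-≤ p 0≤q)

  p≤p+q : ∀ {p q} → 0ℚ ≤ q → p ≤ p + q
  p≤p+q {p} {q} 0≤q = subst (_≤ p + q) (ℚ.+-identityʳ p) (ℚ.+-monoʳ-≤ p 0≤q)

  p≤∣p∣ : ∀ p → p ≤ ∣ p ∣
  p≤∣p∣ p with ℚ.≤-total 0ℚ p
  ... | inj₁ 0≤p = ℚ.≤-reflexive (sym (ℚ.0≤p⇒∣p∣≡p 0≤p))
  ... | inj₂ p≤0 = ℚ.≤-trans p≤0 (ℚ.0≤∣p∣ p)

  -p≤∣p∣ : ∀ p → - p ≤ ∣ p ∣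
  -p≤∣p∣ p = subst (- p ≤_) (ℚ.∣-p∣≡∣p∣ p) (p≤∣p∣ (- p))

  ∣p∣≤ : ∀ {p q} → p ≤ q → - p ≤ q → ∣ p ∣ ≤ q
  ∣p∣≤ {p} p≤q -p≤q with ℚ.∣p∣≡p∨∣p∣≡-p p
  ... | inj₁ eq = subst (_≤ _) (sym eq) p≤q
  ... | inj₂ eq = subst (_≤ _) (sym eq) -p≤q

  ∣p-q∣≡∣q-p∣ : ∀ p q → ∣ p - q ∣ ≡ ∣ q - p ∣
  ∣p-q∣≡∣q-p∣ p q = trans (sym (ℚ.∣-p∣≡∣p∣ (p - q)))
    (cong ∣_∣ (solve 2 (λ p q → :- (p :- q) := q :- p) refl p q))

  ∣p-r∣≤ : ∀ p q r {a b} → ∣ p - q ∣ ≤ a → ∣ q - r ∣ ≤ b → ∣ p - r ∣ ≤ a + b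
  ∣p-r∣≤ p q r {a} {b} pq qr = begin
    ∣ p - r ∣               ≡⟨ cong ∣_∣ (solve 3 (λ p q r → p :- r := (p :- q) :+ (q :- r)) refl p q r) ⟩
    ∣ (p - q) + (q - r) ∣   ≤⟨ ℚ.∣p+q∣≤∣p∣+∣q∣ (p - q) (q - r) ⟩
    ∣ p - q ∣ + ∣ q - r ∣   ≤⟨ ℚ.+-mono-≤ pq qr ⟩
    a + b                   ∎
    where open ℚ.≤-Reasoning

  ∣p-q∣≤r⇒p≤q+r : ∀ p q {r} → ∣ p - q ∣ ≤ r → p ≤ q + r
  ∣p-q∣≤r⇒p≤q+r p q {r} h = begin
    p              ≡⟨ solve 2 (λ p q → p := q :+ (p :- q)) refl p q ⟩
    q + (p - q)    ≤⟨ ℚ.+-monoʳ-≤ q (ℚ.≤-trans (p≤∣p∣ (p - q)) h) ⟩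
    q + r          ∎
    where open ℚ.≤-Reasoning

  ∣p-q∣≤⊔ : ∀ {p q r} → 0ℚ ≤ p → 0ℚ ≤ q → p ≤ r → q ≤ r → ∣ p - q ∣ ≤ r
  ∣p-q∣≤⊔ {p} {q} {r} 0≤p 0≤q p≤r q≤r = ∣p∣≤
    (ℚ.≤-trans (subst (p - q ≤_) (ℚ.+-identityʳ p) (ℚ.+-monoʳ-≤ p (ℚ.neg-antimono-≤ 0≤q))) p≤r)
    (ℚ.≤-trans (p+r≡q⇒p≤q p (solve 2 (λ p q → :- (p :- q) :+ p := q) refl p q) 0≤p) q≤r)

  0≤p*p : ∀ p → 0ℚ ≤ p * p
  0≤p*p p with ℚ.≤-total 0ℚ p
  ... | inj₁ 0≤p = 0≤p*q 0≤p 0≤p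
  ... | inj₂ p≤0 = subst (0ℚ ≤_) (solve 1 (λ p → (:- p) :* (:- p) := p :* p) refl p)
    (0≤p*q (ℚ.neg-antimono-≤ p≤0) (ℚ.neg-antimono-≤ p≤0))

  ∣p∣*∣p∣≡p*p : ∀ p → ∣ p ∣ * ∣ p ∣ ≡ p * p
  ∣p∣*∣p∣≡p*p p = trans (sym (ℚ.∣p*q∣≡∣p∣*∣q∣ p p)) (ℚ.0≤p⇒∣p∣≡p (0≤p*p p))

  0≤^ : ∀ {q} n → 0ℚ ≤ q → 0ℚ ≤ q ^ n
  0≤^ zero    0≤q = 0≤1
  0≤^ (suc n) 0≤q = 0≤p*q 0≤q (0≤^ n 0≤q)

  0<^ : ∀ {q} n → 0ℚ < q → 0ℚ < q ^ n
  0<^ zero    0<q = 0<1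
  0<^ (suc n) 0<q = 0<p*q 0<q (0<^ n 0<q)

  ^≤1 : ∀ {q} n → 0ℚ ≤ q → q ≤ 1ℚ → q ^ n ≤ 1ℚ
  ^≤1 zero    0≤q q≤1 = ℚ.≤-refl
  ^≤1 (suc n) 0≤q q≤1 = ℚ.≤-trans (p*q≤p 0≤q (^≤1 n 0≤q q≤1)) q≤1

  1≤^ : ∀ {q} n → 1ℚ ≤ q → 1ℚ ≤ q ^ n
  1≤^ zero    1≤q = ℚ.≤-refl
  1≤^ (suc n) 1≤q = *-mono-≤ 0≤1 (ℚ.≤-trans 0≤1 1≤q) 1≤q (1≤^ n 1≤q)

  ^-anti : ∀ {q m n} → 0ℚ ≤ q → q ≤ 1ℚ → m ℕ.≤ n → q ^ n ≤ q ^ m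
  ^-anti {q} {m} {n} 0≤q q≤1 m≤n = subst (λ k → q ^ k ≤ q ^ m) (ℕ.m+[n∸m]≡n m≤n)
    (subst (_≤ q ^ m) (sym (^-homo-* q m (n ℕ.∸ m))) (p*q≤p (0≤^ m 0≤q) (^≤1 (n ℕ.∸ m) 0≤q q≤1)))

  ^-monoˡ : ∀ {q r} n → 0ℚ ≤ q → q ≤ r → q ^ n ≤ r ^ n
  ^-monoˡ zero    0≤q q≤r = ℚ.≤-refl
  ^-monoˡ (suc n) 0≤q q≤r = *-mono-≤ (0≤^ n 0≤q) (ℚ.≤-trans 0≤q q≤r) q≤r (^-monoˡ n 0≤q q≤r)

  ι : ℕ → ℚ
  ι n = ℤ.+ n ℚ./ 1

  toℚᵘ-ι : ∀ n → ℚ.toℚᵘ (ι n) ℚᵘ.≃ ℚᵘ.mkℚᵘ (ℤ.+ n) 0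
  toℚᵘ-ι n = ℚ.toℚᵘ-fromℚᵘ (ℚᵘ.mkℚᵘ (ℤ.+ n) 0)

  ι-+ : ∀ m n → ι (m ℕ.+ n) ≡ ι m + ι n
  ι-+ m n = ℚ.toℚᵘ-injective (begin
    ℚ.toℚᵘ (ι (m ℕ.+ n))                            ≈⟨ toℚᵘ-ι (m ℕ.+ n) ⟩
    ℚᵘ.mkℚᵘ (ℤ.+ (m ℕ.+ n)) 0                       ≈⟨ ℚᵘ.*≡* (cong (λ t → t ℤ.* ℤ.+ 1)
                                                         (cong₂ ℤ._+_ (sym (ℤ.*-identityʳ (ℤ.+ m))) (sym (ℤ.*-identityʳ (ℤ.+ n))))) ⟩
    ℚᵘ.mkℚᵘ (ℤ.+ m) 0 ℚᵘ.+ ℚᵘ.mkℚᵘ (ℤ.+ n) 0        ≈⟨ ℚᵘ.+-cong (toℚᵘ-ι m) (toℚᵘ-ι n) ⟨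
    ℚ.toℚᵘ (ι m) ℚᵘ.+ ℚ.toℚᵘ (ι n)                  ≈⟨ ℚ.toℚᵘ-homo-+ (ι m) (ι n) ⟨
    ℚ.toℚᵘ (ι m + ι n)                              ∎)
    where open ℚᵘ.≃-Reasoning

  ι-* : ∀ m n → ι (m ℕ.* n) ≡ ι m * ι n
  ι-* m n = ℚ.toℚᵘ-injective (begin
    ℚ.toℚᵘ (ι (m ℕ.* n))                            ≈⟨ toℚᵘ-ι (m ℕ.* n) ⟩
    ℚᵘ.mkℚᵘ (ℤ.+ (m ℕ.* n)) 0                       ≈⟨ ℚᵘ.*≡* (cong (λ t → t ℤ.* ℤ.+ 1) (ℤ.pos-* m n)) ⟩
    ℚᵘ.mkℚᵘ (ℤ.+ m) 0 ℚᵘ.* ℚᵘ.mkℚᵘ (ℤ.+ n) 0        ≈⟨ ℚᵘ.*-cong (toℚᵘ-ι m) (toℚᵘ-ι n) ⟨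
    ℚ.toℚᵘ (ι m) ℚᵘ.* ℚ.toℚᵘ (ι n)                  ≈⟨ ℚ.toℚᵘ-homo-* (ι m) (ι n) ⟨
    ℚ.toℚᵘ (ι m * ι n)                              ∎)
    where open ℚᵘ.≃-Reasoning

  ι-suc : ∀ n → ι (suc n) ≡ 1ℚ + ι n
  ι-suc n = ι-+ 1 n

  0≤ι : ∀ n → 0ℚ ≤ ι n
  0≤ι n = ℚ.nonNegative⁻¹ (ι n) {{ℚ.normalize-nonNeg n 1}}

  0<ι : ∀ n .{{_ : ℕ.NonZero n}} → 0ℚ < ι n
  0<ι n = ℚ.positive⁻¹ (ι n) {{ℚ.normalize-pos n 1}}

  ι-mono : ∀ {m n} → m ℕ.≤ n → ι m ≤ ι n
  ι-mono {m} {n} m≤n = subst (ι m ≤_) (trans (sym (ι-+ m (n ℕ.∸ m))) (cong ι (ℕ.m+[n∸m]≡n m≤n)))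
    (p≤p+q (0≤ι (n ℕ.∸ m)))

  ι*1/ : ∀ n .{{_ : ℕ.NonZero n}} → ι n * (ℤ.+ 1 ℚ./ n) ≡ 1ℚ
  ι*1/ (suc n) = ℚ.toℚᵘ-injective (begin
    ℚ.toℚᵘ (ι (suc n) * (ℤ.+ 1 ℚ./ suc n))               ≈⟨ ℚ.toℚᵘ-homo-* (ι (suc n)) (ℤ.+ 1 ℚ./ suc n) ⟩
    ℚ.toℚᵘ (ι (suc n)) ℚᵘ.* ℚ.toℚᵘ (ℤ.+ 1 ℚ./ suc n)      ≈⟨ ℚᵘ.*-cong (toℚᵘ-ι (suc n)) (ℚ.toℚᵘ-fromℚᵘ (ℚᵘ.mkℚᵘ (ℤ.+ 1) n)) ⟩
    ℚᵘ.mkℚᵘ (ℤ.+ suc n) 0 ℚᵘ.* ℚᵘ.mkℚᵘ (ℤ.+ 1) n          ≈⟨ ℚᵘ.*≡* (trans (ℤ.*-identityʳ _) (trans (ℤ.*-identityʳ _)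
                                                                (sym (trans (ℤ.*-identityˡ _) (cong ℤ.+_ (ℕ.*-identityˡ (suc n))))))) ⟩
    ℚ.toℚᵘ 1ℚ                                             ∎)
    where open ℚᵘ.≃-Reasoning

  abstract

    archimedean : ∀ q → 0ℚ < q → ∃[ N ] 1ℚ ≤ ι N * q
    archimedean q@(mkℚ (ℤ.+ zero)    d _) 0<q with () ← ℚ.positive 0<q
    archimedean q@(mkℚ ℤ.-[1+ n ]    d _) 0<q with () ← ℚ.positive 0<q
    archimedean q@(mkℚ (ℤ.+ suc n) d _) 0<q = suc d , ℚ.toℚᵘ-cancel-≤ (begin
      ℚ.toℚᵘ 1ℚ                                         ≤⟨ ℚᵘ.*≤* (ℤ.+≤+ cross) ⟩
      ℚᵘ.mkℚᵘ (ℤ.+ suc d) 0 ℚᵘ.* ℚ.toℚᵘ q               ≃⟨ ℚᵘ.*-cong (toℚᵘ-ι (suc d)) (ℚᵘ.≃-refl {ℚ.toℚᵘ q}) ⟨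
      ℚ.toℚᵘ (ι (suc d)) ℚᵘ.* ℚ.toℚᵘ q                  ≃⟨ ℚ.toℚᵘ-homo-* (ι (suc d)) q ⟨
      ℚ.toℚᵘ (ι (suc d) * q)                            ∎)
      where
      open ℚᵘ.≤-Reasoning
      cross : 1 ℕ.* (1 ℕ.* suc d) ℕ.≤ (suc d ℕ.* suc n) ℕ.* 1
      cross = subst₂ ℕ._≤_ (sym (trans (ℕ.*-identityˡ _) (ℕ.*-identityˡ _))) (sym (ℕ.*-identityʳ _))
        (ℕ.m≤m*n (suc d) (suc n))

  -- Bernoulli's inequality with the division cleared; the induction step gives away
  -- `ε * ε * (1ℚ + ι n)` times the power. It provides the explicit threshold in `q^n→0`.
  [1-ε]^n*[1+nε]≤1 : ∀ ε n → 0ℚ ≤ ε → ε ≤ 1ℚ → (1ℚ - ε) ^ n * (1ℚ + ι n * ε) ≤ 1ℚ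
  [1-ε]^n*[1+nε]≤1 ε zero    0≤ε ε≤1 = ℚ.≤-reflexive
    (solve 1 (λ ε → con 1ℚ :* (con 1ℚ :+ con 0ℚ :* ε) := con 1ℚ) refl ε)
  [1-ε]^n*[1+nε]≤1 ε (suc n) 0≤ε ε≤1 = begin
    (1ℚ - ε) * y * (1ℚ + ι (suc n) * ε)
      ≡⟨ cong (λ t → (1ℚ - ε) * y * (1ℚ + t * ε)) (ι-suc n) ⟩
    (1ℚ - ε) * y * (1ℚ + (1ℚ + ι n) * ε)
      ≤⟨ p+r≡q⇒p≤q (y * (ε * ε * (1ℚ + ι n)))
           (solve 3 (λ ε y k → (con 1ℚ :- ε) :* y :* (con 1ℚ :+ (con 1ℚ :+ k) :* ε) :+ y :* (ε :* ε :* (con 1ℚ :+ k))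
             := y :* (con 1ℚ :+ k :* ε)) refl ε y (ι n))
           (0≤p*q (0≤^ n (p≤q⇒0≤q-p ε≤1)) (0≤p*q (0≤p*q 0≤ε 0≤ε) (0≤p+q 0≤1 (0≤ι n)))) ⟩
    y * (1ℚ + ι n * ε)
      ≤⟨ [1-ε]^n*[1+nε]≤1 ε n 0≤ε ε≤1 ⟩
    1ℚ ∎
    where
    open ℚ.≤-Reasoning
    y = (1ℚ - ε) ^ n

  abstract

    q^n→0 : ∀ {q} → 0ℚ ≤ q → q < 1ℚ → ∀ δ → 0ℚ < δ → ∃[ N ] (∀ n → N ℕ.≤ n → q ^ n ≤ δ)
    q^n→0 {q} 0≤q q<1 δ 0<δ with (N , 1≤) ← archimedean (δ * (1ℚ - q)) (0<p*q 0<δ (p<q⇒0<q-p q<1))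
      = N , λ n N≤n → ℚ.≤-trans (^-anti {q} 0≤q (ℚ.<⇒≤ q<1) N≤n) bound
      where
      open ℚ.≤-Reasoning
      ε : ℚ
      ε = 1ℚ - q
      1-ε≡q : 1ℚ - ε ≡ q
      1-ε≡q = solve 1 (λ q → con 1ℚ :- (con 1ℚ :- q) := q) refl q
      bernoulli : q ^ N * (1ℚ + ι N * ε) ≤ 1ℚ
      bernoulli = subst (λ t → t ^ N * (1ℚ + ι N * ε) ≤ 1ℚ) 1-ε≡q
        ([1-ε]^n*[1+nε]≤1 ε N (ℚ.<⇒≤ (p<q⇒0<q-p q<1)) (p+r≡q⇒p≤q q (solve 1 (λ q → con 1ℚ :- q :+ q := con 1ℚ) refl q) 0≤q))
      bound : q ^ N ≤ δ
      bound = begin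
        q ^ N                                  ≡⟨ ℚ.*-identityʳ (q ^ N) ⟨
        q ^ N * 1ℚ                             ≤⟨ *-monoˡ-≤ (0≤^ N 0≤q) 1≤ ⟩
        q ^ N * (ι N * (δ * ε))                ≡⟨ solve 4 (λ y k d e → y :* (k :* (d :* e)) := d :* (y :* (k :* e))) refl (q ^ N) (ι N) δ ε ⟩
        δ * (q ^ N * (ι N * ε))                ≤⟨ *-monoˡ-≤ (ℚ.<⇒≤ 0<δ) (*-monoˡ-≤ (0≤^ N 0≤q) (p≤q+p 0≤1)) ⟩
        δ * (q ^ N * (1ℚ + ι N * ε))           ≤⟨ p*q≤p (ℚ.<⇒≤ 0<δ) bernoulli ⟩
        δ                                      ∎

  -- Finite sums and integrals

  𝟙 : {P : Set} → Dec P → ℚ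
  𝟙 P? = if does P? then 1ℚ else 0ℚ

  𝟙-yes : {P : Set} (P? : Dec P) → P → 𝟙 P? ≡ 1ℚ
  𝟙-yes (yes _) _ = refl
  𝟙-yes (no ¬p) p = contradiction p ¬p

  𝟙-no : {P : Set} (P? : Dec P) → ¬ P → 𝟙 P? ≡ 0ℚ
  𝟙-no (yes p) ¬p = contradiction p ¬p
  𝟙-no (no _)  _  = refl

  0≤𝟙 : {P : Set} (P? : Dec P) → 0ℚ ≤ 𝟙 P?
  0≤𝟙 (yes _) = 0≤1
  0≤𝟙 (no _)  = ℚ.≤-refl

  𝟙≤1 : {P : Set} (P? : Dec P) → 𝟙 P? ≤ 1ℚ
  𝟙≤1 (yes _) = ℚ.≤-refl
  𝟙≤1 (no _)  = 0≤1

  𝟙-cong : {P Q : Set} (P? : Dec P) (Q? : Dec Q) → (P → Q) → (Q → P) → 𝟙 P? ≡ 𝟙 Q?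
  𝟙-cong (yes p) Q? P⇒Q Q⇒P = sym (𝟙-yes Q? (P⇒Q p))
  𝟙-cong (no ¬p) Q? P⇒Q Q⇒P = sym (𝟙-no Q? (¬p ∘ Q⇒P))

  𝟙-mono : {P Q : Set} (P? : Dec P) (Q? : Dec Q) → (P → Q) → 𝟙 P? ≤ 𝟙 Q?
  𝟙-mono (yes p) Q? P⇒Q = ℚ.≤-reflexive (sym (𝟙-yes Q? (P⇒Q p)))
  𝟙-mono (no ¬p) Q? P⇒Q = 0≤𝟙 Q?

  sum-mono : ∀ {n} {f g : Fin n → ℚ} → (∀ i → f i ≤ g i) → sum f ≤ sum g
  sum-mono {zero}  f≤g = ℚ.≤-refl
  sum-mono {suc n} f≤g = ℚ.+-mono-≤ (f≤g zero) (sum-mono (f≤g ∘ suc))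

  sum-const : ∀ n c → sum {n} (λ _ → c) ≡ ι n * c
  sum-const zero    c = sym (ℚ.*-zeroˡ c)
  sum-const (suc n) c = begin
    c + sum {n} (λ _ → c)    ≡⟨ cong (c +_) (sum-const n c) ⟩
    c + ι n * c              ≡⟨ solve 2 (λ c k → c :+ k :* c := (con 1ℚ :+ k) :* c) refl c (ι n) ⟩
    (1ℚ + ι n) * c           ≡⟨ cong (_* c) (ι-suc n) ⟨
    ι (suc n) * c            ∎
    where open ≡-Reasoning

  sum-zero : ∀ {n} {f : Fin n → ℚ} → (∀ i → f i ≡ 0ℚ) → sum f ≡ 0ℚ
  sum-zero {n} f≡0 = trans (sum-cong-≗ f≡0) (trans (sum-const n 0ℚ) (ℚ.*-zeroʳ (ι n)))

  sum-single : ∀ {n} (f : Fin n → ℚ) i → (∀ j → j ≢ i → f j ≡ 0ℚ) → sum f ≡ f i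
  sum-single f zero    f≡0 = trans (cong (f zero +_) (sum-zero (λ j → f≡0 (suc j) (λ ())))) (ℚ.+-identityʳ (f zero))
  sum-single f (suc i) f≡0 = trans
    (cong₂ _+_ (f≡0 zero (λ ())) (sum-single (f ∘ suc) i (λ j j≢i → f≡0 (suc j) λ { refl → j≢i refl })))
    (ℚ.+-identityˡ (f (suc i)))

  -- Positive linear functionals: probability laws (those of total mass 1), but also
  -- the counting measures.
  record Integral (X : Set) : Set where
    field
      ∫      : (X → ℚ) → ℚ
      ∫-+    : ∀ f g → ∫ (λ x → f x + g x) ≡ ∫ f + ∫ g
      ∫-*    : ∀ c f → ∫ (λ x → c * f x) ≡ c * ∫ f
      ∫-mono : ∀ {f g} → (∀ x → f x ≤ g x) → ∫ f ≤ ∫ g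

    ∫-cong : ∀ {f g} → (∀ x → f x ≡ g x) → ∫ f ≡ ∫ g
    ∫-cong f≗g = ℚ.≤-antisym (∫-mono (ℚ.≤-reflexive ∘ f≗g)) (∫-mono (ℚ.≤-reflexive ∘ sym ∘ f≗g))

    ∫-0 : ∫ (λ _ → 0ℚ) ≡ 0ℚ
    ∫-0 = trans (∫-cong (λ _ → sym (ℚ.*-zeroˡ 0ℚ))) (trans (∫-* 0ℚ (λ _ → 0ℚ)) (ℚ.*-zeroˡ (∫ (λ _ → 0ℚ))))

    ∫-*ʳ : ∀ c f → ∫ (λ x → f x * c) ≡ ∫ f * c
    ∫-*ʳ c f = trans (∫-cong (λ x → ℚ.*-comm (f x) c)) (trans (∫-* c f) (ℚ.*-comm c (∫ f)))

    ∫-neg : ∀ f → ∫ (λ x → - f x) ≡ - ∫ f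
    ∫-neg f = trans (∫-cong (λ x → neg (f x))) (trans (∫-* (- 1ℚ) f) (sym (neg (∫ f))))
      where
      neg : ∀ q → - q ≡ (- 1ℚ) * q
      neg = solve 1 (λ q → :- q := (:- (con 1ℚ)) :* q) refl

    ∫-sub : ∀ f g → ∫ (λ x → f x - g x) ≡ ∫ f - ∫ g
    ∫-sub f g = trans (∫-+ f (λ x → - g x)) (cong (∫ f +_) (∫-neg g))

    ∫-nonneg : ∀ {f} → (∀ x → 0ℚ ≤ f x) → 0ℚ ≤ ∫ f
    ∫-nonneg {f} 0≤f = subst (_≤ ∫ f) ∫-0 (∫-mono 0≤f)

    ∣∫∣≤ : ∀ f → ∣ ∫ f ∣ ≤ ∫ (λ x → ∣ f x ∣)
    ∣∫∣≤ f = ∣p∣≤ (∫-mono (λ x → p≤∣p∣ (f x)))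
      (subst (_≤ ∫ (λ x → ∣ f x ∣)) (∫-neg f) (∫-mono (λ x → -p≤∣p∣ (f x))))

    ∫-sum : ∀ {n} (f : Fin n → X → ℚ) → ∫ (λ x → sum (λ i → f i x)) ≡ sum (λ i → ∫ (f i))
    ∫-sum {zero}  f = ∫-0
    ∫-sum {suc n} f = trans (∫-+ (f zero) _) (cong (∫ (f zero) +_) (∫-sum (f ∘ suc)))

    IsProbability : Set
    IsProbability = ∫ (λ _ → 1ℚ) ≡ 1ℚ

    ∫-const : IsProbability → ∀ c → ∫ (λ _ → c) ≡ c
    ∫-const ∫1≡1 c = begin
      ∫ (λ _ → c)          ≡⟨ ∫-cong (λ _ → sym (ℚ.*-identityʳ c)) ⟩
      ∫ (λ _ → c * 1ℚ)     ≡⟨ ∫-* c (λ _ → 1ℚ) ⟩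
      c * ∫ (λ _ → 1ℚ)     ≡⟨ cong (c *_) ∫1≡1 ⟩
      c * 1ℚ               ≡⟨ ℚ.*-identityʳ c ⟩
      c                    ∎
      where open ≡-Reasoning

  open Integral public

  weighted : ∀ {n} (μ : Fin n → ℚ) → (∀ i → 0ℚ ≤ μ i) → Integral (Fin n)
  weighted μ 0≤μ = record
    { ∫      = λ f → sum (λ i → μ i * f i)
    ; ∫-+    = λ f g → trans (sum-cong-≗ (λ i → ℚ.*-distribˡ-+ (μ i) (f i) (g i)))
                             (∑-distrib-+ (λ i → μ i * f i) (λ i → μ i * g i))
    ; ∫-*    = λ c f → trans
        (sum-cong-≗ (λ i → solve 3 (λ m c x → m :* (c :* x) := c :* (m :* x)) refl (μ i) c (f i)))
        (sym (*-distribˡ-sum c (λ i → μ i * f i)))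
    ; ∫-mono = λ f≤g → sum-mono (λ i → *-monoˡ-≤ (0≤μ i) (f≤g i))
    }

  counting : ∀ n → Integral (Fin n)
  counting n = record
    { ∫      = sum
    ; ∫-+    = ∑-distrib-+
    ; ∫-*    = λ c f → sym (*-distribˡ-sum c f)
    ; ∫-mono = sum-mono
    }

  -- The tail is the outer variable of integration, so that the head is exposed last.
  iterated : ∀ {X : Set} {n} → (Fin n → Integral X) → Integral (Vec X n)
  iterated {n = zero}  I = record
    { ∫ = λ f → f [] ; ∫-+ = λ _ _ → refl ; ∫-* = λ _ _ → refl ; ∫-mono = λ f≤g → f≤g [] }
  iterated {n = suc n} I = record
    { ∫      = λ f → ∫ T (λ v → ∫ H (λ x → f (x ∷ v)))
    ; ∫-+    = λ f g → trans (∫-cong T (λ v → ∫-+ H (λ x → f (x ∷ v)) (λ x → g (x ∷ v)))) (∫-+ T _ _)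
    ; ∫-*    = λ c f → trans (∫-cong T (λ v → ∫-* H c (λ x → f (x ∷ v)))) (∫-* T c _)
    ; ∫-mono = λ f≤g → ∫-mono T (λ v → ∫-mono H (λ x → f≤g (x ∷ v)))
    }
    where
    H = I zero
    T = iterated (I ∘ suc)

  iterated-isProbability : ∀ {X : Set} {n} (I : Fin n → Integral X) →
    (∀ i → IsProbability (I i)) → IsProbability (iterated I)
  iterated-isProbability {n = zero}  I prob = refl
  iterated-isProbability {n = suc n} I prob = trans
    (∫-cong (iterated (I ∘ suc)) (λ _ → prob zero)) (iterated-isProbability (I ∘ suc) (prob ∘ suc))

  countingVec : ∀ p m → Integral (Vec (Fin p) m)
  countingVec p m = iterated {n = m} (λ _ → counting p)

  ∫-countingVec : ∀ {X : Set} (I : Integral X) p m (f : X → Vec (Fin p) m → ℚ) →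
    ∫ I (λ x → ∫ (countingVec p m) (f x)) ≡ ∫ (countingVec p m) (λ v → ∫ I (λ x → f x v))
  ∫-countingVec I p zero    f = refl
  ∫-countingVec I p (suc m) f = trans
    (∫-countingVec I p m (λ x v → sum (λ a → f x (a ∷ v))))
    (∫-cong (countingVec p m) (λ v → ∫-sum I (λ a x → f x (a ∷ v))))

  sum-countingVec : ∀ {n} p m (f : Fin n → Vec (Fin p) m → ℚ) →
    sum (λ i → ∫ (countingVec p m) (f i)) ≡ ∫ (countingVec p m) (λ v → sum (λ i → f i v))
  sum-countingVec p m f = sym (∫-sum (countingVec p m) f)

  term≤sum : ∀ {n} {f : Fin n → ℚ} → (∀ i → 0ℚ ≤ f i) → ∀ i → f i ≤ sum f
  term≤sum {f = f} 0≤f i = subst (_≤ sum f) single (sum-mono below)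
    where
    g : Fin _ → ℚ
    g j = 𝟙 (j Fin.≟ i) * f j
    single : sum g ≡ f i
    single = trans
      (sum-single g i (λ j j≢i → trans (cong (_* f j) (𝟙-no (j Fin.≟ i) j≢i)) (ℚ.*-zeroˡ (f j))))
      (trans (cong (_* f i) (𝟙-yes (i Fin.≟ i) refl)) (ℚ.*-identityˡ (f i)))
    below : ∀ j → g j ≤ f j
    below j = subst (g j ≤_) (ℚ.*-identityˡ (f j)) (*-monoʳ-≤ (0≤f j) (𝟙≤1 (j Fin.≟ i)))

  -- A positive functional on a finite set is a sum of point masses. This yields the exchange law
  -- `∫-swap`, which is not among the axioms of `Integral`.
  ∫-Fin : ∀ {n} (I : Integral (Fin n)) f → ∫ I f ≡ sum (λ i → f i * ∫ I (λ j → 𝟙 (j Fin.≟ i)))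
  ∫-Fin I f = begin
    ∫ I f                                              ≡⟨ ∫-cong I expand ⟩
    ∫ I (λ j → sum (λ i → f i * 𝟙 (j Fin.≟ i)))        ≡⟨ ∫-sum I (λ i j → f i * 𝟙 (j Fin.≟ i)) ⟩
    sum (λ i → ∫ I (λ j → f i * 𝟙 (j Fin.≟ i)))        ≡⟨ sum-cong-≗ (λ i → ∫-* I (f i) (λ j → 𝟙 (j Fin.≟ i))) ⟩
    sum (λ i → f i * ∫ I (λ j → 𝟙 (j Fin.≟ i)))        ∎
    where
    open ≡-Reasoning
    expand : ∀ j → f j ≡ sum (λ i → f i * 𝟙 (j Fin.≟ i))
    expand j = sym (trans
      (sum-single (λ i → f i * 𝟙 (j Fin.≟ i)) j
        (λ i i≢j → trans (cong (f i *_) (𝟙-no (j Fin.≟ i) (i≢j ∘ sym))) (ℚ.*-zeroʳ (f i))))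
      (trans (cong (f j *_) (𝟙-yes (j Fin.≟ j) refl)) (ℚ.*-identityʳ (f j))))

  ∫-swap : ∀ {n} {X : Set} (I : Integral (Fin n)) (J : Integral X) (f : Fin n → X → ℚ) →
    ∫ J (λ x → ∫ I (λ i → f i x)) ≡ ∫ I (λ i → ∫ J (f i))
  ∫-swap I J f = begin
    ∫ J (λ x → ∫ I (λ i → f i x))                ≡⟨ ∫-cong J (λ x → ∫-Fin I (λ i → f i x)) ⟩
    ∫ J (λ x → sum (λ i → f i x * μ i))          ≡⟨ ∫-sum J (λ i x → f i x * μ i) ⟩
    sum (λ i → ∫ J (λ x → f i x * μ i))          ≡⟨ sum-cong-≗ (λ i → ∫-*ʳ J (μ i) (f i)) ⟩
    sum (λ i → ∫ J (f i) * μ i)                  ≡⟨ ∫-Fin I (λ i → ∫ J (f i)) ⟨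
    ∫ I (λ i → ∫ J (f i))                        ∎
    where
    open ≡-Reasoning
    μ : Fin _ → ℚ
    μ i = ∫ I (λ j → 𝟙 (j Fin.≟ i))

  a^n*b^n≡1 : ∀ {a b} n → a * b ≡ 1ℚ → a ^ n * b ^ n ≡ 1ℚ
  a^n*b^n≡1 zero    ab≡1 = refl
  a^n*b^n≡1 {a} {b} (suc n) ab≡1 = begin
    (a * a ^ n) * (b * b ^ n)    ≡⟨ solve 4 (λ a b x y → (a :* x) :* (b :* y) := (a :* b) :* (x :* y)) refl a b (a ^ n) (b ^ n) ⟩
    (a * b) * (a ^ n * b ^ n)    ≡⟨ cong₂ _*_ ab≡1 (a^n*b^n≡1 n ab≡1) ⟩
    1ℚ * 1ℚ                      ≡⟨⟩
    1ℚ                           ∎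
    where open ≡-Reasoning

  ∫-quadratic : ∀ {X : Set} (I : Integral X) → IsProbability I → ∀ a b c (y : X → ℚ) →
    ∫ I (λ t → a + b * y t + c * (y t * y t)) ≡ a + b * ∫ I y + c * ∫ I (λ t → y t * y t)
  ∫-quadratic I prob a b c y = begin
    ∫ I (λ t → a + b * y t + c * (y t * y t))
      ≡⟨ ∫-+ I (λ t → a + b * y t) (λ t → c * (y t * y t)) ⟩
    ∫ I (λ t → a + b * y t) + ∫ I (λ t → c * (y t * y t))
      ≡⟨ cong₂ _+_ (∫-+ I (λ _ → a) (λ t → b * y t)) (∫-* I c (λ t → y t * y t)) ⟩
    ∫ I (λ _ → a) + ∫ I (λ t → b * y t) + c * ∫ I (λ t → y t * y t)
      ≡⟨ cong (_+ c * ∫ I (λ t → y t * y t)) (cong₂ _+_ (∫-const I prob a) (∫-* I b y)) ⟩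
    a + b * ∫ I y + c * ∫ I (λ t → y t * y t) ∎
    where open ≡-Reasoning

  -- Writing the variance with an independent copy keeps the mean out of the integrand, so that the
  -- differences `y t - y t′` can later be read as translations in ℤ/p.
  variance : ∀ {X : Set} (I : Integral X) → IsProbability I → (y : X → ℚ) →
    ∫ I (λ t → ∫ I (λ t′ → (y t - y t′) * (y t - y t′)))
      ≡ ι 2 * ∫ I (λ t → y t * y t) - ι 2 * (∫ I y * ∫ I y)
  variance I prob y = begin
    ∫ I (λ t → ∫ I (λ t′ → (y t - y t′) * (y t - y t′)))
      ≡⟨ ∫-cong I (λ t → trans
           (∫-cong I (λ t′ → solve 2 (λ x z → (x :- z) :* (x :- z)
             := x :* x :+ (:- (con (ι 2) :* x)) :* z :+ con 1ℚ :* (z :* z)) refl (y t) (y t′)))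
           (∫-quadratic I prob (y t * y t) (- (ι 2 * y t)) 1ℚ y)) ⟩
    ∫ I (λ t → y t * y t + (- (ι 2 * y t)) * m + 1ℚ * m₂)
      ≡⟨ ∫-cong I (λ t → solve 3 (λ x m n → x :* x :+ (:- (con (ι 2) :* x)) :* m :+ con 1ℚ :* n
           := n :+ (:- (con (ι 2) :* m)) :* x :+ con 1ℚ :* (x :* x)) refl (y t) m m₂) ⟩
    ∫ I (λ t → m₂ + (- (ι 2 * m)) * y t + 1ℚ * (y t * y t))
      ≡⟨ ∫-quadratic I prob m₂ (- (ι 2 * m)) 1ℚ y ⟩
    m₂ + (- (ι 2 * m)) * m + 1ℚ * m₂
      ≡⟨ solve 2 (λ m n → n :+ (:- (con (ι 2) :* m)) :* m :+ con 1ℚ :* n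
           := con (ι 2) :* n :- con (ι 2) :* (m :* m)) refl m m₂ ⟩
    ι 2 * m₂ - ι 2 * (m * m) ∎
    where
    open ≡-Reasoning
    m  = ∫ I y
    m₂ = ∫ I (λ t → y t * y t)

  p²≤q²⇒∣p∣≤q : ∀ p {q} → 0ℚ ≤ q → p * p ≤ q * q → ∣ p ∣ ≤ q
  p²≤q²⇒∣p∣≤q p {q} 0≤q p²≤q² = ℚ.≮⇒≥ λ q<∣p∣ → ℚ.<-irrefl refl (ℚ.<-≤-trans (begin-strict
    q * q           ≤⟨ *-monoˡ-≤ 0≤q (ℚ.<⇒≤ q<∣p∣) ⟩
    q * ∣ p ∣       <⟨ ℚ.*-monoˡ-<-pos ∣ p ∣ {{ℚ.positive (ℚ.≤-<-trans 0≤q q<∣p∣)}} q<∣p∣ ⟩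
    ∣ p ∣ * ∣ p ∣   ≡⟨ ∣p∣*∣p∣≡p*p p ⟩
    p * p           ∎) p²≤q²)
    where open ℚ.≤-Reasoning

  -- A geometric bound is traded for a constant plus a term of any other rate.
  geometric-split : ∀ {θ κ r} → 0ℚ ≤ θ → θ < 1ℚ → 1ℚ ≤ κ → 0ℚ ≤ r → κ * r ≡ 1ℚ → ∀ η → 0ℚ < η →
    ∃[ C ] (0ℚ ≤ C × (∀ q j → q * q ≤ θ ^ j → ∣ q ∣ ≤ η + C * r ^ j))
  geometric-split {θ} {κ} {r} 0≤θ θ<1 1≤κ 0≤r κr≡1 η 0<η
    with (W , small) ← q^n→0 0≤θ θ<1 (η * η) (0<p*q 0<η 0<η)
    -- As `κ` is the inverse of `r`, the term `κ ^ W * r ^ j` is at least 1 for every `j ≤ W`;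
    -- beyond `W` the hypothesis gives `q * q ≤ η * η`.
    = κ ^ W , 0≤^ W 0≤κ , bound
    where
    open ℚ.≤-Reasoning
    0≤κ : 0ℚ ≤ κ
    0≤κ = ℚ.≤-trans 0≤1 1≤κ
    bound : ∀ q j → q * q ≤ θ ^ j → ∣ q ∣ ≤ η + κ ^ W * r ^ j
    bound q j q²≤θ^j with ℕ.≤-total W j
    ... | inj₁ W≤j = ℚ.≤-trans
      (p²≤q²⇒∣p∣≤q q (ℚ.<⇒≤ 0<η) (ℚ.≤-trans q²≤θ^j (small j W≤j)))
      (p≤p+q (0≤p*q (0≤^ W 0≤κ) (0≤^ j 0≤r)))
    ... | inj₂ j≤W = begin
      ∣ q ∣              ≤⟨ p²≤q²⇒∣p∣≤q q 0≤1 (ℚ.≤-trans q²≤θ^j (^≤1 j 0≤θ (ℚ.<⇒≤ θ<1))) ⟩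
      1ℚ                 ≡⟨ a^n*b^n≡1 j κr≡1 ⟨
      κ ^ j * r ^ j      ≤⟨ *-monoʳ-≤ (0≤^ j 0≤r) κ^j≤κ^W ⟩
      κ ^ W * r ^ j      ≤⟨ p≤q+p (ℚ.<⇒≤ 0<η) ⟩
      η + κ ^ W * r ^ j  ∎
      where
      κ^j≤κ^W : κ ^ j ≤ κ ^ W
      κ^j≤κ^W = begin
        κ ^ j                        ≡⟨ ℚ.*-identityʳ (κ ^ j) ⟨
        κ ^ j * 1ℚ                   ≤⟨ *-monoˡ-≤ (0≤^ j 0≤κ) (1≤^ (W ℕ.∸ j) 1≤κ) ⟩
        κ ^ j * κ ^ (W ℕ.∸ j)        ≡⟨ ^-homo-* κ j (W ℕ.∸ j) ⟨
        κ ^ (j ℕ.+ (W ℕ.∸ j))        ≡⟨ cong (κ ^_) (ℕ.m+[n∸m]≡n j≤W) ⟩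
        κ ^ W                        ∎

  ∫-countingVec-single : ∀ {p m} (f : Vec (Fin p) m → ℚ) v → (∀ w → w ≢ v → f w ≡ 0ℚ) →
    ∫ (countingVec p m) f ≡ f v
  ∫-countingVec-single f [] f≡0 = refl
  ∫-countingVec-single {p} {suc m} f (b ∷ v) f≡0 = trans
    (∫-countingVec-single (λ w → sum (λ a → f (a ∷ w))) v
      (λ w w≢v → sum-zero (λ a → f≡0 (a ∷ w) λ { refl → w≢v refl })))
    (sum-single (λ a → f (a ∷ v)) b (λ a a≢b → f≡0 (a ∷ v) λ { refl → a≢b refl }))

  ∫-countingVec-1 : ∀ p m → ∫ (countingVec p m) (λ _ → 1ℚ) ≡ ι p ^ m
  ∫-countingVec-1 p zero    = refl
  ∫-countingVec-1 p (suc m) = begin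
    ∫ (countingVec p m) (λ _ → sum {p} (λ _ → 1ℚ))   ≡⟨ ∫-cong (countingVec p m) (λ _ → sum-const p 1ℚ) ⟩
    ∫ (countingVec p m) (λ _ → ι p * 1ℚ)             ≡⟨ ∫-* (countingVec p m) (ι p) (λ _ → 1ℚ) ⟩
    ι p * ∫ (countingVec p m) (λ _ → 1ℚ)             ≡⟨ cong (ι p *_) (∫-countingVec-1 p m) ⟩
    ι p * ι p ^ m                                    ∎
    where open ≡-Reasoning

  abstract

    -- Opaque, so that the exhaustive search is never unfolded where `dim` and `ℙ[stay]` branch on
    -- its result.
    anyVec? : ∀ {p m} {P : Vec (Fin p) m → Set} → (∀ w → Dec (P w)) → Dec (∃[ w ] P w)
    anyVec? {m = zero}  P? = map′ (λ h → [] , h) (λ { ([] , h) → h }) (P? [])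
    anyVec? {m = suc m} P? = map′ (λ { (a , w , h) → a ∷ w , h }) (λ { (a ∷ w , h) → a , w , h })
      (Fin.any? (λ a → anyVec? (λ w → P? (a ∷ w))))

  ∈-vectors : ∀ {A : Set} {xs : List A} → (∀ x → x ∈ xs) → ∀ {n} (v : Vec A n) → v ∈ vectors xs n
  ∈-vectors all∈ []      = here refl
  ∈-vectors all∈ (x ∷ v) = ∈-cartesianProductWith⁺ _∷_ (all∈ x) (∈-vectors all∈ v)

  outsides : ∀ {m} → Subset m → List (Fin m)
  outsides []            = []
  outsides (inside  ∷ S) = List.map suc (outsides S)
  outsides (outside ∷ S) = zero ∷ List.map suc (outsides S)

  length-outsides : ∀ {m} (S : Subset m) → card S ℕ.+ length (outsides S) ≡ m
  length-outsides []            = refl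
  length-outsides (inside  ∷ S) = cong suc (trans (cong (card S ℕ.+_) (length-map suc (outsides S))) (length-outsides S))
  length-outsides (outside ∷ S) = trans (ℕ.+-suc (card S) _)
    (cong suc (trans (cong (card S ℕ.+_) (length-map suc (outsides S))) (length-outsides S)))

  ∉⇒∈-outsides : ∀ {m} (S : Subset m) {j} → j ∉ S → j ∈ outsides S
  ∉⇒∈-outsides (inside  ∷ S) {zero}  j∉S = contradiction here j∉S
  ∉⇒∈-outsides (inside  ∷ S) {suc j} j∉S = ∈-map⁺ suc (∉⇒∈-outsides S (j∉S ∘ there))
  ∉⇒∈-outsides (outside ∷ S) {zero}  j∉S = here refl
  ∉⇒∈-outsides (outside ∷ S) {suc j} j∉S = there (∈-map⁺ suc (∉⇒∈-outsides S (j∉S ∘ there)))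

  𝟙-× : ∀ {P Q : Set} (P? : Dec P) (Q? : Dec Q) → 𝟙 (P? ×-dec Q?) ≡ 𝟙 P? * 𝟙 Q?
  𝟙-× (yes _) Q? = sym (ℚ.*-identityˡ (𝟙 Q?))
  𝟙-× (no _)  Q? = sym (ℚ.*-zeroˡ (𝟙 Q?))

  divide : ∀ p q → 0ℚ < p → 0ℚ < q → ∃[ r ] (0ℚ < r × p * r ≡ q)
  divide p q 0<p 0<q = r , 0<p*q 0<p⁻¹ 0<q , eq
    where
    p>0 : ℚ.Positive p
    p>0 = ℚ.positive 0<p
    p≢0 : ℚ.NonZero p
    p≢0 = ℚ.pos⇒nonZero p {{p>0}}
    p⁻¹ r : ℚ
    p⁻¹ = (ℚ.1/ p) {{p≢0}}
    r = p⁻¹ * q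
    0<p⁻¹ : 0ℚ < p⁻¹
    0<p⁻¹ = ℚ.positive⁻¹ p⁻¹ {{ℚ.1/pos⇒pos p {{p>0}}}}
    eq : p * r ≡ q
    eq = trans (sym (ℚ.*-assoc p p⁻¹ q)) (trans (cong (_* q) (ℚ.*-inverseʳ p {{p≢0}})) (ℚ.*-identityˡ q))

  ^-* : ∀ q m n → q ^ (m ℕ.* n) ≡ (q ^ n) ^ m
  ^-* q zero    n = refl
  ^-* q (suc m) n = trans (^-homo-* q n (m ℕ.* n)) (cong (q ^ n *_) (^-* q m n))

  -- Sums over lists and products

  ∏ : ∀ {n} → (Fin n → ℚ) → ℚ
  ∏ = RawMonoidDefs.sum ℚ.*-1-rawMonoid

  0≤∏ : ∀ {n} {f : Fin n → ℚ} → (∀ i → 0ℚ ≤ f i) → 0ℚ ≤ ∏ f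
  0≤∏ {zero}  0≤f = 0≤1
  0≤∏ {suc n} 0≤f = 0≤p*q (0≤f zero) (0≤∏ (0≤f ∘ suc))

  ∏≤1 : ∀ {n} {f : Fin n → ℚ} → (∀ i → 0ℚ ≤ f i) → (∀ i → f i ≤ 1ℚ) → ∏ f ≤ 1ℚ
  ∏≤1 {zero}  0≤f f≤1 = ℚ.≤-refl
  ∏≤1 {suc n} 0≤f f≤1 = ℚ.≤-trans (p*q≤p (0≤f zero) (∏≤1 (0≤f ∘ suc) (f≤1 ∘ suc))) (f≤1 zero)

  ∑ₗ : {X : Set} → List X → (X → ℚ) → ℚ
  ∑ₗ []       f = 0ℚ
  ∑ₗ (x ∷ xs) f = f x + ∑ₗ xs f

  ∑ₗ-cong : ∀ {X : Set} (xs : List X) {f g : X → ℚ} → (∀ x → f x ≡ g x) → ∑ₗ xs f ≡ ∑ₗ xs g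
  ∑ₗ-cong []       f≗g = refl
  ∑ₗ-cong (x ∷ xs) f≗g = cong₂ _+_ (f≗g x) (∑ₗ-cong xs f≗g)

  ∑ₗ-mono : ∀ {X : Set} {xs : List X} {f g : X → ℚ} → All (λ x → f x ≤ g x) xs → ∑ₗ xs f ≤ ∑ₗ xs g
  ∑ₗ-mono []            = ℚ.≤-refl
  ∑ₗ-mono (f≤g ∷ f≤gs) = ℚ.+-mono-≤ f≤g (∑ₗ-mono f≤gs)

  ∑ₗ-const : ∀ {X : Set} (xs : List X) c → ∑ₗ xs (λ _ → c) ≡ ι (length xs) * c
  ∑ₗ-const []       c = sym (ℚ.*-zeroˡ c)
  ∑ₗ-const (x ∷ xs) c = trans (cong (c +_) (∑ₗ-const xs c)) (trans
    (solve 2 (λ c k → c :+ k :* c := (con 1ℚ :+ k) :* c) refl c (ι (length xs)))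
    (cong (_* c) (sym (ι-suc (length xs)))))

  ∣∑ₗ-∑ₗ∣≤ : ∀ {X : Set} {xs : List X} {f g : X → ℚ} {c} → All (λ x → ∣ f x - g x ∣ ≤ c) xs →
    ∣ ∑ₗ xs f - ∑ₗ xs g ∣ ≤ ι (length xs) * c
  ∣∑ₗ-∑ₗ∣≤ {c = c} [] = ℚ.≤-reflexive (sym (ℚ.*-zeroˡ c))
  ∣∑ₗ-∑ₗ∣≤ {xs = x ∷ xs} {f} {g} {c} (close ∷ closes) = begin
    ∣ (f x + F) - (g x + G) ∣       ≡⟨ cong ∣_∣ (solve 4 (λ a F b G → (a :+ F) :- (b :+ G) := (a :- b) :+ (F :- G)) refl (f x) F (g x) G) ⟩
    ∣ (f x - g x) + (F - G) ∣       ≤⟨ ℚ.∣p+q∣≤∣p∣+∣q∣ (f x - g x) (F - G) ⟩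
    ∣ f x - g x ∣ + ∣ F - G ∣       ≤⟨ ℚ.+-mono-≤ close (∣∑ₗ-∑ₗ∣≤ closes) ⟩
    c + ι (length xs) * c           ≡⟨ solve 2 (λ c k → c :+ k :* c := (con 1ℚ :+ k) :* c) refl c (ι (length xs)) ⟩
    (1ℚ + ι (length xs)) * c        ≡⟨ cong (_* c) (ι-suc (length xs)) ⟨
    ι (suc (length xs)) * c         ∎
    where
    open ℚ.≤-Reasoning
    F = ∑ₗ xs f
    G = ∑ₗ xs g

  ∑ₗ-filter : ∀ {X : Set} {E : X → Set} (E? : ∀ x → Dec (E x)) (xs : List X) f →
    ∑ₗ (filter E? xs) f ≡ ∑ₗ xs (λ x → 𝟙 (E? x) * f x)
  ∑ₗ-filter E? []       f = refl
  ∑ₗ-filter E? (x ∷ xs) f with E? x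
  ... | yes _ = cong₂ _+_ (sym (ℚ.*-identityˡ (f x))) (∑ₗ-filter E? xs f)
  ... | no _  = trans (∑ₗ-filter E? xs f) (sym (trans (cong (_+ ∑ₗ xs (λ x → 𝟙 (E? x) * f x)) (ℚ.*-zeroˡ (f x))) (ℚ.+-identityˡ _)))

  ∑ₗ-map : ∀ {X Y : Set} (g : X → Y) (xs : List X) f → ∑ₗ (List.map g xs) f ≡ ∑ₗ xs (f ∘ g)
  ∑ₗ-map g []       f = refl
  ∑ₗ-map g (x ∷ xs) f = cong (f (g x) +_) (∑ₗ-map g xs f)

  ∑ₗ-++ : ∀ {X : Set} (xs ys : List X) f → ∑ₗ (xs List.++ ys) f ≡ ∑ₗ xs f + ∑ₗ ys f
  ∑ₗ-++ []       ys f = sym (ℚ.+-identityˡ (∑ₗ ys f))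
  ∑ₗ-++ (x ∷ xs) ys f = trans (cong (f x +_) (∑ₗ-++ xs ys f)) (sym (ℚ.+-assoc (f x) (∑ₗ xs f) (∑ₗ ys f)))

  ∑ₗ-vectors : ∀ {X : Set} (xs : List X) n (f : Vec X (suc n) → ℚ) →
    ∑ₗ (vectors xs (suc n)) f ≡ ∑ₗ xs (λ x → ∑ₗ (vectors xs n) (λ v → f (x ∷ v)))
  ∑ₗ-vectors {X} xs n f = product xs
    where
    product : ∀ ys → ∑ₗ (cartesianProductWith Vec._∷_ ys (vectors xs n)) f ≡ ∑ₗ ys (λ x → ∑ₗ (vectors xs n) (λ v → f (x ∷ v)))
    product []       = refl
    product (y ∷ ys) = trans (∑ₗ-++ (List.map (y ∷_) (vectors xs n)) _ f)
      (cong₂ _+_ (∑ₗ-map (y ∷_) (vectors xs n) f) (product ys))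

  ∑ₗ-allFin : ∀ n (f : Fin n → ℚ) → ∑ₗ (allFin n) f ≡ sum f
  ∑ₗ-allFin n f = tabulated (λ i → i)
    where
    tabulated : ∀ {k} (g : Fin k → Fin n) → ∑ₗ (List.tabulate g) f ≡ sum (f ∘ g)
    tabulated {zero}  g = refl
    tabulated {suc k} g = cong (f (g zero) +_) (tabulated (g ∘ suc))

  ∫-∑ₗ : ∀ {X Y : Set} (I : Integral X) (ys : List Y) (f : Y → X → ℚ) →
    ∫ I (λ x → ∑ₗ ys (λ y → f y x)) ≡ ∑ₗ ys (λ y → ∫ I (f y))
  ∫-∑ₗ I []       f = ∫-0 I
  ∫-∑ₗ I (y ∷ ys) f = trans (∫-+ I (f y) (λ x → ∑ₗ ys (λ y → f y x))) (cong (∫ I (f y) +_) (∫-∑ₗ I ys f))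

  sum-∑ₗ : ∀ {n} {X : Set} (xs : List X) (f : Fin n → X → ℚ) →
    sum (λ i → ∑ₗ xs (f i)) ≡ ∑ₗ xs (λ x → sum (λ i → f i x))
  sum-∑ₗ {n} xs f = ∫-∑ₗ (counting n) xs (λ x i → f i x)

  -- The bridge to the probabilities of the theorem, which are sums over the list `matrices`:
  -- applied once to the entries of a row and once to the rows, it makes the product law explicit.
  iterated-expand : ∀ {X : Set} (xs : List X) {n} (I : Fin n → Integral X) (w : Fin n → X → ℚ) →
    (∀ i f → ∫ (I i) f ≡ ∑ₗ xs (λ x → w i x * f x)) →
    ∀ f → ∫ (iterated I) f ≡ ∑ₗ (vectors xs n) (λ v → ∏ (λ i → w i (lookup v i)) * f v)
  iterated-expand xs {zero}  I w expand f = sym (trans (ℚ.+-identityʳ (1ℚ * f [])) (ℚ.*-identityˡ (f [])))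
  iterated-expand xs {suc n} I w expand f = begin
    ∫ T (λ v → ∫ (I zero) (λ x → f (x ∷ v)))
      ≡⟨ ∫-cong T (λ v → expand zero (λ x → f (x ∷ v))) ⟩
    ∫ T (λ v → ∑ₗ xs (λ x → w zero x * f (x ∷ v)))
      ≡⟨ ∫-∑ₗ T xs (λ x v → w zero x * f (x ∷ v)) ⟩
    ∑ₗ xs (λ x → ∫ T (λ v → w zero x * f (x ∷ v)))
      ≡⟨ ∑ₗ-cong xs (λ x → trans (iterated-expand xs (I ∘ suc) (w ∘ suc) (expand ∘ suc) (λ v → w zero x * f (x ∷ v)))
           (∑ₗ-cong (vectors xs n) (λ v → solve 3 (λ a b c → a :* (b :* c) := b :* a :* c) refl
             (∏ (λ i → w (suc i) (lookup v i))) (w zero x) (f (x ∷ v))))) ⟩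
    ∑ₗ xs (λ x → ∑ₗ (vectors xs n) (λ v → w zero x * ∏ (λ i → w (suc i) (lookup v i)) * f (x ∷ v)))
      ≡⟨ ∑ₗ-vectors xs n (λ v → ∏ (λ i → w i (lookup v i)) * f v) ⟨
    ∑ₗ (vectors xs (suc n)) (λ v → ∏ (λ i → w i (lookup v i)) * f v) ∎
    where
    open ≡-Reasoning
    T = iterated (I ∘ suc)

  -- Properties that hold eventually along sequences

  Eventually : (ℕ → Set) → Set
  Eventually P = ∃[ T ] (∀ t → T ℕ.≤ t → P t)

  eventually-map : {P Q : ℕ → Set} → (∀ {t} → P t → Q t) → Eventually P → Eventually Q
  eventually-map f (T , h) = T , λ t T≤t → f (h t T≤t)

  eventually-× : {P Q : ℕ → Set} → Eventually P → Eventually Q → Eventually (λ t → P t × Q t)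
  eventually-× (S , g) (T , h) = S ℕ.⊔ T ,
    λ t S⊔T≤t → g t (ℕ.m⊔n≤o⇒m≤o S T S⊔T≤t) , h t (ℕ.m⊔n≤o⇒n≤o S T S⊔T≤t)

  eventually-All : {X : Set} {P : X → ℕ → Set} → (∀ x → Eventually (P x)) →
    ∀ xs → Eventually (λ t → All (λ x → P x t) xs)
  eventually-All h []       = 0 , λ _ _ → []
  eventually-All h (x ∷ xs) = eventually-map (λ (px , pxs) → px ∷ pxs) (eventually-× (h x) (eventually-All h xs))

  eventually-∀ : ∀ {n} {P : Fin n → ℕ → Set} → (∀ i → Eventually (P i)) → Eventually (λ t → ∀ i → P i t)
  eventually-∀ {n} h = eventually-map (λ all i → All.lookup all (∈-allFin i)) (eventually-All h (allFin n))

  -- Only the `g i` are known to lie in the unit interval, so `f zero` is expanded around `g zero`.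
  -- The resulting three terms are each at most `ι 3 ^ n * σ`, whence the base 3.
  ∏-close : ∀ {σ} → 0ℚ ≤ σ → σ ≤ 1ℚ → ∀ {n} {f g : Fin n → ℚ} →
    (∀ i → 0ℚ ≤ g i) → (∀ i → g i ≤ 1ℚ) → (∀ i → ∣ f i - g i ∣ ≤ σ) → ∣ ∏ f - ∏ g ∣ ≤ ι 3 ^ n * σ
  ∏-close {σ} 0≤σ σ≤1 {zero}  0≤g g≤1 close = 0≤p*q 0≤1 0≤σ
  ∏-close {σ} 0≤σ σ≤1 {suc n} {f} {g} 0≤g g≤1 close = begin
    ∣ a * F - b * G ∣
      ≡⟨ cong ∣_∣ (solve 4 (λ a b F G → a :* F :- b :* G := ((a :- b) :* (F :- G) :+ b :* (F :- G)) :+ G :* (a :- b)) refl a b F G) ⟩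
    ∣ ((a - b) * (F - G) + b * (F - G)) + G * (a - b) ∣
      ≤⟨ ℚ.≤-trans (ℚ.∣p+q∣≤∣p∣+∣q∣ ((a - b) * (F - G) + b * (F - G)) (G * (a - b)))
           (ℚ.+-monoˡ-≤ ∣ G * (a - b) ∣ (ℚ.∣p+q∣≤∣p∣+∣q∣ ((a - b) * (F - G)) (b * (F - G)))) ⟩
    ∣ (a - b) * (F - G) ∣ + ∣ b * (F - G) ∣ + ∣ G * (a - b) ∣
      ≡⟨ cong₂ _+_ (cong₂ _+_ (ℚ.∣p*q∣≡∣p∣*∣q∣ (a - b) (F - G)) (trans (ℚ.∣p*q∣≡∣p∣*∣q∣ b (F - G)) (cong (_* ∣ F - G ∣) (ℚ.0≤p⇒∣p∣≡p (0≤g zero)))))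
           (trans (ℚ.∣p*q∣≡∣p∣*∣q∣ G (a - b)) (cong (_* ∣ a - b ∣) (ℚ.0≤p⇒∣p∣≡p (0≤∏ (0≤g ∘ suc))))) ⟩
    ∣ a - b ∣ * ∣ F - G ∣ + b * ∣ F - G ∣ + G * ∣ a - b ∣
      ≤⟨ ℚ.+-mono-≤ (ℚ.+-mono-≤
           (*-mono-≤ (ℚ.0≤∣p∣ (F - G)) 0≤1 (ℚ.≤-trans (close zero) σ≤1) rest)
           (*-mono-≤ (ℚ.0≤∣p∣ (F - G)) 0≤1 (g≤1 zero) rest))
           (*-mono-≤ (ℚ.0≤∣p∣ (a - b)) 0≤1 (∏≤1 (0≤g ∘ suc) (g≤1 ∘ suc)) (close zero)) ⟩
    1ℚ * Y + 1ℚ * Y + 1ℚ * σ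
      ≤⟨ p+r≡q⇒p≤q (ι 3 ^ n * σ - 1ℚ * σ)
           (solve 2 (λ y s → con 1ℚ :* (y :* s) :+ con 1ℚ :* (y :* s) :+ con 1ℚ :* s :+ (y :* s :- con 1ℚ :* s) := con (ι 3) :* y :* s) refl (ι 3 ^ n) σ)
           (p≤q⇒0≤q-p (*-monoʳ-≤ 0≤σ (1≤^ n (ι-mono {1} {3} (ℕ.s≤s ℕ.z≤n))))) ⟩
    ι 3 ^ suc n * σ ∎
    where
    open ℚ.≤-Reasoning
    a b F G Y : ℚ
    a = f zero
    b = g zero
    F = ∏ (f ∘ suc)
    G = ∏ (g ∘ suc)
    Y = ι 3 ^ n * σ
    rest : ∣ F - G ∣ ≤ Y
    rest = ∏-close 0≤σ σ≤1 (0≤g ∘ suc) (g≤1 ∘ suc) (close ∘ suc)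

  below-both : ∀ {a b} → 0ℚ < a → 0ℚ < b → ∃[ x ] (0ℚ < x × x ≤ a × x ≤ b)
  below-both {a} {b} 0<a 0<b with ℚ.≤-total a b
  ... | inj₁ a≤b = a , 0<a , ℚ.≤-refl , a≤b
  ... | inj₂ b≤a = b , 0<b , b≤a , ℚ.≤-refl

  seq-∑ℝ : ∀ {X : Set} (f : X → ℝ) xs t → seq (∑ℝ (List.map f xs)) t ≡ ∑ₗ xs (λ x → seq (f x) t)
  seq-∑ℝ f []       t = refl
  seq-∑ℝ f (x ∷ xs) t = cong (seq (f x) t +_) (seq-∑ℝ f xs t)

  seq-∏ℝ : ∀ {n} (f : Fin n → ℝ) t → seq (∏ℝ f) t ≡ ∏ (λ i → seq (f i) t)
  seq-∏ℝ {zero}  f t = refl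
  seq-∏ℝ {suc n} f t = cong (seq (f zero) t *_) (seq-∏ℝ (f ∘ suc) t)

  ∏-cong : ∀ {n} {f g : Fin n → ℚ} → (∀ i → f i ≡ g i) → ∏ f ≡ ∏ g
  ∏-cong {zero}  f≗g = refl
  ∏-cong {suc n} f≗g = cong₂ _*_ (f≗g zero) (∏-cong (f≗g ∘ suc))

  -- Probability weights near approximate ones

  record Weights (p : ℕ) : Set where
    field
      mass   : Fin p → ℚ
      0≤mass : ∀ r → 0ℚ ≤ mass r
      total≡ : sum mass ≡ 1ℚ

    mass≤1 : ∀ r → mass r ≤ 1ℚ
    mass≤1 r = subst (mass r ≤_) total≡ (term≤sum 0≤mass r)

  open Weights

  -- Adding σ to every weight makes them nonnegative, and dividing by the new total `S` makes them a
  -- law. `S` is within `(p + 1) σ ≤ ½` of 1, hence positive; the error at `r` is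
  -- `mass ν r * (S - 1ℚ) - σ`, which explains the constant `p + 2`.
  normalised-weights : ∀ {p} (μ : Fin p → ℚ) σ → 0ℚ ≤ σ → (ι p + 1ℚ) * σ ≤ ½ → (∀ r → 0ℚ ≤ μ r + σ) → ∣ sum μ - 1ℚ ∣ ≤ σ →
    ∃[ ν ] (∀ r → ∣ μ r - mass ν r ∣ ≤ (ι p + ι 2) * σ)
  normalised-weights {p} μ σ 0≤σ small 0≤μ+σ total≈1 = ν , close
    where
    open ℚ.≤-Reasoning
    S : ℚ
    S = sum (λ r → μ r + σ)
    S≡ : S ≡ sum μ + ι p * σ
    S≡ = trans (∑-distrib-+ μ (λ _ → σ)) (cong (sum μ +_) (sum-const p σ))
    ∣S-1∣≤ : ∣ S - 1ℚ ∣ ≤ (ι p + 1ℚ) * σ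
    ∣S-1∣≤ = begin
      ∣ S - 1ℚ ∣                         ≡⟨ cong (λ s → ∣ s - 1ℚ ∣) S≡ ⟩
      ∣ sum μ + ι p * σ - 1ℚ ∣           ≡⟨ cong ∣_∣ (solve 2 (λ a b → a :+ b :- con 1ℚ := (a :- con 1ℚ) :+ b) refl (sum μ) (ι p * σ)) ⟩
      ∣ (sum μ - 1ℚ) + ι p * σ ∣         ≤⟨ ℚ.∣p+q∣≤∣p∣+∣q∣ (sum μ - 1ℚ) (ι p * σ) ⟩
      ∣ sum μ - 1ℚ ∣ + ∣ ι p * σ ∣       ≤⟨ ℚ.+-mono-≤ total≈1 (ℚ.≤-reflexive (ℚ.0≤p⇒∣p∣≡p (0≤p*q (0≤ι p) 0≤σ))) ⟩
      σ + ι p * σ                        ≡⟨ solve 2 (λ s k → s :+ k :* s := (k :+ con 1ℚ) :* s) refl σ (ι p) ⟩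
      (ι p + 1ℚ) * σ                     ∎
    0<S : 0ℚ < S
    0<S = begin-strict
      0ℚ                 <⟨ ℚ.positive⁻¹ ½ ⟩
      ½                  ≡⟨⟩
      1ℚ - ½             ≤⟨ ℚ.+-monoʳ-≤ 1ℚ (ℚ.neg-antimono-≤ (ℚ.≤-trans (-p≤∣p∣ (S - 1ℚ)) (ℚ.≤-trans ∣S-1∣≤ small))) ⟩
      1ℚ - - (S - 1ℚ)    ≡⟨ solve 1 (λ s → con 1ℚ :- (:- (s :- con 1ℚ)) := s) refl S ⟩
      S                  ∎
    inverse : ∃[ s ] (0ℚ < s × S * s ≡ 1ℚ)
    inverse = divide S 1ℚ 0<S 0<1
    s : ℚ
    s = proj₁ inverse
    ν : Weights p
    ν = record
      { mass   = λ r → (μ r + σ) * s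
      ; 0≤mass = λ r → 0≤p*q (0≤μ+σ r) (ℚ.<⇒≤ (proj₁ (proj₂ inverse)))
      ; total≡ = trans (sym (*-distribʳ-sum s (λ r → μ r + σ))) (proj₂ (proj₂ inverse))
      }
    close : ∀ r → ∣ μ r - mass ν r ∣ ≤ (ι p + ι 2) * σ
    close r = begin
      ∣ μ r - (μ r + σ) * s ∣
        ≡⟨ cong ∣_∣ (solve 3 (λ m o s → m :- (m :+ o) :* s := (m :+ o) :* con 1ℚ :- (m :+ o) :* s :- o) refl (μ r) σ s) ⟩
      ∣ (μ r + σ) * 1ℚ - (μ r + σ) * s - σ ∣
        ≡⟨ cong (λ t → ∣ (μ r + σ) * t - (μ r + σ) * s - σ ∣) (proj₂ (proj₂ inverse)) ⟨
      ∣ (μ r + σ) * (S * s) - (μ r + σ) * s - σ ∣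
        ≡⟨ cong ∣_∣ (solve 4 (λ m o S s → (m :+ o) :* (S :* s) :- (m :+ o) :* s :- o := (m :+ o) :* s :* (S :- con 1ℚ) :- o) refl (μ r) σ S s) ⟩
      ∣ mass ν r * (S - 1ℚ) - σ ∣
        ≤⟨ ℚ.∣p-q∣≤∣p∣+∣q∣ (mass ν r * (S - 1ℚ)) σ ⟩
      ∣ mass ν r * (S - 1ℚ) ∣ + ∣ σ ∣
        ≡⟨ cong₂ _+_ (trans (ℚ.∣p*q∣≡∣p∣*∣q∣ (mass ν r) (S - 1ℚ)) (cong (_* ∣ S - 1ℚ ∣) (ℚ.0≤p⇒∣p∣≡p (0≤mass ν r)))) (ℚ.0≤p⇒∣p∣≡p 0≤σ) ⟩
      mass ν r * ∣ S - 1ℚ ∣ + σ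
        ≤⟨ ℚ.+-monoˡ-≤ σ (*-mono-≤ (ℚ.0≤∣p∣ (S - 1ℚ)) 0≤1 (mass≤1 ν r) ∣S-1∣≤) ⟩
      1ℚ * ((ι p + 1ℚ) * σ) + σ
        ≡⟨ solve 2 (λ k s → con 1ℚ :* ((k :+ con 1ℚ) :* s) :+ s := (k :+ con (ι 2)) :* s) refl (ι p) σ ⟩
      (ι p + ι 2) * σ ∎

  module _ {p : ℕ} {{isPrime : Prime p}} where

    private
      instance
        p≢0 : ℕ.NonZero p
        p≢0 = prime⇒nonZero isPrime

    -- The field of residues

    [_] : ℕ → Fin p
    [ m ] = m mod p

    toℕ-mod : ∀ m → toℕ [ m ] ≡ m % p
    toℕ-mod m = Fin.toℕ-fromℕ< (m%n<n m p)

    %≡⇒mod≡ : ∀ m n → m % p ≡ n % p → [ m ] ≡ [ n ]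
    %≡⇒mod≡ m n eq = Fin.toℕ-injective (trans (toℕ-mod m) (trans eq (sym (toℕ-mod n))))

    toℕ-mod-id : ∀ a → [ toℕ a ] ≡ a
    toℕ-mod-id a = Fin.toℕ-injective (trans (toℕ-mod (toℕ a)) (m<n⇒m%n≡m (Fin.toℕ<n a)))

    mod-+ : ∀ m n → [ m ℕ.+ n ] ≡ [ m ] +ₚ [ n ]
    mod-+ m n = %≡⇒mod≡ (m ℕ.+ n) _ (trans (%-distribˡ-+ m n p)
      (cong (_% p) (sym (cong₂ ℕ._+_ (toℕ-mod m) (toℕ-mod n)))))

    mod-* : ∀ m n → [ m ℕ.* n ] ≡ [ m ] *ₚ [ n ]
    mod-* m n = %≡⇒mod≡ (m ℕ.* n) _ (trans (%-distribˡ-* m n p)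
      (cong (_% p) (sym (cong₂ ℕ._*_ (toℕ-mod m) (toℕ-mod n)))))

    infix 8 -ₚ_

    1ₚ : Fin p
    1ₚ = [ 1 ]

    -ₚ_ : Fin p → Fin p
    -ₚ a = [ p ℕ.∸ toℕ a ]

    mod-elim : (P : Fin p → Set) → (∀ m → P [ m ]) → ∀ a → P a
    mod-elim P h a = subst P (toℕ-mod-id a) (h (toℕ a))

    +ₚ-comm : ∀ a b → a +ₚ b ≡ b +ₚ a
    +ₚ-comm a b = cong [_] (ℕ.+-comm (toℕ a) (toℕ b))

    *ₚ-comm : ∀ a b → a *ₚ b ≡ b *ₚ a
    *ₚ-comm a b = cong [_] (ℕ.*-comm (toℕ a) (toℕ b))

    +ₚ-assoc : ∀ a b c → (a +ₚ b) +ₚ c ≡ a +ₚ (b +ₚ c)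
    +ₚ-assoc = mod-elim _ λ k → mod-elim _ λ m → mod-elim _ λ n → begin
      ([ k ] +ₚ [ m ]) +ₚ [ n ]    ≡⟨ cong (_+ₚ [ n ]) (mod-+ k m) ⟨
      [ k ℕ.+ m ] +ₚ [ n ]         ≡⟨ mod-+ (k ℕ.+ m) n ⟨
      [ k ℕ.+ m ℕ.+ n ]              ≡⟨ cong [_] (ℕ.+-assoc k m n) ⟩
      [ k ℕ.+ (m ℕ.+ n) ]            ≡⟨ mod-+ k (m ℕ.+ n) ⟩
      [ k ] +ₚ [ m ℕ.+ n ]         ≡⟨ cong ([ k ] +ₚ_) (mod-+ m n) ⟩
      [ k ] +ₚ ([ m ] +ₚ [ n ])    ∎
      where open ≡-Reasoning

    *ₚ-assoc : ∀ a b c → (a *ₚ b) *ₚ c ≡ a *ₚ (b *ₚ c)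
    *ₚ-assoc = mod-elim _ λ k → mod-elim _ λ m → mod-elim _ λ n → begin
      ([ k ] *ₚ [ m ]) *ₚ [ n ]    ≡⟨ cong (_*ₚ [ n ]) (mod-* k m) ⟨
      [ k ℕ.* m ] *ₚ [ n ]         ≡⟨ mod-* (k ℕ.* m) n ⟨
      [ k ℕ.* m ℕ.* n ]              ≡⟨ cong [_] (ℕ.*-assoc k m n) ⟩
      [ k ℕ.* (m ℕ.* n) ]            ≡⟨ mod-* k (m ℕ.* n) ⟩
      [ k ] *ₚ [ m ℕ.* n ]         ≡⟨ cong ([ k ] *ₚ_) (mod-* m n) ⟩
      [ k ] *ₚ ([ m ] *ₚ [ n ])    ∎
      where open ≡-Reasoning

    *ₚ-distribˡ-+ₚ : ∀ a b c → a *ₚ (b +ₚ c) ≡ a *ₚ b +ₚ a *ₚ c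
    *ₚ-distribˡ-+ₚ = mod-elim _ λ k → mod-elim _ λ m → mod-elim _ λ n → begin
      [ k ] *ₚ ([ m ] +ₚ [ n ])                 ≡⟨ cong ([ k ] *ₚ_) (mod-+ m n) ⟨
      [ k ] *ₚ [ m ℕ.+ n ]                      ≡⟨ mod-* k (m ℕ.+ n) ⟨
      [ k ℕ.* (m ℕ.+ n) ]                         ≡⟨ cong [_] (ℕ.*-distribˡ-+ k m n) ⟩
      [ k ℕ.* m ℕ.+ k ℕ.* n ]                     ≡⟨ mod-+ (k ℕ.* m) (k ℕ.* n) ⟩
      [ k ℕ.* m ] +ₚ [ k ℕ.* n ]              ≡⟨ cong₂ _+ₚ_ (mod-* k m) (mod-* k n) ⟩
      [ k ] *ₚ [ m ] +ₚ [ k ] *ₚ [ n ]        ∎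
      where open ≡-Reasoning

    *ₚ-distribʳ-+ₚ : ∀ a b c → (b +ₚ c) *ₚ a ≡ b *ₚ a +ₚ c *ₚ a
    *ₚ-distribʳ-+ₚ a b c = trans (*ₚ-comm (b +ₚ c) a)
      (trans (*ₚ-distribˡ-+ₚ a b c) (cong₂ _+ₚ_ (*ₚ-comm a b) (*ₚ-comm a c)))

    +ₚ-identityˡ : ∀ a → 0ₚ +ₚ a ≡ a
    +ₚ-identityˡ = mod-elim _ λ m → sym (mod-+ 0 m)

    *ₚ-identityˡ : ∀ a → 1ₚ *ₚ a ≡ a
    *ₚ-identityˡ = mod-elim _ λ m → trans (sym (mod-* 1 m)) (cong [_] (ℕ.*-identityˡ m))

    +ₚ-inverseʳ : ∀ a → a +ₚ -ₚ a ≡ 0ₚ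
    +ₚ-inverseʳ a = begin
      a +ₚ -ₚ a                                    ≡⟨ cong (_+ₚ -ₚ a) (toℕ-mod-id a) ⟨
      [ toℕ a ] +ₚ [ p ℕ.∸ toℕ a ]           ≡⟨ mod-+ (toℕ a) (p ℕ.∸ toℕ a) ⟨
      [ toℕ a ℕ.+ (p ℕ.∸ toℕ a) ]              ≡⟨ cong [_] (ℕ.m+[n∸m]≡n (ℕ.<⇒≤ (Fin.toℕ<n a))) ⟩
      [ p ]                                      ≡⟨ %≡⇒mod≡ p 0 (trans (n%n≡0 p) (sym (m*n%n≡0 0 p))) ⟩
      0ₚ                                           ∎
      where open ≡-Reasoning

    𝔽ₚ : CommutativeRing 0ℓ 0ℓ
    𝔽ₚ = record
      { Carrier = Fin p ; _≈_ = _≡_ ; _+_ = _+ₚ_ ; _*_ = _*ₚ_ ; -_ = -ₚ_ ; 0# = 0ₚ ; 1# = 1ₚ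
      ; isCommutativeRing = record
        { isRing = record
          { +-isAbelianGroup = record
            { isGroup = record
              { isMonoid = record
                { isSemigroup = record
                  { isMagma = record { isEquivalence = isEquivalence ; ∙-cong = cong₂ _+ₚ_ }
                  ; assoc = +ₚ-assoc }
                ; identity = +ₚ-identityˡ , λ a → trans (+ₚ-comm a 0ₚ) (+ₚ-identityˡ a) }
              ; inverse = (λ a → trans (+ₚ-comm (-ₚ a) a) (+ₚ-inverseʳ a)) , +ₚ-inverseʳ
              ; ⁻¹-cong = cong -ₚ_ }
            ; comm = +ₚ-comm }
          ; *-cong = cong₂ _*ₚ_
          ; *-assoc = *ₚ-assoc
          ; *-identity = *ₚ-identityˡ , λ a → trans (*ₚ-comm a 1ₚ) (*ₚ-identityˡ a)
          ; distrib = *ₚ-distribˡ-+ₚ , *ₚ-distribʳ-+ₚ }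
        ; *-comm = *ₚ-comm } }

    open CommutativeRing 𝔽ₚ using (commutativeSemiring; ring) renaming
      ( +-identityʳ to +ₚ-identityʳ ; -‿inverseˡ to +ₚ-inverseˡ ; *-identityʳ to *ₚ-identityʳ
      ; zeroˡ to *ₚ-zeroˡ ; zeroʳ to *ₚ-zeroʳ) public
    open RingProperties ring using () renaming
      ( -‿distribˡ-* to -ₚ-distribˡ-*ₚ ; +-inverseʳ-unique to +ₚ-inverseʳ-unique ) public
    private module 𝔽 = SemiringSolver commutativeSemiring

    +ₚ-cancelʳ : ∀ a b → (a +ₚ b) +ₚ -ₚ b ≡ a
    +ₚ-cancelʳ a b = trans (+ₚ-assoc a b (-ₚ b)) (trans (cong (a +ₚ_) (+ₚ-inverseʳ b)) (+ₚ-identityʳ a))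

    -ₚ-cancelʳ : ∀ a b → (a +ₚ -ₚ b) +ₚ b ≡ a
    -ₚ-cancelʳ a b = trans (+ₚ-assoc a (-ₚ b) b) (trans (cong (a +ₚ_) (+ₚ-inverseˡ b)) (+ₚ-identityʳ a))

    *ₚ-inverse : ∀ g → g ≢ 0ₚ → ∃[ h ] h *ₚ g ≡ 1ₚ
    *ₚ-inverse g g≢0 = go (coprime-Bézout (prime⇒coprime isPrime {{ℕ.≢-nonZero A≢0}} (Fin.toℕ<n g)))
      where
      open ≡-Reasoning
      A = toℕ g
      A≢0 : A ≢ 0
      A≢0 A≡0 = g≢0 (trans (sym (toℕ-mod-id g)) (cong [_] A≡0))
      kp≡0 : ∀ k → [ k ℕ.* p ] ≡ 0ₚ
      kp≡0 k = %≡⇒mod≡ (k ℕ.* p) 0 (trans (m*n%n≡0 k p) (sym (m*n%n≡0 0 p)))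
      yA : ∀ y → [ y ℕ.* A ] ≡ [ y ] *ₚ g
      yA y = trans (mod-* y A) (cong ([ y ] *ₚ_) (toℕ-mod-id g))
      go : Bézout.Identity 1 p A → ∃[ h ] h *ₚ g ≡ 1ₚ
      -- Here `1 + y * A ≡ x * p`, so `y` inverts `g` up to sign; in the other case `y` itself is
      -- the inverse.
      go (Bézout.+- x y eq) = -ₚ [ y ] , (begin
        -ₚ [ y ] *ₚ g         ≡⟨ -ₚ-distribˡ-*ₚ [ y ] g ⟨
        -ₚ ([ y ] *ₚ g)         ≡⟨ +ₚ-inverseʳ-unique ([ y ] *ₚ g) 1ₚ yg+1≡0 ⟨
        1ₚ                        ∎)
        where
        yg+1≡0 : [ y ] *ₚ g +ₚ 1ₚ ≡ 0ₚ
        yg+1≡0 = begin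
          [ y ] *ₚ g +ₚ 1ₚ         ≡⟨ +ₚ-comm ([ y ] *ₚ g) 1ₚ ⟩
          1ₚ +ₚ [ y ] *ₚ g         ≡⟨ cong (1ₚ +ₚ_) (yA y) ⟨
          1ₚ +ₚ [ y ℕ.* A ]      ≡⟨ mod-+ 1 (y ℕ.* A) ⟨
          [ 1 ℕ.+ y ℕ.* A ]      ≡⟨ cong [_] eq ⟩
          [ x ℕ.* p ]            ≡⟨ kp≡0 x ⟩
          0ₚ                         ∎
      go (Bézout.-+ x y eq) = [ y ] , (begin
        [ y ] *ₚ g               ≡⟨ yA y ⟨
        [ y ℕ.* A ]            ≡⟨ cong [_] eq ⟨
        [ 1 ℕ.+ x ℕ.* p ]      ≡⟨ mod-+ 1 (x ℕ.* p) ⟩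
        1ₚ +ₚ [ x ℕ.* p ]      ≡⟨ cong (1ₚ +ₚ_) (kp≡0 x) ⟩
        1ₚ +ₚ 0ₚ                   ≡⟨ +ₚ-identityʳ 1ₚ ⟩
        1ₚ                         ∎)

    *ₚ-divisible : ∀ {g} → g ≢ 0ₚ → ∀ a → ∃[ b ] b *ₚ g ≡ a
    *ₚ-divisible {g} g≢0 a with (h , hg≡1) ← *ₚ-inverse g g≢0
      = a *ₚ h , trans (*ₚ-assoc a h g) (trans (cong (a *ₚ_) hg≡1) (*ₚ-identityʳ a))

    *ₚ-cancelʳ : ∀ {g} → g ≢ 0ₚ → ∀ a b → a *ₚ g ≡ b *ₚ g → a ≡ b
    *ₚ-cancelʳ {g} g≢0 a b eq with (h , hg≡1) ← *ₚ-inverse g g≢0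
      = trans (sym (undo a)) (trans (cong (_*ₚ h) eq) (undo b))
      where
      undo : ∀ c → c *ₚ g *ₚ h ≡ c
      undo c = trans (*ₚ-assoc c g h)
        (trans (cong (c *ₚ_) (trans (*ₚ-comm g h) hg≡1)) (*ₚ-identityʳ c))

    sum-translate : ∀ (f : Fin p → ℚ) b → sum (λ a → f (a +ₚ b)) ≡ sum f
    sum-translate f b = sym (sum-permute f
      (permutation (_+ₚ b) (_+ₚ -ₚ b) (λ a → -ₚ-cancelʳ a b) (λ a → +ₚ-cancelʳ a b)))

    -- Vectors and dot products over the residue field

    infixl 6 _⊕_·_

    -- Addition and scaling in one operation, so that subspaces and functionals need a single
    -- closure or linearity law, and the lines parallel to `v` are parametrised directly by `c`.
    _⊕_·_ : ∀ {m} → Vec (Fin p) m → Fin p → Vec (Fin p) m → Vec (Fin p) m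
    w ⊕ c · v = zipWith (λ a b → a +ₚ c *ₚ b) w v

    0ᵥ : ∀ {m} → Vec (Fin p) m
    0ᵥ = replicate _ 0ₚ

    infix 7 _∙_

    _∙_ : ∀ {m} → Vec (Fin p) m → Vec (Fin p) m → Fin p
    w ∙ x = ∑ₚ (λ j → lookup w j *ₚ lookup x j)

    ∙-linear : ∀ {m} (w v x : Vec (Fin p) m) c → (w ⊕ c · v) ∙ x ≡ w ∙ x +ₚ c *ₚ (v ∙ x)
    ∙-linear []      []      []      c = sym (trans (+ₚ-identityˡ (c *ₚ 0ₚ)) (*ₚ-zeroʳ c))
    ∙-linear (a ∷ w) (b ∷ v) (y ∷ x) c = begin
      (a +ₚ c *ₚ b) *ₚ y +ₚ (w ⊕ c · v) ∙ x          ≡⟨ cong ((a +ₚ c *ₚ b) *ₚ y +ₚ_) (∙-linear w v x c) ⟩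
      (a +ₚ c *ₚ b) *ₚ y +ₚ (w ∙ x +ₚ c *ₚ (v ∙ x))
        ≡⟨ 𝔽.solve 6 (λ a b c y s t → (a 𝔽.:+ c 𝔽.:* b) 𝔽.:* y 𝔽.:+ (s 𝔽.:+ c 𝔽.:* t)
              𝔽.:= (a 𝔽.:* y 𝔽.:+ s) 𝔽.:+ c 𝔽.:* (b 𝔽.:* y 𝔽.:+ t)) refl a b c y (w ∙ x) (v ∙ x) ⟩
      (a *ₚ y +ₚ w ∙ x) +ₚ c *ₚ (b *ₚ y +ₚ v ∙ x)    ∎
      where open ≡-Reasoning

    0ᵥ∙x≡0 : ∀ {m} (x : Vec (Fin p) m) → 0ᵥ ∙ x ≡ 0ₚ
    0ᵥ∙x≡0 []      = refl
    0ᵥ∙x≡0 (a ∷ x) = trans (cong₂ _+ₚ_ (*ₚ-zeroˡ a) (0ᵥ∙x≡0 x)) (+ₚ-identityˡ 0ₚ)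

    sum-countingVec-translate : ∀ {m} (f : Vec (Fin p) m → ℚ) c v →
      ∫ (countingVec p m) (λ w → f (w ⊕ c · v)) ≡ ∫ (countingVec p m) f
    sum-countingVec-translate f c []      = refl
    sum-countingVec-translate {suc m} f c (b ∷ v) = trans
      (∫-cong (countingVec p m) (λ w → sum-translate (λ a → f (a ∷ (w ⊕ c · v))) (c *ₚ b)))
      (sum-countingVec-translate (λ w → sum (λ a → f (a ∷ w))) c v)

    -- Equidistribution of w ∙ x

    p*p^-1≡1 : ι p * p ^- 1 ≡ 1ℚ
    p*p^-1≡1 = trans (cong (λ n → ι n * p ^- 1) (sym (ℕ.*-identityʳ p))) (ι*1/ (p ℕ.^ 1) {{ℕ.m^n≢0 p 1}})

    norm² : (Fin p → ℚ) → ℚ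
    norm² e = sum (λ s → e s * e s)

    0≤norm² : ∀ e → 0ℚ ≤ norm² e
    0≤norm² e = ∫-nonneg (counting p) (λ s → 0≤p*p (e s))

    variation : (Fin p → ℚ) → Fin p → ℚ
    variation e a = norm² (λ s → e s - e (s +ₚ a))

    variation-0 : ∀ e → variation e 0ₚ ≡ 0ℚ
    variation-0 e = sum-zero (λ s → trans
      (cong (λ t → (e s - e t) * (e s - e t)) (+ₚ-identityʳ s))
      (solve 1 (λ x → (x :- x) :* (x :- x) := con 0ℚ) refl (e s)))

    -- Pass through the intermediate point `s +ₚ a` and use `(u + v)² ≤ 2 u² + 2 v²`, whose defect
    -- is `(u - v)²`; the second sum is then translated back by `a`.
    variation-+ : ∀ e a b → variation e (a +ₚ b) ≤ ι 2 * variation e a + ι 2 * variation e b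
    variation-+ e a b = begin
      variation e (a +ₚ b)
        ≤⟨ sum-mono pointwise ⟩
      sum (λ s → ι 2 * (u s * u s) + ι 2 * (v (s +ₚ a) * v (s +ₚ a)))
        ≡⟨ ∑-distrib-+ (λ s → ι 2 * (u s * u s)) (λ s → ι 2 * (v (s +ₚ a) * v (s +ₚ a))) ⟩
      sum (λ s → ι 2 * (u s * u s)) + sum (λ s → ι 2 * (v (s +ₚ a) * v (s +ₚ a)))
        ≡⟨ cong₂ _+_ (sym (*-distribˡ-sum (ι 2) (λ s → u s * u s)))
             (trans (sym (*-distribˡ-sum (ι 2) (λ s → v (s +ₚ a) * v (s +ₚ a))))
               (cong (ι 2 *_) (sum-translate (λ s → v s * v s) a))) ⟩
      ι 2 * variation e a + ι 2 * variation e b ∎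
      where
      open ℚ.≤-Reasoning
      u v : Fin p → ℚ
      u s = e s - e (s +ₚ a)
      v s = e s - e (s +ₚ b)
      pointwise : ∀ s → (e s - e (s +ₚ (a +ₚ b))) * (e s - e (s +ₚ (a +ₚ b)))
                      ≤ ι 2 * (u s * u s) + ι 2 * (v (s +ₚ a) * v (s +ₚ a))
      pointwise s rewrite sym (+ₚ-assoc s a b) = p+r≡q⇒p≤q ((x - y - (y - z)) * (x - y - (y - z)))
        (solve 3 (λ x y z → (x :- z) :* (x :- z) :+ (x :- y :- (y :- z)) :* (x :- y :- (y :- z))
          := con (ι 2) :* ((x :- y) :* (x :- y)) :+ con (ι 2) :* ((y :- z) :* (y :- z))) refl x y z)
        (0≤p*p (x - y - (y - z)))
        where
        x = e s
        y = e (s +ₚ a)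
        z = e ((s +ₚ a) +ₚ b)

    0≤variation : ∀ e a → 0ℚ ≤ variation e a
    0≤variation e a = 0≤norm² (λ s → e s - e (s +ₚ a))

    -- One more step of length `g` replaces the factor `4 ^ j` by `2 + 2 * 4 ^ j`, which is at most
    -- `4 ^ (j + 1)`. The growth is crude, but it leads to a constant depending on p alone.
    variation-multiple : ∀ e g j → variation e ([ j ] *ₚ g) ≤ ι 4 ^ j * variation e g
    variation-multiple e g zero    = begin
      variation e (0ₚ *ₚ g)    ≡⟨ cong (variation e) (*ₚ-zeroˡ g) ⟩
      variation e 0ₚ           ≡⟨ variation-0 e ⟩
      0ℚ                       ≤⟨ 0≤p*q 0≤1 (0≤variation e g) ⟩
      1ℚ * variation e g       ∎
      where open ℚ.≤-Reasoning
    variation-multiple e g (suc j) = begin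
      variation e ([ suc j ] *ₚ g)
        ≡⟨ cong (variation e) (trans (cong (_*ₚ g) (mod-+ 1 j))
             (trans (*ₚ-distribʳ-+ₚ g 1ₚ [ j ]) (cong (_+ₚ [ j ] *ₚ g) (*ₚ-identityˡ g)))) ⟩
      variation e (g +ₚ [ j ] *ₚ g)
        ≤⟨ variation-+ e g ([ j ] *ₚ g) ⟩
      ι 2 * V + ι 2 * variation e ([ j ] *ₚ g)
        ≤⟨ ℚ.+-monoʳ-≤ (ι 2 * V) (*-monoˡ-≤ (0≤ι 2) (variation-multiple e g j)) ⟩
      ι 2 * V + ι 2 * (Y * V)
        ≤⟨ p+r≡q⇒p≤q (ι 2 * ((Y - 1ℚ) * V))
             (solve 2 (λ y v → con (ι 2) :* v :+ con (ι 2) :* (y :* v) :+ con (ι 2) :* ((y :- con 1ℚ) :* v)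
               := con (ι 4) :* y :* v) refl Y V)
             (0≤p*q (0≤ι 2) (0≤p*q (p≤q⇒0≤q-p (1≤^ j (ι-mono {1} {4} (ℕ.s≤s ℕ.z≤n)))) (0≤variation e g))) ⟩
      ι 4 * Y * V ∎
      where
      open ℚ.≤-Reasoning
      V = variation e g
      Y = ι 4 ^ j

    -- As p is prime, the nonzero `g` generates ℤ/p, and fewer than p steps of length `g` reach `a`.
    variation-≤ : ∀ e {g} → g ≢ 0ₚ → ∀ a → variation e a ≤ ι 4 ^ p * variation e g
    variation-≤ e {g} g≢0 a with (b , refl) ← *ₚ-divisible g≢0 a = begin
      variation e (b *ₚ g)               ≡⟨ cong (λ c → variation e (c *ₚ g)) (toℕ-mod-id b) ⟨
      variation e ([ toℕ b ] *ₚ g)       ≤⟨ variation-multiple e g (toℕ b) ⟩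
      ι 4 ^ toℕ b * variation e g        ≤⟨ *-monoʳ-≤ (0≤variation e g) grow ⟩
      ι 4 ^ p * variation e g            ∎
      where
      open ℚ.≤-Reasoning
      1≤4 : 1ℚ ≤ ι 4
      1≤4 = ι-mono {1} {4} (ℕ.s≤s ℕ.z≤n)
      grow : ι 4 ^ toℕ b ≤ ι 4 ^ p
      grow = begin
        ι 4 ^ toℕ b
          ≡⟨ ℚ.*-identityʳ (ι 4 ^ toℕ b) ⟨
        ι 4 ^ toℕ b * 1ℚ
          ≤⟨ *-monoˡ-≤ (0≤^ (toℕ b) (0≤ι 4)) (1≤^ (p ℕ.∸ toℕ b) 1≤4) ⟩
        ι 4 ^ toℕ b * ι 4 ^ (p ℕ.∸ toℕ b)
          ≡⟨ ^-homo-* (ι 4) (toℕ b) (p ℕ.∸ toℕ b) ⟨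
        ι 4 ^ (toℕ b ℕ.+ (p ℕ.∸ toℕ b))
          ≡⟨ cong (ι 4 ^_) (ℕ.m+[n∸m]≡n (ℕ.<⇒≤ (Fin.toℕ<n b))) ⟩
        ι 4 ^ p ∎

    -- After expanding the square, the cross terms `e s * e (s +ₚ a)` sum to zero over `a`, because
    -- `e` has mean zero.
    sum-variation : ∀ e → sum e ≡ 0ℚ → sum (variation e) ≡ ι p * (ι 2 * norm² e)
    sum-variation e Σe≡0 = begin
      sum (λ a → sum (λ s → (e s - e (s +ₚ a)) * (e s - e (s +ₚ a))))
        ≡⟨ ∑-comm (λ a s → (e s - e (s +ₚ a)) * (e s - e (s +ₚ a))) ⟩
      sum (λ s → sum (λ a → (e s - e (s +ₚ a)) * (e s - e (s +ₚ a))))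
        ≡⟨ sum-cong-≗ inner ⟩
      sum (λ s → ι p * (e s * e s) + N)
        ≡⟨ ∑-distrib-+ (λ s → ι p * (e s * e s)) (λ _ → N) ⟩
      sum (λ s → ι p * (e s * e s)) + sum {p} (λ _ → N)
        ≡⟨ cong₂ _+_ (sym (*-distribˡ-sum (ι p) (λ s → e s * e s))) (sum-const p N) ⟩
      ι p * N + ι p * N
        ≡⟨ solve 2 (λ k x → k :* x :+ k :* x := k :* (con (ι 2) :* x)) refl (ι p) N ⟩
      ι p * (ι 2 * N) ∎
      where
      open ≡-Reasoning
      N = norm² e
      inner : ∀ s → sum (λ a → (e s - e (s +ₚ a)) * (e s - e (s +ₚ a))) ≡ ι p * (e s * e s) + N
      inner s = begin
        sum (λ a → (x - e (s +ₚ a)) * (x - e (s +ₚ a)))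
          ≡⟨ sum-cong-≗ (λ a → trans (cong (λ t → (x - e t) * (x - e t)) (+ₚ-comm s a)) (square x (e (a +ₚ s)))) ⟩
        sum (λ a → (λ b → x * x + (- (ι 2 * x)) * e b + e b * e b) (a +ₚ s))
          ≡⟨ sum-translate (λ b → x * x + (- (ι 2 * x)) * e b + e b * e b) s ⟩
        sum (λ b → x * x + (- (ι 2 * x)) * e b + e b * e b)
          ≡⟨ ∑-distrib-+ (λ b → x * x + (- (ι 2 * x)) * e b) (λ b → e b * e b) ⟩
        sum (λ b → x * x + (- (ι 2 * x)) * e b) + N
          ≡⟨ cong (_+ N) (∑-distrib-+ (λ _ → x * x) (λ b → (- (ι 2 * x)) * e b)) ⟩
        sum {p} (λ _ → x * x) + sum (λ b → (- (ι 2 * x)) * e b) + N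
          ≡⟨ cong₂ (λ a b → a + b + N) (sum-const p (x * x))
               (trans (sym (*-distribˡ-sum (- (ι 2 * x)) e)) (trans (cong (- (ι 2 * x) *_) Σe≡0) (ℚ.*-zeroʳ (- (ι 2 * x))))) ⟩
        ι p * (x * x) + 0ℚ + N
          ≡⟨ cong (_+ N) (ℚ.+-identityʳ (ι p * (x * x))) ⟩
        ι p * (x * x) + N ∎
        where
        x = e s
        square : ∀ x y → (x - y) * (x - y) ≡ x * x + (- (ι 2 * x)) * y + y * y
        square = solve 2 (λ x y → (x :- y) :* (x :- y)
          := x :* x :+ (:- (con (ι 2) :* x)) :* y :+ y :* y) refl

    -- A Poincaré inequality on the cycle generated by g.
    poincaré : ∀ e → sum e ≡ 0ℚ → ∀ {g} → g ≢ 0ₚ → ι 2 * norm² e ≤ ι 4 ^ p * variation e g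
    poincaré e Σe≡0 {g} g≢0 = *-cancelˡ-≤ (ι p) (0<ι p) (begin
      ι p * (ι 2 * norm² e)                 ≡⟨ sum-variation e Σe≡0 ⟨
      sum (variation e)                     ≤⟨ sum-mono (variation-≤ e g≢0) ⟩
      sum {p} (λ _ → ι 4 ^ p * variation e g)   ≡⟨ sum-const p (ι 4 ^ p * variation e g) ⟩
      ι p * (ι 4 ^ p * variation e g)       ∎)
      where open ℚ.≤-Reasoning

    record BalancedLaw (ε : ℚ) : Set where
      field
        integral      : Integral (Fin p)
        isProbability : IsProbability integral
        bounded       : ∀ a → ∫ integral (λ t → 𝟙 (t Fin.≟ a)) ≤ 1ℚ - ε

    open BalancedLaw public

    module _ {ε} (μ : BalancedLaw ε) where

      private
        I = integral μ

      -- If `e` is the law of some variable, this is the law of that variable plus `g *ₚ t`, with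
      -- `t` drawn independently from `μ`.
      convolve : Fin p → (Fin p → ℚ) → Fin p → ℚ
      convolve g e s = ∫ I (λ t → e (s +ₚ -ₚ (g *ₚ t)))

      variation-translate : ∀ e a b →
        sum (λ s → (e (s +ₚ -ₚ a) - e (s +ₚ -ₚ b)) * (e (s +ₚ -ₚ a) - e (s +ₚ -ₚ b))) ≡ variation e (a +ₚ -ₚ b)
      variation-translate e a b = trans
        (sum-cong-≗ (λ s → cong (λ c → (e (s +ₚ -ₚ a) - e c) * (e (s +ₚ -ₚ a) - e c)) (shift s)))
        (sum-translate (λ s → (e s - e (s +ₚ (a +ₚ -ₚ b))) * (e s - e (s +ₚ (a +ₚ -ₚ b)))) (-ₚ a))
        where
        shift : ∀ s → s +ₚ -ₚ b ≡ (s +ₚ -ₚ a) +ₚ (a +ₚ -ₚ b)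
        shift s = sym (trans (sym (+ₚ-assoc (s +ₚ -ₚ a) a (-ₚ b))) (cong (_+ₚ -ₚ b) (-ₚ-cancelʳ s a)))

      -- This is `variance` for each fixed `s`, summed over `s`: the means form the convolution, and
      -- the second moments add up to `norm² e` because the sum over residues is translation
      -- invariant.
      norm²-convolve : ∀ g e →
        ∫ I (λ t → ∫ I (λ t′ → variation e (g *ₚ t +ₚ -ₚ (g *ₚ t′)))) ≡ ι 2 * norm² e - ι 2 * norm² (convolve g e)
      norm²-convolve g e = begin
        ∫ I (λ t → ∫ I (λ t′ → variation e (g *ₚ t +ₚ -ₚ (g *ₚ t′))))
          ≡⟨ ∫-cong I (λ t → ∫-cong I (λ t′ → sym (variation-translate e (g *ₚ t) (g *ₚ t′)))) ⟩
        ∫ I (λ t → ∫ I (λ t′ → sum (λ s → d s t t′ * d s t t′)))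
          ≡⟨ ∫-cong I (λ t → ∫-sum I (λ s t′ → d s t t′ * d s t t′)) ⟩
        ∫ I (λ t → sum (λ s → ∫ I (λ t′ → d s t t′ * d s t t′)))
          ≡⟨ ∫-sum I (λ s t → ∫ I (λ t′ → d s t t′ * d s t t′)) ⟩
        sum (λ s → ∫ I (λ t → ∫ I (λ t′ → d s t t′ * d s t t′)))
          ≡⟨ sum-cong-≗ (λ s → variance I (isProbability μ) (y s)) ⟩
        sum (λ s → ι 2 * ∫ I (λ t → y s t * y s t) - ι 2 * (convolve g e s * convolve g e s))
          ≡⟨ ∫-sub (counting p) (λ s → ι 2 * ∫ I (λ t → y s t * y s t)) (λ s → ι 2 * (convolve g e s * convolve g e s)) ⟩
        sum (λ s → ι 2 * ∫ I (λ t → y s t * y s t)) - sum (λ s → ι 2 * (convolve g e s * convolve g e s))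
          ≡⟨ cong₂ _-_
               (trans (∫-* (counting p) (ι 2) (λ s → ∫ I (λ t → y s t * y s t))) (cong (ι 2 *_) moment))
               (∫-* (counting p) (ι 2) (λ s → convolve g e s * convolve g e s)) ⟩
        ι 2 * norm² e - ι 2 * norm² (convolve g e) ∎
        where
        open ≡-Reasoning
        y : Fin p → Fin p → ℚ
        y s t = e (s +ₚ -ₚ (g *ₚ t))
        d : Fin p → Fin p → Fin p → ℚ
        d s t t′ = y s t - y s t′
        moment : sum (λ s → ∫ I (λ t → y s t * y s t)) ≡ norm² e
        moment = begin
          sum (λ s → ∫ I (λ t → y s t * y s t))   ≡⟨ ∫-sum I (λ s t → y s t * y s t) ⟨
          ∫ I (λ t → sum (λ s → y s t * y s t))   ≡⟨ ∫-cong I (λ t → sum-translate (λ s → e s * e s) (-ₚ (g *ₚ t))) ⟩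
          ∫ I (λ _ → norm² e)                     ≡⟨ ∫-const I (isProbability μ) (norm² e) ⟩
          norm² e                                 ∎

      -- Two independent samples `t`, `t′` differ with probability at least ε; then `g *ₚ t` and
      -- `g *ₚ t′` differ as well, and the Poincaré inequality bounds the variation along their
      -- difference from below. The factor `4⁻ᵖ` is the inverse of its constant.
      norm²-contract : ∀ {g} → g ≢ 0ₚ → ∀ e → sum e ≡ 0ℚ →
        norm² (convolve g e) ≤ (1ℚ - ε * (ℤ.+ 1 ℚ./ 4) ^ p) * norm² e
      norm²-contract {g} g≢0 e Σe≡0 = *-cancelˡ-≤ (ι 2 * Y) (0<p*q (0<ι 2) (0<^ p (0<ι 4))) (begin
        ι 2 * Y * N′
          ≡⟨ solve 3 (λ y n m → con (ι 2) :* y :* m := con (ι 2) :* y :* n :- y :* (con (ι 2) :* n :- con (ι 2) :* m)) refl Y N N′ ⟩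
        ι 2 * Y * N - Y * (ι 2 * N - ι 2 * N′)
          ≤⟨ ℚ.+-monoʳ-≤ (ι 2 * Y * N) (ℚ.neg-antimono-≤ gain) ⟩
        ι 2 * Y * N - ι 2 * N * ε
          ≡⟨ cong (λ t → ι 2 * Y * N - t) (ℚ.*-identityʳ (ι 2 * N * ε)) ⟨
        ι 2 * Y * N - ι 2 * N * ε * 1ℚ
          ≡⟨ cong (λ t → ι 2 * Y * N - ι 2 * N * ε * t) Yc≡1 ⟨
        ι 2 * Y * N - ι 2 * N * ε * (Y * c)
          ≡⟨ solve 4 (λ y n e c → con (ι 2) :* y :* n :- con (ι 2) :* n :* e :* (y :* c)
               := con (ι 2) :* y :* ((con 1ℚ :- e :* c) :* n)) refl Y N ε c ⟩
        ι 2 * Y * ((1ℚ - ε * c) * N) ∎)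
        where
        open ℚ.≤-Reasoning
        Y = ι 4 ^ p
        c = (ℤ.+ 1 ℚ./ 4) ^ p
        N = norm² e
        N′ = norm² (convolve g e)
        Yc≡1 : Y * c ≡ 1ℚ
        Yc≡1 = a^n*b^n≡1 p refl
        separate : ∀ t t′ → ι 2 * N * (1ℚ - 𝟙 (t′ Fin.≟ t)) ≤ Y * variation e (g *ₚ t +ₚ -ₚ (g *ₚ t′))
        separate t t′ with t′ Fin.≟ t
        ... | yes _    = subst (_≤ Y * variation e (g *ₚ t +ₚ -ₚ (g *ₚ t′))) (sym (ℚ.*-zeroʳ (ι 2 * N)))
                           (0≤p*q (0≤^ p (0≤ι 4)) (0≤variation e (g *ₚ t +ₚ -ₚ (g *ₚ t′))))
        ... | no t′≢t = subst (_≤ Y * variation e (g *ₚ t +ₚ -ₚ (g *ₚ t′))) (sym (ℚ.*-identityʳ (ι 2 * N)))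
                           (poincaré e Σe≡0 nonzero)
          where
          nonzero : g *ₚ t +ₚ -ₚ (g *ₚ t′) ≢ 0ₚ
          nonzero eq = t′≢t (*ₚ-cancelʳ g≢0 t′ t (trans (*ₚ-comm t′ g) (trans (sym equal) (*ₚ-comm g t))))
            where
            equal : g *ₚ t ≡ g *ₚ t′
            equal = trans (sym (-ₚ-cancelʳ (g *ₚ t) (g *ₚ t′)))
              (trans (cong (_+ₚ g *ₚ t′) eq) (+ₚ-identityˡ (g *ₚ t′)))
        gain : ι 2 * N * ε ≤ Y * (ι 2 * N - ι 2 * N′)
        gain = begin
          ι 2 * N * ε
            ≡⟨ ∫-const I (isProbability μ) (ι 2 * N * ε) ⟨
          ∫ I (λ _ → ι 2 * N * ε)
            ≤⟨ ∫-mono I spread ⟩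
          ∫ I (λ t → ∫ I (λ t′ → ι 2 * N * (1ℚ - 𝟙 (t′ Fin.≟ t))))
            ≤⟨ ∫-mono I (λ t → ∫-mono I (separate t)) ⟩
          ∫ I (λ t → ∫ I (λ t′ → Y * variation e (g *ₚ t +ₚ -ₚ (g *ₚ t′))))
            ≡⟨ trans (∫-cong I (λ t → ∫-* I Y (λ t′ → variation e (g *ₚ t +ₚ -ₚ (g *ₚ t′)))))
                 (∫-* I Y (λ t → ∫ I (λ t′ → variation e (g *ₚ t +ₚ -ₚ (g *ₚ t′))))) ⟩
          Y * ∫ I (λ t → ∫ I (λ t′ → variation e (g *ₚ t +ₚ -ₚ (g *ₚ t′))))
            ≡⟨ cong (Y *_) (norm²-convolve g e) ⟩
          Y * (ι 2 * N - ι 2 * N′) ∎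
          where
          -- Balance at the single value `t` leaves mass at least ε for the samples `t′` different
          -- from `t`.
          spread : ∀ t → ι 2 * N * ε ≤ ∫ I (λ t′ → ι 2 * N * (1ℚ - 𝟙 (t′ Fin.≟ t)))
          spread t = begin
            ι 2 * N * ε
              ≤⟨ *-monoˡ-≤ (0≤p*q (0≤ι 2) (0≤norm² e)) (p+r≡q⇒p≤q (1ℚ - ε - q)
                   (solve 2 (λ e q → e :+ (con 1ℚ :- e :- q) := con 1ℚ :- q) refl ε q)
                   (p≤q⇒0≤q-p (bounded μ t))) ⟩
            ι 2 * N * (1ℚ - q)
              ≡⟨ cong (λ r → ι 2 * N * (r - q)) (isProbability μ) ⟨
            ι 2 * N * (∫ I (λ _ → 1ℚ) - q)
              ≡⟨ cong (ι 2 * N *_) (∫-sub I (λ _ → 1ℚ) (λ t′ → 𝟙 (t′ Fin.≟ t))) ⟨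
            ι 2 * N * ∫ I (λ t′ → 1ℚ - 𝟙 (t′ Fin.≟ t))
              ≡⟨ ∫-* I (ι 2 * N) (λ t′ → 1ℚ - 𝟙 (t′ Fin.≟ t)) ⟨
            ∫ I (λ t′ → ι 2 * N * (1ℚ - 𝟙 (t′ Fin.≟ t))) ∎
            where
            q = ∫ I (λ t′ → 𝟙 (t′ Fin.≟ t))

    weight : ∀ {m} → Vec (Fin p) m → ℕ
    weight []      = 0
    weight (a ∷ w) = if does (a Fin.≟ 0ₚ) then weight w else suc (weight w)

    decay : ℚ → ℚ
    decay ε = 1ℚ - ε * (ℤ.+ 1 ℚ./ 4) ^ p

    0≤decay : ∀ {ε} → 0ℚ ≤ ε → ε ≤ 1ℚ → 0ℚ ≤ decay ε
    0≤decay {ε} 0≤ε ε≤1 = p≤q⇒0≤q-p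
      (ℚ.≤-trans (p*q≤p 0≤ε (^≤1 p (ℚ.nonNegative⁻¹ (ℤ.+ 1 ℚ./ 4)) (ℚ.*≤* (ℤ.+≤+ (ℕ.s≤s ℕ.z≤n))))) ε≤1)

    decay<1 : ∀ {ε} → 0ℚ < ε → decay ε < 1ℚ
    decay<1 {ε} 0<ε = p+r≡q⇒p<q (ε * (ℤ.+ 1 ℚ./ 4) ^ p)
      (solve 1 (λ x → con 1ℚ :- x :+ x := con 1ℚ) refl (ε * (ℤ.+ 1 ℚ./ 4) ^ p))
      (0<p*q 0<ε (0<^ p (ℚ.positive⁻¹ (ℤ.+ 1 ℚ./ 4))))

    row : ∀ {ε m} → (Fin m → BalancedLaw ε) → Integral (Vec (Fin p) m)
    row μ = iterated (λ j → integral (μ j))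

    row-isProbability : ∀ {ε m} (μ : Fin m → BalancedLaw ε) → IsProbability (row μ)
    row-isProbability μ = iterated-isProbability _ (λ j → isProbability (μ j))

    ℙ[_∙≡_] : ∀ {ε m} → Vec (Fin p) m → Fin p → (Fin m → BalancedLaw ε) → ℚ
    ℙ[ w ∙≡ s ] μ = ∫ (row μ) (λ x → 𝟙 (w ∙ x Fin.≟ s))

    bias : ∀ {ε m} → (Fin m → BalancedLaw ε) → Vec (Fin p) m → Fin p → ℚ
    bias μ w s = ℙ[ w ∙≡ s ] μ - p ^- 1

    -- In `row` the head is the inner variable. Exchanging the integrals puts it outside, and for a
    -- fixed head `t` the condition on the tail only has its target `s` shifted by `a *ₚ t`.
    bias-∷ : ∀ {ε m} (μ : Fin (suc m) → BalancedLaw ε) a w s →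
      bias μ (a ∷ w) s ≡ convolve (μ zero) a (bias (μ ∘ suc) w) s
    bias-∷ μ a w s = begin
      ∫ T (λ x → ∫ H (λ t → 𝟙 (a *ₚ t +ₚ w ∙ x Fin.≟ s))) - p ^- 1
        ≡⟨ cong (_- p ^- 1) (∫-swap H T (λ t x → 𝟙 (a *ₚ t +ₚ w ∙ x Fin.≟ s))) ⟩
      ∫ H (λ t → ∫ T (λ x → 𝟙 (a *ₚ t +ₚ w ∙ x Fin.≟ s))) - p ^- 1
        ≡⟨ cong₂ _-_ (∫-cong H (λ t → ∫-cong T (λ x → 𝟙-cong (a *ₚ t +ₚ w ∙ x Fin.≟ s) (w ∙ x Fin.≟ s +ₚ -ₚ (a *ₚ t))
               (λ eq → trans (sym (trans (cong (_+ₚ -ₚ (a *ₚ t)) (+ₚ-comm (a *ₚ t) (w ∙ x))) (+ₚ-cancelʳ (w ∙ x) (a *ₚ t))))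
                 (cong (_+ₚ -ₚ (a *ₚ t)) eq))
               (λ eq → trans (cong (a *ₚ t +ₚ_) eq)
                 (trans (+ₚ-comm (a *ₚ t) (s +ₚ -ₚ (a *ₚ t))) (-ₚ-cancelʳ s (a *ₚ t)))))))
             (sym (∫-const H (isProbability (μ zero)) (p ^- 1))) ⟩
      ∫ H (λ t → ℙ[ w ∙≡ s +ₚ -ₚ (a *ₚ t) ] (μ ∘ suc)) - ∫ H (λ _ → p ^- 1)
        ≡⟨ ∫-sub H (λ t → ℙ[ w ∙≡ s +ₚ -ₚ (a *ₚ t) ] (μ ∘ suc)) (λ _ → p ^- 1) ⟨
      convolve (μ zero) a (bias (μ ∘ suc) w) s ∎
      where
      open ≡-Reasoning
      H = integral (μ zero)
      T = row (μ ∘ suc)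

    sum-bias : ∀ {ε m} (μ : Fin m → BalancedLaw ε) w → sum (bias μ w) ≡ 0ℚ
    sum-bias μ w = begin
      sum (λ s → ∫ (row μ) (λ x → 𝟙 (w ∙ x Fin.≟ s)) - p ^- 1)
        ≡⟨ ∫-sub (counting p) (λ s → ∫ (row μ) (λ x → 𝟙 (w ∙ x Fin.≟ s))) (λ _ → p ^- 1) ⟩
      sum (λ s → ∫ (row μ) (λ x → 𝟙 (w ∙ x Fin.≟ s))) - sum {p} (λ _ → p ^- 1)
        ≡⟨ cong₂ _-_ total′ (trans (sum-const p (p ^- 1)) p*p^-1≡1) ⟩
      1ℚ - 1ℚ
        ≡⟨⟩
      0ℚ ∎
      where
      open ≡-Reasoning
      total′ : sum (λ s → ∫ (row μ) (λ x → 𝟙 (w ∙ x Fin.≟ s))) ≡ 1ℚ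
      total′ = begin
        sum (λ s → ∫ (row μ) (λ x → 𝟙 (w ∙ x Fin.≟ s)))
          ≡⟨ ∫-sum (row μ) (λ s x → 𝟙 (w ∙ x Fin.≟ s)) ⟨
        ∫ (row μ) (λ x → sum (λ s → 𝟙 (w ∙ x Fin.≟ s)))
          ≡⟨ ∫-cong (row μ) (λ x → trans
               (sum-single (λ s → 𝟙 (w ∙ x Fin.≟ s)) (w ∙ x) (λ s s≢ → 𝟙-no (w ∙ x Fin.≟ s) (s≢ ∘ sym)))
               (𝟙-yes (w ∙ x Fin.≟ w ∙ x) refl)) ⟩
        ∫ (row μ) (λ _ → 1ℚ)
          ≡⟨ row-isProbability μ ⟩
        1ℚ ∎

    -- A zero coordinate leaves the bias unchanged; a nonzero one contracts it, as `sum-bias`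
    -- supplies the mean zero that the Poincaré inequality asks for. For the empty vector the
    -- product is constantly 0 and the value is `1 - p⁻¹`.
    norm²-bias : ∀ {ε} → 0ℚ ≤ ε → ε ≤ 1ℚ → ∀ {m} (μ : Fin m → BalancedLaw ε) w →
      norm² (bias μ w) ≤ decay ε ^ weight w
    norm²-bias 0≤ε ε≤1 μ [] = begin
      sum (λ s → bias μ [] s * bias μ [] s)
        ≡⟨ sum-cong-≗ (λ s → square (0ₚ Fin.≟ s)) ⟩
      sum (λ s → (1ℚ - ι 2 * x) * 𝟙 (0ₚ Fin.≟ s) + x * x)
        ≡⟨ ∑-distrib-+ (λ s → (1ℚ - ι 2 * x) * 𝟙 (0ₚ Fin.≟ s)) (λ _ → x * x) ⟩
      sum (λ s → (1ℚ - ι 2 * x) * 𝟙 (0ₚ Fin.≟ s)) + sum {p} (λ _ → x * x)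
        ≡⟨ cong₂ _+_
             (trans (sum-single (λ s → (1ℚ - ι 2 * x) * 𝟙 (0ₚ Fin.≟ s)) 0ₚ
               (λ s s≢0 → trans (cong ((1ℚ - ι 2 * x) *_) (𝟙-no (0ₚ Fin.≟ s) (s≢0 ∘ sym))) (ℚ.*-zeroʳ (1ℚ - ι 2 * x))))
               (cong ((1ℚ - ι 2 * x) *_) (𝟙-yes (0ₚ Fin.≟ 0ₚ) refl)))
             (trans (sum-const p (x * x)) (trans (sym (ℚ.*-assoc (ι p) x x)) (cong (_* x) p*p^-1≡1))) ⟩
      (1ℚ - ι 2 * x) * 1ℚ + 1ℚ * x
        ≤⟨ p+r≡q⇒p≤q x (solve 1 (λ x → (con 1ℚ :- con (ι 2) :* x) :* con 1ℚ :+ con 1ℚ :* x :+ x := con 1ℚ) refl x)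
             (ℚ.nonNegative⁻¹ x {{ℚ.normalize-nonNeg 1 (p ℕ.^ 1) {{ℕ.m^n≢0 p 1}}}}) ⟩
      1ℚ ∎
      where
      open ℚ.≤-Reasoning
      x = p ^- 1
      square : ∀ {P : Set} (P? : Dec P) → (𝟙 P? - x) * (𝟙 P? - x) ≡ (1ℚ - ι 2 * x) * 𝟙 P? + x * x
      square (yes _) = solve 1 (λ x → (con 1ℚ :- x) :* (con 1ℚ :- x) := (con 1ℚ :- con (ι 2) :* x) :* con 1ℚ :+ x :* x) refl x
      square (no _)  = solve 1 (λ x → (con 0ℚ :- x) :* (con 0ℚ :- x) := (con 1ℚ :- con (ι 2) :* x) :* con 0ℚ :+ x :* x) refl x
    norm²-bias {ε} 0≤ε ε≤1 μ (a ∷ w) with a Fin.≟ 0ₚ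
    ... | yes refl = begin
      norm² (bias μ (0ₚ ∷ w))      ≡⟨ sum-cong-≗ (λ s → cong₂ _*_ (same s) (same s)) ⟩
      norm² (bias (μ ∘ suc) w)     ≤⟨ norm²-bias 0≤ε ε≤1 (μ ∘ suc) w ⟩
      decay ε ^ weight w           ∎
      where
      open ℚ.≤-Reasoning
      s-0*t≡s : ∀ s t → s +ₚ -ₚ (0ₚ *ₚ t) ≡ s
      s-0*t≡s s t = trans (cong (s +ₚ_) (trans (cong -ₚ_ (*ₚ-zeroˡ t))
        (trans (sym (+ₚ-identityˡ (-ₚ 0ₚ))) (+ₚ-inverseʳ 0ₚ)))) (+ₚ-identityʳ s)
      same : ∀ s → bias μ (0ₚ ∷ w) s ≡ bias (μ ∘ suc) w s
      same s = trans (bias-∷ μ 0ₚ w s) (trans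
        (∫-cong (integral (μ zero)) (λ t → cong (bias (μ ∘ suc) w) (s-0*t≡s s t)))
        (∫-const (integral (μ zero)) (isProbability (μ zero)) (bias (μ ∘ suc) w s)))
    ... | no a≢0 = begin
      norm² (bias μ (a ∷ w))
        ≡⟨ sum-cong-≗ (λ s → cong₂ _*_ (bias-∷ μ a w s) (bias-∷ μ a w s)) ⟩
      norm² (convolve (μ zero) a (bias (μ ∘ suc) w))
        ≤⟨ norm²-contract (μ zero) a≢0 (bias (μ ∘ suc) w) (sum-bias (μ ∘ suc) w) ⟩
      decay ε * norm² (bias (μ ∘ suc) w)
        ≤⟨ *-monoˡ-≤ (0≤decay 0≤ε ε≤1) (norm²-bias 0≤ε ε≤1 (μ ∘ suc) w) ⟩
      decay ε * decay ε ^ weight w ∎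
      where open ℚ.≤-Reasoning

    bias²≤ : ∀ {ε} → 0ℚ ≤ ε → ε ≤ 1ℚ → ∀ {m} (μ : Fin m → BalancedLaw ε) w s →
      bias μ w s * bias μ w s ≤ decay ε ^ weight w
    bias²≤ 0≤ε ε≤1 μ w s = ℚ.≤-trans
      (term≤sum (λ s → 0≤p*p (bias μ w s)) s) (norm²-bias 0≤ε ε≤1 μ w)

    anticoncentration : ∀ {ε} (μ : BalancedLaw ε) {g} → g ≢ 0ₚ → ∀ b s →
      ∫ (integral μ) (λ t → 𝟙 (g *ₚ t +ₚ b Fin.≟ s)) ≤ 1ℚ - ε
    anticoncentration {ε} μ {g} g≢0 b s with (t₀ , t₀g≡s-b) ← *ₚ-divisible g≢0 (s +ₚ -ₚ b) =
      ℚ.≤-trans (∫-mono (integral μ) (λ t → 𝟙-mono (g *ₚ t +ₚ b Fin.≟ s) (t Fin.≟ t₀) (unique t))) (bounded μ t₀)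
      where
      unique : ∀ t → g *ₚ t +ₚ b ≡ s → t ≡ t₀
      unique t eq = *ₚ-cancelʳ g≢0 t t₀ (trans (*ₚ-comm t g)
        (trans (sym (+ₚ-cancelʳ (g *ₚ t) b)) (trans (cong (_+ₚ -ₚ b) eq) (sym t₀g≡s-b))))

    -- Given the entries after the first nonzero coordinate of `w`, at most one value of the entry
    -- at that coordinate makes the product vanish.
    ℙ[∙≡0]≤ : ∀ {ε m} (μ : Fin m → BalancedLaw ε) w → w ≢ 0ᵥ → ℙ[ w ∙≡ 0ₚ ] μ ≤ 1ℚ - ε
    ℙ[∙≡0]≤ μ []      w≢0 = contradiction refl w≢0
    ℙ[∙≡0]≤ {ε} μ (a ∷ w) w≢0 with a Fin.≟ 0ₚ
    ... | no a≢0 = ℚ.≤-trans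
      (∫-mono (row (μ ∘ suc)) (λ x → anticoncentration (μ zero) a≢0 (w ∙ x) 0ₚ))
      (ℚ.≤-reflexive (∫-const (row (μ ∘ suc)) (row-isProbability (μ ∘ suc)) (1ℚ - ε)))
    ... | yes refl = ℚ.≤-trans (∫-mono (row (μ ∘ suc)) (λ x → ℚ.≤-trans
      (∫-mono H (λ t → 𝟙-mono (0ₚ *ₚ t +ₚ w ∙ x Fin.≟ 0ₚ) (w ∙ x Fin.≟ 0ₚ)
        (trans (sym (trans (cong (_+ₚ w ∙ x) (*ₚ-zeroˡ t)) (+ₚ-identityˡ (w ∙ x)))))))
      (ℚ.≤-reflexive (∫-const H (isProbability (μ zero)) (𝟙 (w ∙ x Fin.≟ 0ₚ))))))
      (ℙ[∙≡0]≤ (μ ∘ suc) w (w≢0 ∘ cong (0ₚ ∷_)))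
      where H = integral (μ zero)

    -- Subspaces and rank

    1<p : 1 ℕ.< p
    1<p = ℕ.nonTrivial⇒n>1 p {{prime⇒nonTrivial isPrime}}

    1<ιp : 1ℚ < ι p
    1<ιp = ℚ.<-≤-trans (p+r≡q⇒p<q 1ℚ refl 0<1) (ι-mono {2} 1<p)

    -- Lets dimensions be compared through cardinalities: together with `size≡p^dim` it turns
    -- counting arguments into identities for `dim`.
    ιp^-injective : ∀ a b → ι p ^ a ≡ ι p ^ b → a ≡ b
    ιp^-injective zero    zero    eq = refl
    ιp^-injective zero    (suc b) eq = contradiction eq (ℚ.<⇒≢ (1<ιp^suc b))
      where
      1<ιp^suc : ∀ b → 1ℚ < ι p ^ suc b
      1<ιp^suc b = ℚ.<-≤-trans 1<ιp (subst (_≤ ι p ^ suc b) (ℚ.*-identityʳ (ι p))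
        (*-monoˡ-≤ (0≤ι p) (1≤^ b (ℚ.<⇒≤ 1<ιp))))
    ιp^-injective (suc a) zero    eq = sym (ιp^-injective zero (suc a) (sym eq))
    ιp^-injective (suc a) (suc b) eq = cong suc (ιp^-injective a b (*-cancelˡ-≡ (ι p) (0<ι p) eq))

    record Subspace (m : ℕ) : Set₁ where
      field
        Member  : Vec (Fin p) m → Set
        member? : ∀ w → Dec (Member w)
        0∈      : Member 0ᵥ
        closed  : ∀ {w v} c → Member w → Member v → Member (w ⊕ c · v)

    open Subspace public

    -- Covers both the rows of a matrix, as `dot`, and the coordinates of the ambient space, as
    -- `coordinate`. The same dimension count for `cut` thus serves the exposure of a row and the
    -- comparison with sets of columns.
    record Functional (m : ℕ) : Set where
      field
        eval   : Vec (Fin p) m → Fin p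
        linear : ∀ w v c → eval (w ⊕ c · v) ≡ eval w +ₚ c *ₚ eval v
        eval-0 : eval 0ᵥ ≡ 0ₚ

    open Functional public

    dot : ∀ {m} → Vec (Fin p) m → Functional m
    dot x = record { eval = _∙ x ; linear = λ w v c → ∙-linear w v x c ; eval-0 = 0ᵥ∙x≡0 x }

    coordinate : ∀ {m} → Fin m → Functional m
    coordinate j = record
      { eval   = λ w → lookup w j
      ; linear = λ w v c → lookup-zipWith (λ a b → a +ₚ c *ₚ b) j w v
      ; eval-0 = lookup-replicate j 0ₚ
      }

    whole : ∀ {m} → Subspace m
    whole = record { Member = λ _ → ⊤ ; member? = λ _ → yes tt ; 0∈ = tt ; closed = λ _ _ _ → tt }

    cut : ∀ {m} → Subspace m → Functional m → Subspace m
    cut K φ = record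
      { Member  = λ w → Member K w × eval φ w ≡ 0ₚ
      ; member? = λ w → member? K w ×-dec (eval φ w Fin.≟ 0ₚ)
      ; 0∈      = 0∈ K , eval-0 φ
      ; closed  = λ { {w} {v} c (w∈ , φw) (v∈ , φv) → closed K c w∈ v∈ ,
          trans (linear φ w v c) (trans (cong₂ (λ a b → a +ₚ c *ₚ b) φw φv)
            (trans (+ₚ-identityˡ (c *ₚ 0ₚ)) (*ₚ-zeroʳ c))) }
      }

    tailSubspace : ∀ {m} → Subspace (suc m) → Subspace m
    tailSubspace K = record
      { Member  = λ w → Member K (0ₚ ∷ w)
      ; member? = λ w → member? K (0ₚ ∷ w)
      ; 0∈      = 0∈ K
      ; closed  = λ {w} {v} c w∈ v∈ → subst (λ a → Member K (a ∷ (w ⊕ c · v)))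
          (trans (+ₚ-identityˡ (c *ₚ 0ₚ)) (*ₚ-zeroʳ c)) (closed K c w∈ v∈)
      }

    size : ∀ {m} → Subspace m → ℚ
    size {m} K = ∫ (countingVec p m) (λ w → 𝟙 (member? K w))

    size-cong : ∀ {m} (K L : Subspace m) → (∀ w → Member K w → Member L w) → (∀ w → Member L w → Member K w) →
      size K ≡ size L
    size-cong {m} K L K⊆L L⊆K = ∫-cong (countingVec p m)
      (λ w → 𝟙-cong (member? K w) (member? L w) (K⊆L w) (L⊆K w))

    NonVanishing : ∀ {m} → Subspace m → Functional m → Set
    NonVanishing K φ = ∃[ v ] (Member K v × eval φ v ≢ 0ₚ)

    nonVanishing? : ∀ {m} (K : Subspace m) φ → Dec (NonVanishing K φ)
    nonVanishing? K φ = anyVec? (λ v → member? K v ×-dec ¬? (eval φ v Fin.≟ 0ₚ))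

    vanishing : ∀ {m} (K : Subspace m) φ → ¬ NonVanishing K φ → ∀ w → Member K w → eval φ w ≡ 0ₚ
    vanishing K φ none w w∈ = decidable-stable (eval φ w Fin.≟ 0ₚ) (λ φw≢0 → none (w , w∈ , φw≢0))

    ⊕-cancel : ∀ {m} (w v : Vec (Fin p) m) c → (w ⊕ c · v) ⊕ -ₚ c · v ≡ w
    ⊕-cancel []      []      c = refl
    ⊕-cancel (a ∷ w) (b ∷ v) c = cong₂ _∷_
      (trans (cong (λ t → (a +ₚ c *ₚ b) +ₚ t) (sym (-ₚ-distribˡ-*ₚ c b))) (+ₚ-cancelʳ a (c *ₚ b)))
      (⊕-cancel w v c)

    -- Each coset of the line through v in K meets the kernel of φ exactly once.
    size-cut : ∀ {m} (K : Subspace m) φ → NonVanishing K φ → size K ≡ ι p * size (cut K φ)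
    size-cut {m} K φ (v , v∈ , φv≢0) = sym (begin
      ι p * size L
        ≡⟨ sum-const p (size L) ⟨
      sum {p} (λ _ → size L)
        ≡⟨ sum-cong-≗ (λ c → sym (sum-countingVec-translate (λ w → 𝟙 (member? L w)) c v)) ⟩
      sum (λ c → ∫ (countingVec p m) (λ w → 𝟙 (member? L (w ⊕ c · v))))
        ≡⟨ sum-countingVec p m (λ c w → 𝟙 (member? L (w ⊕ c · v))) ⟩
      ∫ (countingVec p m) (λ w → sum (λ c → 𝟙 (member? L (w ⊕ c · v))))
        ≡⟨ ∫-cong (countingVec p m) fibre ⟩
      size K ∎)
      where
      open ≡-Reasoning
      L = cut K φ
      fibre : ∀ w → sum (λ c → 𝟙 (member? L (w ⊕ c · v))) ≡ 𝟙 (member? K w)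
      fibre w with member? K w
      ... | no w∉ = sum-zero (λ c → 𝟙-no (member? L (w ⊕ c · v))
        (λ (wv∈ , _) → w∉ (subst (Member K) (⊕-cancel w v c) (closed K (-ₚ c) wv∈ v∈))))
      ... | yes w∈ with (c₀ , c₀φv) ← *ₚ-divisible φv≢0 (-ₚ eval φ w) = trans
        (sum-single (λ c → 𝟙 (member? L (w ⊕ c · v))) c₀
          (λ c c≢c₀ → 𝟙-no (member? L (w ⊕ c · v)) (λ (_ , eq) → c≢c₀ (unique c eq))))
        (𝟙-yes (member? L (w ⊕ c₀ · v)) (closed K c₀ w∈ v∈ ,
          trans (linear φ w v c₀) (trans (cong (eval φ w +ₚ_) c₀φv) (+ₚ-inverseʳ (eval φ w)))))
        where
        unique : ∀ c → eval φ (w ⊕ c · v) ≡ 0ₚ → c ≡ c₀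
        unique c eq = *ₚ-cancelʳ φv≢0 c c₀ (trans
          (+ₚ-inverseʳ-unique (eval φ w) (c *ₚ eval φ v) (trans (sym (linear φ w v c)) eq)) (sym c₀φv))

    headFunctional : ∀ {m} → Functional (suc m)
    headFunctional = coordinate zero

    -- Counts the pivots, that is, the positions at which some member has its first nonzero
    -- coordinate. The recursion runs coordinate by coordinate like the exposure of a row in
    -- `ℙ[stay]≤`, and its branches also decide the set in `complement`.
    dim : ∀ {m} → Subspace m → ℕ
    dim {zero}  K = 0
    dim {suc m} K = if does (nonVanishing? K headFunctional) then suc (dim (tailSubspace K)) else dim (tailSubspace K)

    size-tail : ∀ {m} (K : Subspace (suc m)) → (∀ w → Member K w → lookup w zero ≡ 0ₚ) →
      size K ≡ size (tailSubspace K)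
    size-tail {m} K head≡0 = ∫-cong (countingVec p m) (λ w →
      sum-single (λ a → 𝟙 (member? K (a ∷ w))) 0ₚ (λ a a≢0 → 𝟙-no (member? K (a ∷ w)) (a≢0 ∘ head≡0 (a ∷ w))))

    size≡p^dim : ∀ {m} (K : Subspace m) → size K ≡ ι p ^ dim K
    size≡p^dim {zero}  K = 𝟙-yes (member? K []) (0∈ K)
    size≡p^dim {suc m} K with nonVanishing? K headFunctional
    ... | yes nv = begin
      size K                                             ≡⟨ size-cut K headFunctional nv ⟩
      ι p * size (cut K headFunctional)                  ≡⟨ cong (ι p *_) (size-tail (cut K headFunctional) (λ _ → proj₂)) ⟩
      ι p * size (tailSubspace (cut K headFunctional))   ≡⟨ cong (ι p *_) (size-cong (tailSubspace (cut K headFunctional)) (tailSubspace K)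
                                                              (λ _ → proj₁) (λ _ w∈ → w∈ , refl)) ⟩
      ι p * size (tailSubspace K)                        ≡⟨ cong (ι p *_) (size≡p^dim (tailSubspace K)) ⟩
      ι p * ι p ^ dim (tailSubspace K)                   ∎
      where open ≡-Reasoning
    ... | no ¬nv = trans (size-tail K (vanishing K headFunctional ¬nv)) (size≡p^dim (tailSubspace K))

    dim-cong : ∀ {m} (K L : Subspace m) → (∀ w → Member K w → Member L w) → (∀ w → Member L w → Member K w) →
      dim K ≡ dim L
    dim-cong K L K⊆L L⊆K = ιp^-injective (dim K) (dim L)
      (trans (sym (size≡p^dim K)) (trans (size-cong K L K⊆L L⊆K) (size≡p^dim L)))

    dim-whole : ∀ m → dim (whole {m}) ≡ m
    dim-whole m = ιp^-injective (dim (whole {m})) m (trans (sym (size≡p^dim (whole {m}))) (∫-countingVec-1 p m))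

    dim-cut-vanishing : ∀ {m} (K : Subspace m) φ → ¬ NonVanishing K φ → dim (cut K φ) ≡ dim K
    dim-cut-vanishing K φ ¬nv = dim-cong (cut K φ) K (λ _ → proj₁) (λ w w∈ → w∈ , vanishing K φ ¬nv w w∈)

    dim-cut-nonVanishing : ∀ {m} (K : Subspace m) φ → NonVanishing K φ → dim K ≡ suc (dim (cut K φ))
    dim-cut-nonVanishing K φ nv = ιp^-injective (dim K) (suc (dim (cut K φ)))
      (trans (sym (size≡p^dim K)) (trans (size-cut K φ nv) (cong (ι p *_) (size≡p^dim (cut K φ)))))

    dim≤1+dim-cut : ∀ {m} (K : Subspace m) φ → dim K ℕ.≤ suc (dim (cut K φ))
    dim≤1+dim-cut K φ with nonVanishing? K φ
    ... | yes nv = ℕ.≤-reflexive (dim-cut-nonVanishing K φ nv)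
    ... | no ¬nv = ℕ.≤-trans (ℕ.≤-reflexive (sym (dim-cut-vanishing K φ ¬nv))) (ℕ.n≤1+n (dim (cut K φ)))

    -- The head row is cut last, matching `iterated`, which integrates over the head inside the
    -- integral over the tail.
    kernel : ∀ {m c} → Vec (Vec (Fin p) m) c → Subspace m
    kernel []      = whole
    kernel (r ∷ A) = cut (kernel A) (dot r)

    nullity : ∀ {m c} → Vec (Vec (Fin p) m) c → ℕ
    nullity A = dim (kernel A)

    m≤c+nullity : ∀ {m c} (A : Vec (Vec (Fin p) m) c) → m ℕ.≤ c ℕ.+ nullity A
    m≤c+nullity {m} []      = ℕ.≤-reflexive (sym (dim-whole m))
    m≤c+nullity {m} {suc c} (r ∷ A) = ℕ.≤-trans (m≤c+nullity A) (ℕ.≤-trans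
      (ℕ.+-monoʳ-≤ c (dim≤1+dim-cut (kernel A) (dot r))) (ℕ.≤-reflexive (ℕ.+-suc c (nullity (r ∷ A)))))

    lookup≡0⇒≡0ᵥ : ∀ {m} (w : Vec (Fin p) m) → (∀ j → lookup w j ≡ 0ₚ) → w ≡ 0ᵥ
    lookup≡0⇒≡0ᵥ []      w≡0 = refl
    lookup≡0⇒≡0ᵥ (a ∷ w) w≡0 = cong₂ _∷_ (w≡0 zero) (lookup≡0⇒≡0ᵥ w (w≡0 ∘ suc))

    -- For the kernel of a matrix this is the linear independence of the columns in `S`: relations
    -- among columns are exactly the kernel vectors supported on `S`.
    TrivialOn : ∀ {m} → Subspace m → Subset m → Set
    TrivialOn K S = ∀ w → Member K w → (∀ j → j ∉ S → lookup w j ≡ 0ₚ) → ∀ j → lookup w j ≡ 0ₚ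

    -- `S` collects the positions that are not pivots. The first nonzero coordinate of a member is a
    -- pivot, so a member supported on `S` has none.
    complement : ∀ {m} (K : Subspace m) → ∃[ S ] (TrivialOn K S × card S ℕ.+ dim K ≡ m)
    complement {zero}  K = [] , (λ _ _ _ ()) , refl
    complement {suc m} K with nonVanishing? K headFunctional | complement (tailSubspace K)
    ... | yes _ | S , trivial , eq = outside ∷ S , triv , trans (ℕ.+-suc (card S) _) (cong suc eq)
      where
      triv : TrivialOn K (outside ∷ S)
      triv (a ∷ w) w∈ w≡0 with w≡0 zero (λ ())
      ... | refl = λ { zero → refl ; (suc j) → trivial w w∈ (λ j j∉S → w≡0 (suc j) λ { (there j∈S) → j∉S j∈S }) j }
    ... | no ¬nv | S , trivial , eq = inside ∷ S , triv , cong suc eq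
      where
      triv : TrivialOn K (inside ∷ S)
      triv (a ∷ w) w∈ w≡0 with vanishing K headFunctional ¬nv (a ∷ w) w∈
      ... | refl = λ { zero → refl ; (suc j) → trivial w w∈ (λ j j∉S → w≡0 (suc j) λ { (there j∈S) → j∉S j∈S }) j }

    cutAll : ∀ {m} → Subspace m → List (Fin m) → Subspace m
    cutAll K []       = K
    cutAll K (j ∷ js) = cut (cutAll K js) (coordinate j)

    ∈-cutAll : ∀ {m} (K : Subspace m) js {w} → Member (cutAll K js) w →
      Member K w × (∀ {j} → j ∈ js → lookup w j ≡ 0ₚ)
    ∈-cutAll K []       w∈ = w∈ , λ ()
    ∈-cutAll K (j ∷ js) (w∈ , wj≡0) with ∈-cutAll K js w∈
    ... | w∈K , rest = w∈K , λ { (here refl) → wj≡0 ; (there i∈) → rest i∈ }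

    dim≤length+dim-cutAll : ∀ {m} (K : Subspace m) js → dim K ℕ.≤ length js ℕ.+ dim (cutAll K js)
    dim≤length+dim-cutAll K []       = ℕ.≤-refl
    dim≤length+dim-cutAll K (j ∷ js) = ℕ.≤-trans (dim≤length+dim-cutAll K js) (ℕ.≤-trans
      (ℕ.+-monoʳ-≤ (length js) (dim≤1+dim-cut (cutAll K js) (coordinate j)))
      (ℕ.≤-reflexive (ℕ.+-suc (length js) _)))

    dim-trivial : ∀ {m} (K : Subspace m) → (∀ w → Member K w → w ≡ 0ᵥ) → dim K ≡ 0
    dim-trivial K trivial = ιp^-injective (dim K) 0 (trans (sym (size≡p^dim K)) (trans
      (∫-countingVec-single (λ w → 𝟙 (member? K w)) 0ᵥ (λ w w≢0 → 𝟙-no (member? K w) (w≢0 ∘ trivial w)))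
      (𝟙-yes (member? K 0ᵥ) (0∈ K))))

    -- Forcing the coordinates outside `S` to vanish imposes `m - card S` conditions. Each lowers
    -- the dimension by at most one, and together they leave only the zero vector.
    card+dim≤ : ∀ {m} (K : Subspace m) S → TrivialOn K S → card S ℕ.+ dim K ℕ.≤ m
    card+dim≤ {m} K S trivial = begin
      card S ℕ.+ dim K                                           ≤⟨ ℕ.+-monoʳ-≤ (card S) (dim≤length+dim-cutAll K js) ⟩
      card S ℕ.+ (length js ℕ.+ dim (cutAll K js))               ≡⟨ cong (λ d → card S ℕ.+ (length js ℕ.+ d)) (dim-trivial (cutAll K js) triv) ⟩
      card S ℕ.+ (length js ℕ.+ 0)                               ≡⟨ cong (card S ℕ.+_) (ℕ.+-identityʳ (length js)) ⟩
      card S ℕ.+ length js                                       ≡⟨ length-outsides S ⟩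
      m                                                          ∎
      where
      open ℕ.≤-Reasoning
      js = outsides S
      triv : ∀ w → Member (cutAll K js) w → w ≡ 0ᵥ
      triv w w∈ with ∈-cutAll K js w∈
      ... | w∈K , vanish = lookup≡0⇒≡0ᵥ w (trivial w w∈K (λ j j∉S → vanish (∉⇒∈-outsides S j∉S)))

    ∈-kernel⁺ : ∀ {m c} (A : Matrix p c m) w → (∀ i → w ∙ lookup A i ≡ 0ₚ) → Member (kernel A) w
    ∈-kernel⁺ []      w w⊥A = tt
    ∈-kernel⁺ (r ∷ A) w w⊥A = ∈-kernel⁺ A w (w⊥A ∘ suc) , w⊥A zero

    ∈-kernel⁻ : ∀ {m c} (A : Matrix p c m) w → Member (kernel A) w → ∀ i → w ∙ lookup A i ≡ 0ₚ
    ∈-kernel⁻ (r ∷ A) w (w∈ , w⊥r) zero    = w⊥r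
    ∈-kernel⁻ (r ∷ A) w (w∈ , w⊥r) (suc i) = ∈-kernel⁻ A w w∈ i

    -- The maximum in `rank` is attained at the set given by `complement`, and `card+dim≤` keeps
    -- every independent set of columns from being larger.
    rank+nullity : ∀ {m c} (A : Matrix p c m) → rank A ℕ.+ nullity A ≡ m
    rank+nullity {m} {c} A with complement (kernel A)
    ... | S , trivial , eq = trans (cong (ℕ._+ nullity A) rank≡) eq
      where
      independent? = independentColumns? A
      cards : List ℕ
      cards = List.map card (filter independent? (subsets m))
      all∈ : ∀ x → x ∈ (inside ∷ outside ∷ [])
      all∈ inside  = here refl
      all∈ outside = there (here refl)
      S∈ : card S ∈ cards
      S∈ = ∈-map⁺ card (∈-filter⁺ independent? (∈-vectors all∈ S)
        (λ w w≡0 w⊥A → trivial w (∈-kernel⁺ A w w⊥A) w≡0))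
      bounded′ : ∀ {k} → k ∈ cards → k ℕ.≤ card S
      bounded′ k∈ with ∈-map⁻ card k∈
      ... | T , T∈ , refl with ∈-filter⁻ independent? {xs = subsets m} T∈
      ... | _ , independent′ = ℕ.+-cancelʳ-≤ (nullity A) (card T) (card S) (ℕ.≤-trans
        (card+dim≤ (kernel A) T (λ w w∈ w≡0 → independent′ w w≡0 (∈-kernel⁻ A w w∈)))
        (ℕ.≤-reflexive (sym eq)))
      rank≡ : rank A ≡ card S
      rank≡ = max≈v⁺ S∈ (All.tabulate bounded′) ℕ.z≤n

    -- Exposing the rows of a random matrix

    ℙ[stay] : ∀ {ε m} → (Fin m → BalancedLaw ε) → Subspace m → ℚ
    ℙ[stay] μ K = ∫ (row μ) (λ x → 𝟙 (¬? (nonVanishing? K (dot x))))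

    -- Odlyzko's lemma. If some member has nonzero head `a`, then orthogonality to it determines the
    -- head entry of the row from the tail, which costs a factor `1 - ε`, while the tail must still
    -- be orthogonal to `tailSubspace K`. The factors are thus collected once per pivot.
    ℙ[stay]≤ : ∀ {ε} → ε ≤ 1ℚ → ∀ {m} (μ : Fin m → BalancedLaw ε) (K : Subspace m) →
      ℙ[stay] μ K ≤ (1ℚ - ε) ^ dim K
    ℙ[stay]≤ ε≤1 {zero}  μ K = 𝟙≤1 (¬? (nonVanishing? K (dot [])))
    ℙ[stay]≤ {ε} ε≤1 {suc m} μ K with nonVanishing? K headFunctional
    ... | yes (a ∷ v , v∈ , a≢0) = begin
      ∫ T (λ x → ∫ H (λ t → 𝟙 (¬? (nonVanishing? K (dot (t ∷ x))))))
        ≤⟨ ∫-mono T (λ x → ∫-mono H (λ t → factor x t)) ⟩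
      ∫ T (λ x → ∫ H (λ t → 𝟙 (a *ₚ t +ₚ v ∙ x Fin.≟ 0ₚ) * tail-stays x))
        ≡⟨ ∫-cong T (λ x → ∫-*ʳ H (tail-stays x) (λ t → 𝟙 (a *ₚ t +ₚ v ∙ x Fin.≟ 0ₚ))) ⟩
      ∫ T (λ x → ∫ H (λ t → 𝟙 (a *ₚ t +ₚ v ∙ x Fin.≟ 0ₚ)) * tail-stays x)
        ≤⟨ ∫-mono T (λ x → *-monoʳ-≤ (0≤𝟙 (¬? (nonVanishing? K′ (dot x)))) (anticoncentration (μ zero) a≢0 (v ∙ x) 0ₚ)) ⟩
      ∫ T (λ x → (1ℚ - ε) * tail-stays x)
        ≡⟨ ∫-* T (1ℚ - ε) tail-stays ⟩
      (1ℚ - ε) * ∫ T tail-stays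
        ≤⟨ *-monoˡ-≤ (p≤q⇒0≤q-p ε≤1) (ℙ[stay]≤ ε≤1 (μ ∘ suc) K′) ⟩
      (1ℚ - ε) * (1ℚ - ε) ^ dim K′ ∎
      where
      open ℚ.≤-Reasoning
      H = integral (μ zero)
      T = row (μ ∘ suc)
      K′ = tailSubspace K
      tail-stays : Vec (Fin p) m → ℚ
      tail-stays x = 𝟙 (¬? (nonVanishing? K′ (dot x)))
      factor : ∀ x t → 𝟙 (¬? (nonVanishing? K (dot (t ∷ x)))) ≤ 𝟙 (a *ₚ t +ₚ v ∙ x Fin.≟ 0ₚ) * tail-stays x
      factor x t = subst (𝟙 (¬? (nonVanishing? K (dot (t ∷ x)))) ≤_)
        (𝟙-× (a *ₚ t +ₚ v ∙ x Fin.≟ 0ₚ) (¬? (nonVanishing? K′ (dot x))))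
        (𝟙-mono (¬? (nonVanishing? K (dot (t ∷ x)))) ((a *ₚ t +ₚ v ∙ x Fin.≟ 0ₚ) ×-dec ¬? (nonVanishing? K′ (dot x)))
          (λ none → vanishing K (dot (t ∷ x)) none (a ∷ v) v∈ , none ∘ extend x t))
        where
        extend : ∀ x t → NonVanishing K′ (dot x) → NonVanishing K (dot (t ∷ x))
        extend x t (w , w∈ , w∙x≢0) = 0ₚ ∷ w , w∈ , λ eq → w∙x≢0
          (trans (sym (trans (cong (_+ₚ w ∙ x) (*ₚ-zeroˡ t)) (+ₚ-identityˡ (w ∙ x)))) eq)
    ... | no _ = begin
      ∫ T (λ x → ∫ H (λ t → 𝟙 (¬? (nonVanishing? K (dot (t ∷ x))))))
        ≤⟨ ∫-mono T (λ x → ∫-mono H (λ t → 𝟙-mono (¬? (nonVanishing? K (dot (t ∷ x)))) (¬? (nonVanishing? K′ (dot x)))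
             (λ none (w , w∈ , w∙x≢0) → none (0ₚ ∷ w , w∈ , λ eq → w∙x≢0
               (trans (sym (trans (cong (_+ₚ w ∙ x) (*ₚ-zeroˡ t)) (+ₚ-identityˡ (w ∙ x)))) eq))))) ⟩
      ∫ T (λ x → ∫ H (λ _ → 𝟙 (¬? (nonVanishing? K′ (dot x)))))
        ≡⟨ ∫-cong T (λ x → ∫-const H (isProbability (μ zero)) (𝟙 (¬? (nonVanishing? K′ (dot x))))) ⟩
      ∫ T (λ x → 𝟙 (¬? (nonVanishing? K′ (dot x))))
        ≤⟨ ℙ[stay]≤ ε≤1 (μ ∘ suc) K′ ⟩
      (1ℚ - ε) ^ dim K′ ∎
      where
      open ℚ.≤-Reasoning
      H = integral (μ zero)
      T = row (μ ∘ suc)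
      K′ = tailSubspace K

    -- Stay probabilities and light vectors

    infix 4 _≟ᵥ_
    _≟ᵥ_ : ∀ {m} (w v : Vec (Fin p) m) → Dec (w ≡ v)
    _≟ᵥ_ = ≡-dec Fin._≟_

    nonzero : ∀ {m} → Vec (Fin p) m → ℚ
    nonzero w = 𝟙 (¬? (w ≟ᵥ 0ᵥ))

    0≤nonzero : ∀ {m} (w : Vec (Fin p) m) → 0ℚ ≤ nonzero w
    0≤nonzero w = 0≤𝟙 (¬? (w ≟ᵥ 0ᵥ))

    -- A count of the nonzero members in which vectors of small support dominate, those being the
    -- ones whose product with a balanced row may be far from uniform.
    lightness : ∀ {m} → ℚ → Subspace m → ℚ
    lightness {m} r K = ∫ (countingVec p m) (λ w → 𝟙 (member? K w) * nonzero w * r ^ weight w)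

    0≤lightness : ∀ {m r} → 0ℚ ≤ r → (K : Subspace m) → 0ℚ ≤ lightness r K
    0≤lightness {m} 0≤r K = ∫-nonneg (countingVec p m)
      (λ w → 0≤p*q (0≤p*q (0≤𝟙 (member? K w)) (0≤nonzero w)) (0≤^ (weight w) 0≤r))

    -- This replaces the Fourier expansion of the indicator that x is orthogonal to K: the
    -- characters of w ∙ x are summed over the nonzero multiples of w, which keeps them rational.
    ∑[p𝟙-1] : ∀ {m} (K : Subspace m) x →
      ∫ (countingVec p m) (λ w → 𝟙 (member? K w) * (ι p * 𝟙 (w ∙ x Fin.≟ 0ₚ) - 1ℚ))
        ≡ (ι p - 1ℚ) * size K * 𝟙 (¬? (nonVanishing? K (dot x)))
    ∑[p𝟙-1] {m} K x = begin
      ∫ V (λ w → 𝟙 (member? K w) * (ι p * 𝟙 (w ∙ x Fin.≟ 0ₚ) - 1ℚ))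
        ≡⟨ ∫-cong V (λ w → trans
             (solve 3 (λ k q z → k :* (q :* z :- con 1ℚ) := q :* (k :* z) :- k) refl (𝟙 (member? K w)) (ι p) (𝟙 (w ∙ x Fin.≟ 0ₚ)))
             (cong (λ t → ι p * t - 𝟙 (member? K w)) (sym (𝟙-× (member? K w) (w ∙ x Fin.≟ 0ₚ))))) ⟩
      ∫ V (λ w → ι p * 𝟙 (member? (cut K (dot x)) w) - 𝟙 (member? K w))
        ≡⟨ trans (∫-sub V (λ w → ι p * 𝟙 (member? (cut K (dot x)) w)) (λ w → 𝟙 (member? K w)))
             (cong (_- size K) (∫-* V (ι p) (λ w → 𝟙 (member? (cut K (dot x)) w)))) ⟩
      ι p * size (cut K (dot x)) - size K
        ≡⟨ cases (nonVanishing? K (dot x)) ⟩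
      (ι p - 1ℚ) * size K * 𝟙 (¬? (nonVanishing? K (dot x))) ∎
      where
      open ≡-Reasoning
      V = countingVec p m
      cases : (nv? : Dec (NonVanishing K (dot x))) →
        ι p * size (cut K (dot x)) - size K ≡ (ι p - 1ℚ) * size K * 𝟙 (¬? nv?)
      cases (yes nv) = trans (cong (_- size K) (sym (size-cut K (dot x) nv)))
        (solve 2 (λ q k → k :- k := (q :- con 1ℚ) :* k :* con 0ℚ) refl (ι p) (size K))
      cases (no ¬nv) = trans
        (cong (λ t → ι p * t - size K) (size-cong (cut K (dot x)) K (λ _ → proj₁)
          (λ w w∈ → w∈ , vanishing K (dot x) ¬nv w w∈)))
        (solve 2 (λ q k → q :* k :- k := (q :- con 1ℚ) :* k :* con 1ℚ) refl (ι p) (size K))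

    -- Average `∑[p𝟙-1]` over the row. The zero vector contributes exactly `p - 1`, which accounts
    -- for the main term `1 / size K`; the other members contribute p times their bias, and `R` is
    -- their total.
    ℙ[stay]-deviation : ∀ {ε m} (μ : Fin m → BalancedLaw ε) (K : Subspace m) {η C r} → 0ℚ ≤ η → 0ℚ ≤ C → 0ℚ ≤ r →
      (∀ w → ∣ bias μ w 0ₚ ∣ ≤ η + C * r ^ weight w) →
      ∣ ℙ[stay] μ K - p ^- 1 ^ dim K ∣ ≤ ι 2 * (η + C * lightness r K)
    ℙ[stay]-deviation {m = m} μ K {η} {C} {r} 0≤η 0≤C 0≤r bias≤ = *-cancelˡ-≤ (ι p - 1ℚ) (p<q⇒0<q-p 1<ιp) (begin
      (ι p - 1ℚ) * ∣ s - Z ∣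
        ≡⟨ cong (_* ∣ s - Z ∣) (ℚ.0≤p⇒∣p∣≡p 0≤p-1) ⟨
      ∣ ι p - 1ℚ ∣ * ∣ s - Z ∣
        ≡⟨ ℚ.∣p*q∣≡∣p∣*∣q∣ (ι p - 1ℚ) (s - Z) ⟨
      ∣ (ι p - 1ℚ) * (s - Z) ∣
        ≡⟨ cong ∣_∣ rescale ⟩
      ∣ Z * R ∣
        ≡⟨ trans (ℚ.∣p*q∣≡∣p∣*∣q∣ Z R) (cong (_* ∣ R ∣) (ℚ.0≤p⇒∣p∣≡p 0≤Z)) ⟩
      Z * ∣ R ∣
        ≤⟨ *-monoˡ-≤ 0≤Z R≤ ⟩
      Z * (ι p * (η * size K + C * L))
        ≡⟨ solve 6 (λ z q e k c l → z :* (q :* (e :* k :+ c :* l)) := q :* (e :* (k :* z) :+ z :* (c :* l))) refl Z (ι p) η (size K) C L ⟩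
      ι p * (η * (size K * Z) + Z * (C * L))
        ≡⟨ cong (λ t → ι p * (η * t + Z * (C * L))) size*Z≡1 ⟩
      ι p * (η * 1ℚ + Z * (C * L))
        -- `Z` is the inverse of the size of K. It has cancelled the number of terms carrying η; on
        -- the light part it is merely bounded by 1.
        ≤⟨ *-monoˡ-≤ (0≤ι p) (ℚ.+-mono-≤ (ℚ.≤-reflexive (ℚ.*-identityʳ η))
             (ℚ.≤-trans (ℚ.≤-reflexive (ℚ.*-comm Z (C * L))) (p*q≤p 0≤CL Z≤1))) ⟩
      ι p * (η + C * L)
        -- The factor 2 of the claim comes from `p ≤ 2 (p - 1)`.
        ≤⟨ p+r≡q⇒p≤q ((ι p - ι 2) * (η + C * L))
             (solve 2 (λ q e → q :* e :+ (q :- con (ι 2)) :* e := (q :- con 1ℚ) :* (con (ι 2) :* e)) refl (ι p) (η + C * L))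
             (0≤p*q (p≤q⇒0≤q-p (ι-mono {2} 1<p)) (0≤p+q 0≤η 0≤CL)) ⟩
      (ι p - 1ℚ) * (ι 2 * (η + C * L)) ∎)
      where
      open ℚ.≤-Reasoning
      V = countingVec p m
      s = ℙ[stay] μ K
      y = p ^- 1
      Z = y ^ dim K
      L = lightness r K
      b : Vec (Fin p) m → ℚ
      b w = bias μ w 0ₚ
      R = ∫ V (λ w → 𝟙 (member? K w) * nonzero w * (ι p * b w))
      0≤p-1 : 0ℚ ≤ ι p - 1ℚ
      0≤p-1 = ℚ.<⇒≤ (p<q⇒0<q-p 1<ιp)
      0≤y : 0ℚ ≤ y
      0≤y = ℚ.nonNegative⁻¹ y {{ℚ.normalize-nonNeg 1 (p ℕ.^ 1) {{ℕ.m^n≢0 p 1}}}}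
      y≤1 : y ≤ 1ℚ
      y≤1 = begin
        y            ≡⟨ ℚ.*-identityˡ y ⟨
        1ℚ * y       ≤⟨ *-monoʳ-≤ 0≤y (ℚ.<⇒≤ 1<ιp) ⟩
        ι p * y      ≡⟨ p*p^-1≡1 ⟩
        1ℚ           ∎
      0≤Z : 0ℚ ≤ Z
      0≤Z = 0≤^ (dim K) 0≤y
      Z≤1 : Z ≤ 1ℚ
      Z≤1 = ^≤1 (dim K) 0≤y y≤1
      0≤CL : 0ℚ ≤ C * L
      0≤CL = 0≤p*q 0≤C (0≤lightness 0≤r K)
      size*Z≡1 : size K * Z ≡ 1ℚ
      size*Z≡1 = trans (cong (_* Z) (size≡p^dim K)) (a^n*b^n≡1 (dim K) p*p^-1≡1)
      bias-0ᵥ : b 0ᵥ ≡ 1ℚ - y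
      bias-0ᵥ = cong (_- y) (trans (∫-cong (row μ) (λ x → 𝟙-yes (0ᵥ ∙ x Fin.≟ 0ₚ) (0ᵥ∙x≡0 x))) (row-isProbability μ))
      at-zero : ∫ V (λ w → 𝟙 (w ≟ᵥ 0ᵥ) * (𝟙 (member? K w) * (ι p * b w))) ≡ ι p - 1ℚ
      at-zero = begin-equality
        ∫ V (λ w → 𝟙 (w ≟ᵥ 0ᵥ) * (𝟙 (member? K w) * (ι p * b w)))
          ≡⟨ ∫-countingVec-single (λ w → 𝟙 (w ≟ᵥ 0ᵥ) * (𝟙 (member? K w) * (ι p * b w))) 0ᵥ
               (λ w w≢0 → trans (cong (_* (𝟙 (member? K w) * (ι p * b w))) (𝟙-no (w ≟ᵥ 0ᵥ) w≢0)) (ℚ.*-zeroˡ (𝟙 (member? K w) * (ι p * b w)))) ⟩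
        𝟙 (0ᵥ {m = m} ≟ᵥ 0ᵥ) * (𝟙 (member? K 0ᵥ) * (ι p * b 0ᵥ))
          ≡⟨ cong₂ _*_ (𝟙-yes (0ᵥ {m = m} ≟ᵥ 0ᵥ) refl) (cong₂ _*_ (𝟙-yes (member? K 0ᵥ) (0∈ K)) (cong (ι p *_) bias-0ᵥ)) ⟩
        1ℚ * (1ℚ * (ι p * (1ℚ - y)))
          ≡⟨ solve 2 (λ q y → con 1ℚ :* (con 1ℚ :* (q :* (con 1ℚ :- y))) := q :- q :* y) refl (ι p) y ⟩
        ι p - ι p * y
          ≡⟨ cong (λ t → ι p - t) p*p^-1≡1 ⟩
        ι p - 1ℚ ∎
      first-moment : (ι p - 1ℚ) * size K * s ≡ ι p - 1ℚ + R
      first-moment = begin-equality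
        (ι p - 1ℚ) * size K * s
          ≡⟨ ∫-* (row μ) ((ι p - 1ℚ) * size K) (λ x → 𝟙 (¬? (nonVanishing? K (dot x)))) ⟨
        ∫ (row μ) (λ x → (ι p - 1ℚ) * size K * 𝟙 (¬? (nonVanishing? K (dot x))))
          ≡⟨ ∫-cong (row μ) (λ x → ∑[p𝟙-1] K x) ⟨
        ∫ (row μ) (λ x → ∫ V (λ w → 𝟙 (member? K w) * (ι p * 𝟙 (w ∙ x Fin.≟ 0ₚ) - 1ℚ)))
          ≡⟨ ∫-countingVec (row μ) p m (λ x w → 𝟙 (member? K w) * (ι p * 𝟙 (w ∙ x Fin.≟ 0ₚ) - 1ℚ)) ⟩
        ∫ V (λ w → ∫ (row μ) (λ x → 𝟙 (member? K w) * (ι p * 𝟙 (w ∙ x Fin.≟ 0ₚ) - 1ℚ)))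
          ≡⟨ ∫-cong V integrate ⟩
        ∫ V (λ w → 𝟙 (w ≟ᵥ 0ᵥ) * (𝟙 (member? K w) * (ι p * b w)) + 𝟙 (member? K w) * nonzero w * (ι p * b w))
          ≡⟨ ∫-+ V (λ w → 𝟙 (w ≟ᵥ 0ᵥ) * (𝟙 (member? K w) * (ι p * b w))) (λ w → 𝟙 (member? K w) * nonzero w * (ι p * b w)) ⟩
        ∫ V (λ w → 𝟙 (w ≟ᵥ 0ᵥ) * (𝟙 (member? K w) * (ι p * b w))) + R
          ≡⟨ cong (_+ R) at-zero ⟩
        ι p - 1ℚ + R ∎
        where
        split : ∀ {P : Set} (P? : Dec P) c → c ≡ 𝟙 P? * c + 𝟙 (¬? P?) * c
        split (yes _) c = solve 1 (λ c → c := con 1ℚ :* c :+ con 0ℚ :* c) refl c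
        split (no _)  c = solve 1 (λ c → c := con 0ℚ :* c :+ con 1ℚ :* c) refl c
        integrate : ∀ w → ∫ (row μ) (λ x → 𝟙 (member? K w) * (ι p * 𝟙 (w ∙ x Fin.≟ 0ₚ) - 1ℚ)) ≡
          𝟙 (w ≟ᵥ 0ᵥ) * (𝟙 (member? K w) * (ι p * b w)) + 𝟙 (member? K w) * nonzero w * (ι p * b w)
        integrate w = begin-equality
          ∫ (row μ) (λ x → k * (ι p * 𝟙 (w ∙ x Fin.≟ 0ₚ) - 1ℚ))
            ≡⟨ ∫-* (row μ) k (λ x → ι p * 𝟙 (w ∙ x Fin.≟ 0ₚ) - 1ℚ) ⟩
          k * ∫ (row μ) (λ x → ι p * 𝟙 (w ∙ x Fin.≟ 0ₚ) - 1ℚ)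
            ≡⟨ cong (k *_) (trans (∫-sub (row μ) (λ x → ι p * 𝟙 (w ∙ x Fin.≟ 0ₚ)) (λ _ → 1ℚ))
                 (cong₂ _-_ (∫-* (row μ) (ι p) (λ x → 𝟙 (w ∙ x Fin.≟ 0ₚ))) (trans (row-isProbability μ) (sym p*p^-1≡1)))) ⟩
          k * (ι p * ℙ[ w ∙≡ 0ₚ ] μ - ι p * y)
            ≡⟨ cong (k *_) (solve 3 (λ q a y → q :* a :- q :* y := q :* (a :- y)) refl (ι p) (ℙ[ w ∙≡ 0ₚ ] μ) y) ⟩
          k * (ι p * b w)
            ≡⟨ split (w ≟ᵥ 0ᵥ) (k * (ι p * b w)) ⟩
          𝟙 (w ≟ᵥ 0ᵥ) * (k * (ι p * b w)) + nonzero w * (k * (ι p * b w))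
            ≡⟨ cong (𝟙 (w ≟ᵥ 0ᵥ) * (k * (ι p * b w)) +_)
                 (solve 3 (λ n k c → n :* (k :* c) := k :* n :* c) refl (nonzero w) k (ι p * b w)) ⟩
          𝟙 (w ≟ᵥ 0ᵥ) * (k * (ι p * b w)) + k * nonzero w * (ι p * b w) ∎
          where k = 𝟙 (member? K w)
      rescale : (ι p - 1ℚ) * (s - Z) ≡ Z * R
      rescale = begin-equality
        (ι p - 1ℚ) * (s - Z)
          ≡⟨ cong (λ t → (ι p - 1ℚ) * (t - Z)) (ℚ.*-identityˡ s) ⟨
        (ι p - 1ℚ) * (1ℚ * s - Z)
          ≡⟨ cong (λ t → (ι p - 1ℚ) * (t * s - Z)) size*Z≡1 ⟨
        (ι p - 1ℚ) * (size K * Z * s - Z)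
          ≡⟨ solve 4 (λ q k z s → q :* (k :* z :* s :- z) := z :* (q :* k :* s :- q)) refl (ι p - 1ℚ) (size K) Z s ⟩
        Z * ((ι p - 1ℚ) * size K * s - (ι p - 1ℚ))
          ≡⟨ cong (λ t → Z * (t - (ι p - 1ℚ))) first-moment ⟩
        Z * (ι p - 1ℚ + R - (ι p - 1ℚ))
          ≡⟨ solve 3 (λ z q r → z :* (q :+ r :- q) := z :* r) refl Z (ι p - 1ℚ) R ⟩
        Z * R ∎
      R≤ : ∣ R ∣ ≤ ι p * (η * size K + C * L)
      R≤ = begin
        ∣ R ∣
          ≤⟨ ∣∫∣≤ V (λ w → 𝟙 (member? K w) * nonzero w * (ι p * b w)) ⟩
        ∫ V (λ w → ∣ 𝟙 (member? K w) * nonzero w * (ι p * b w) ∣)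
          ≤⟨ ∫-mono V termwise ⟩
        ∫ V (λ w → ι p * η * 𝟙 (member? K w) + ι p * C * (𝟙 (member? K w) * nonzero w * r ^ weight w))
          ≡⟨ trans (∫-+ V (λ w → ι p * η * 𝟙 (member? K w)) (λ w → ι p * C * (𝟙 (member? K w) * nonzero w * r ^ weight w)))
               (cong₂ _+_ (∫-* V (ι p * η) (λ w → 𝟙 (member? K w))) (∫-* V (ι p * C) (λ w → 𝟙 (member? K w) * nonzero w * r ^ weight w))) ⟩
        ι p * η * size K + ι p * C * L
          ≡⟨ solve 5 (λ q e k c l → q :* e :* k :+ q :* c :* l := q :* (e :* k :+ c :* l)) refl (ι p) η (size K) C L ⟩
        ι p * (η * size K + C * L) ∎
        where
        termwise : ∀ w → ∣ 𝟙 (member? K w) * nonzero w * (ι p * b w) ∣ ≤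
          ι p * η * 𝟙 (member? K w) + ι p * C * (𝟙 (member? K w) * nonzero w * r ^ weight w)
        termwise w = begin
          ∣ k * n * (ι p * b w) ∣
            ≡⟨ trans (ℚ.∣p*q∣≡∣p∣*∣q∣ (k * n) (ι p * b w)) (cong₂ _*_ (ℚ.0≤p⇒∣p∣≡p 0≤kn)
                 (trans (ℚ.∣p*q∣≡∣p∣*∣q∣ (ι p) (b w)) (cong (_* ∣ b w ∣) (ℚ.0≤p⇒∣p∣≡p (0≤ι p))))) ⟩
          k * n * (ι p * ∣ b w ∣)
            ≤⟨ *-monoˡ-≤ 0≤kn (*-monoˡ-≤ (0≤ι p) (bias≤ w)) ⟩
          k * n * (ι p * (η + C * x))
            ≡⟨ solve 6 (λ k n q e c x → k :* n :* (q :* (e :+ c :* x)) := k :* n :* (q :* e) :+ q :* c :* (k :* n :* x)) refl k n (ι p) η C x ⟩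
          k * n * (ι p * η) + ι p * C * (k * n * x)
            ≤⟨ ℚ.+-monoˡ-≤ (ι p * C * (k * n * x)) (*-monoʳ-≤ (0≤p*q (0≤ι p) 0≤η) (p*q≤p (0≤𝟙 (member? K w)) (𝟙≤1 (¬? (w ≟ᵥ 0ᵥ))))) ⟩
          k * (ι p * η) + ι p * C * (k * n * x)
            ≡⟨ cong (_+ ι p * C * (k * n * x)) (ℚ.*-comm k (ι p * η)) ⟩
          ι p * η * k + ι p * C * (k * n * x) ∎
          where
          k = 𝟙 (member? K w)
          n = nonzero w
          x = r ^ weight w
          0≤kn : 0ℚ ≤ k * n
          0≤kn = 0≤p*q (0≤𝟙 (member? K w)) (0≤nonzero w)

    -- Replacing balanced rows by uniform ones

    0<p^-1 : 0ℚ < p ^- 1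
    0<p^-1 = ℚ.positive⁻¹ (p ^- 1) {{ℚ.normalize-pos 1 (p ℕ.^ 1) {{ℕ.m^n≢0 p 1}}}}

    0≤p^-1 : 0ℚ ≤ p ^- 1
    0≤p^-1 = ℚ.<⇒≤ 0<p^-1

    p^-1≤½ : p ^- 1 ≤ ½
    p^-1≤½ = *-cancelˡ-≤ (ι 2) (0<ι 2) (begin
      ι 2 * p ^- 1    ≤⟨ *-monoʳ-≤ 0≤p^-1 (ι-mono {2} 1<p) ⟩
      ι p * p ^- 1    ≡⟨ p*p^-1≡1 ⟩
      ι 2 * ½         ∎)
      where open ℚ.≤-Reasoning

    p^-1≤1 : p ^- 1 ≤ 1ℚ
    p^-1≤1 = ℚ.≤-trans p^-1≤½ (p+r≡q⇒p≤q ½ refl (ℚ.nonNegative⁻¹ ½))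

    -- The probability that j uniformly random rows cut a subspace of dimension d down
    -- to dimension κ.
    uniform : ℕ → ℕ → ℕ → ℚ
    uniform κ zero    d = 𝟙 (d ℕ.≟ κ)
    uniform κ (suc j) d = p ^- 1 ^ d * uniform κ j d + (1ℚ - p ^- 1 ^ d) * uniform κ j (ℕ.pred d)

    0≤1-p^-1^ : ∀ d → 0ℚ ≤ 1ℚ - p ^- 1 ^ d
    0≤1-p^-1^ d = p≤q⇒0≤q-p (^≤1 d 0≤p^-1 p^-1≤1)

    0≤uniform : ∀ κ j d → 0ℚ ≤ uniform κ j d
    0≤uniform κ zero    d = 0≤𝟙 (d ℕ.≟ κ)
    0≤uniform κ (suc j) d = 0≤p+q (0≤p*q (0≤^ d 0≤p^-1) (0≤uniform κ j d))
      (0≤p*q (0≤1-p^-1^ d) (0≤uniform κ j (ℕ.pred d)))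

    uniform≤1 : ∀ κ j d → uniform κ j d ≤ 1ℚ
    uniform≤1 κ zero    d = 𝟙≤1 (d ℕ.≟ κ)
    uniform≤1 κ (suc j) d = begin
      z * uniform κ j d + (1ℚ - z) * uniform κ j (ℕ.pred d)
        ≤⟨ ℚ.+-mono-≤ (p*q≤p (0≤^ d 0≤p^-1) (uniform≤1 κ j d)) (p*q≤p (0≤1-p^-1^ d) (uniform≤1 κ j (ℕ.pred d))) ⟩
      z + (1ℚ - z)
        ≡⟨ solve 1 (λ z → z :+ (con 1ℚ :- z) := con 1ℚ) refl z ⟩
      1ℚ ∎
      where
      open ℚ.≤-Reasoning
      z = p ^- 1 ^ d

    matrixLaw : ∀ {ε m c} → (Fin c → Fin m → BalancedLaw ε) → Integral (Matrix p c m)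
    matrixLaw μ = iterated (λ i → row (μ i))

    matrixLaw-isProbability : ∀ {ε m c} (μ : Fin c → Fin m → BalancedLaw ε) → IsProbability (matrixLaw μ)
    matrixLaw-isProbability μ = iterated-isProbability _ (λ i → row-isProbability (μ i))

    -- A balanced and a uniform row produce mixtures of the same two values, one for staying and one
    -- for descending. The values lie in the unit interval, so the error is at most the difference
    -- of the two staying probabilities.
    expose-row : ∀ {ε m} (μ : Fin m → BalancedLaw ε) (K : Subspace m) κ j →
      ∣ ∫ (row μ) (λ x → uniform κ j (dim (cut K (dot x)))) - uniform κ (suc j) (dim K) ∣
        ≤ ∣ ℙ[stay] μ K - p ^- 1 ^ dim K ∣
    expose-row μ K κ j = begin
      ∣ ∫ (row μ) (λ x → uniform κ j (dim (cut K (dot x)))) - (z * a + (1ℚ - z) * b) ∣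
        ≡⟨ cong (λ t → ∣ t - (z * a + (1ℚ - z) * b) ∣) mean ⟩
      ∣ (b + (a - b) * s) - (z * a + (1ℚ - z) * b) ∣
        ≡⟨ cong ∣_∣ (solve 4 (λ a b s z → (b :+ (a :- b) :* s) :- (z :* a :+ (con 1ℚ :- z) :* b) := (s :- z) :* (a :- b)) refl a b s z) ⟩
      ∣ (s - z) * (a - b) ∣
        ≡⟨ ℚ.∣p*q∣≡∣p∣*∣q∣ (s - z) (a - b) ⟩
      ∣ s - z ∣ * ∣ a - b ∣
        ≤⟨ p*q≤p (ℚ.0≤∣p∣ (s - z)) (∣p-q∣≤⊔ (0≤uniform κ j (dim K)) (0≤uniform κ j (ℕ.pred (dim K)))
             (uniform≤1 κ j (dim K)) (uniform≤1 κ j (ℕ.pred (dim K)))) ⟩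
      ∣ s - z ∣ ∎
      where
      open ℚ.≤-Reasoning
      s = ℙ[stay] μ K
      z = p ^- 1 ^ dim K
      a = uniform κ j (dim K)
      b = uniform κ j (ℕ.pred (dim K))
      next : ∀ x (nv? : Dec (NonVanishing K (dot x))) → uniform κ j (dim (cut K (dot x))) ≡ b + (a - b) * 𝟙 (¬? nv?)
      next x (yes nv) = trans (cong (λ d → uniform κ j (ℕ.pred d)) (sym (dim-cut-nonVanishing K (dot x) nv)))
        (solve 2 (λ a b → b := b :+ (a :- b) :* con 0ℚ) refl a b)
      next x (no ¬nv) = trans (cong (uniform κ j) (dim-cut-vanishing K (dot x) ¬nv))
        (solve 2 (λ a b → a := b :+ (a :- b) :* con 1ℚ) refl a b)
      mean : ∫ (row μ) (λ x → uniform κ j (dim (cut K (dot x)))) ≡ b + (a - b) * s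
      mean = begin-equality
        ∫ (row μ) (λ x → uniform κ j (dim (cut K (dot x))))
          ≡⟨ ∫-cong (row μ) (λ x → next x (nonVanishing? K (dot x))) ⟩
        ∫ (row μ) (λ x → b + (a - b) * 𝟙 (¬? (nonVanishing? K (dot x))))
          ≡⟨ ∫-+ (row μ) (λ _ → b) (λ x → (a - b) * 𝟙 (¬? (nonVanishing? K (dot x)))) ⟩
        ∫ (row μ) (λ _ → b) + ∫ (row μ) (λ x → (a - b) * 𝟙 (¬? (nonVanishing? K (dot x))))
          ≡⟨ cong₂ _+_ (∫-const (row μ) (row-isProbability μ) b) (∫-* (row μ) (a - b) (λ x → 𝟙 (¬? (nonVanishing? K (dot x))))) ⟩
        b + (a - b) * s ∎

    deviation : ∀ {ε m c} → (Fin (suc c) → Fin m → BalancedLaw ε) → ℚ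
    deviation μ = ∫ (matrixLaw (μ ∘ suc)) (λ A → ∣ ℙ[stay] (μ zero) (kernel A) - p ^- 1 ^ nullity A ∣)

    -- A hybrid experiment: the rows of `μ` are exposed, then `j` uniform rows. With `j = 0` it is
    -- the probability of nullity κ; with no rows in `μ` it is `uniform κ j m`.
    𝔼[uniform] : ∀ {ε m c} → (Fin c → Fin m → BalancedLaw ε) → ℕ → ℕ → ℚ
    𝔼[uniform] μ κ j = ∫ (matrixLaw μ) (λ A → uniform κ j (nullity A))

    -- One step of the telescoping between hybrids: the row exposed last is turned into the first of
    -- the pending uniform rows.
    expose-last : ∀ {ε m c} (μ : Fin (suc c) → Fin m → BalancedLaw ε) κ j →
      ∣ 𝔼[uniform] μ κ j - 𝔼[uniform] (μ ∘ suc) κ (suc j) ∣ ≤ deviation μ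
    expose-last μ κ j = begin
      ∣ ∫ T f - ∫ T g ∣              ≡⟨ cong ∣_∣ (∫-sub T f g) ⟨
      ∣ ∫ T (λ A → f A - g A) ∣      ≤⟨ ∣∫∣≤ T (λ A → f A - g A) ⟩
      ∫ T (λ A → ∣ f A - g A ∣)      ≤⟨ ∫-mono T (λ A → expose-row (μ zero) (kernel A) κ j) ⟩
      deviation μ                    ∎
      where
      open ℚ.≤-Reasoning
      T = matrixLaw (μ ∘ suc)
      f g : Matrix p _ _ → ℚ
      f A = ∫ (row (μ zero)) (λ x → uniform κ j (dim (cut (kernel A) (dot x))))
      g A = uniform κ (suc j) (nullity A)

    -- The `c` rows already exposed leave a kernel of dimension at least `e`. Both staying
    -- probabilities are then at most `(1ℚ - ε) ^ e`; for the uniform one this uses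
    -- `p⁻¹ ≤ ½ ≤ 1 - ε`.
    deviation-early : ∀ {ε} → 0ℚ ≤ ε → ε ≤ ½ → ∀ {m c e} → c ℕ.+ e ≡ m → (μ : Fin (suc c) → Fin m → BalancedLaw ε) →
      deviation μ ≤ (1ℚ - ε) ^ e
    deviation-early {ε} 0≤ε ε≤½ {m} {c} {e} c+e≡m μ = begin
      deviation μ                      ≤⟨ ∫-mono T bound ⟩
      ∫ T (λ _ → (1ℚ - ε) ^ e)         ≡⟨ ∫-const T (matrixLaw-isProbability (μ ∘ suc)) ((1ℚ - ε) ^ e) ⟩
      (1ℚ - ε) ^ e                     ∎
      where
      open ℚ.≤-Reasoning
      T = matrixLaw (μ ∘ suc)
      ε≤1 : ε ≤ 1ℚ
      ε≤1 = ℚ.≤-trans ε≤½ (p+r≡q⇒p≤q ½ refl (ℚ.nonNegative⁻¹ ½))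
      0≤1-ε : 0ℚ ≤ 1ℚ - ε
      0≤1-ε = p≤q⇒0≤q-p ε≤1
      1-ε≤1 : 1ℚ - ε ≤ 1ℚ
      1-ε≤1 = p+r≡q⇒p≤q ε (solve 1 (λ e → con 1ℚ :- e :+ e := con 1ℚ) refl ε) 0≤ε
      p^-1≤1-ε : p ^- 1 ≤ 1ℚ - ε
      p^-1≤1-ε = ℚ.≤-trans p^-1≤½ (ℚ.+-monoʳ-≤ 1ℚ (ℚ.neg-antimono-≤ ε≤½))
      bound : ∀ A → ∣ ℙ[stay] (μ zero) (kernel A) - p ^- 1 ^ nullity A ∣ ≤ (1ℚ - ε) ^ e
      bound A = ℚ.≤-trans
        (∣p-q∣≤⊔ (∫-nonneg (row (μ zero)) (λ x → 0≤𝟙 (¬? (nonVanishing? (kernel A) (dot x))))) (0≤^ (nullity A) 0≤p^-1)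
          (ℙ[stay]≤ ε≤1 (μ zero) (kernel A)) (^-monoˡ (nullity A) 0≤p^-1 p^-1≤1-ε))
        (^-anti 0≤1-ε 1-ε≤1 (ℕ.+-cancelˡ-≤ c e (nullity A) (subst (ℕ._≤ c ℕ.+ nullity A) (sym c+e≡m) (m≤c+nullity A))))

    -- Sums the geometric series of the deviations, with the factor `1 / ε` moved to the left. The
    -- step closes because `(1 - ε) (1 + ε) ≤ 1`.
    early-rows : ∀ {ε} → 0ℚ ≤ ε → ε ≤ ½ → ∀ {m} c {e} → c ℕ.+ e ≡ m → (μ : Fin c → Fin m → BalancedLaw ε) → ∀ κ j →
      ε * ∣ 𝔼[uniform] μ κ j - uniform κ (c ℕ.+ j) m ∣ ≤ (1ℚ - ε) ^ e
    early-rows {ε} 0≤ε ε≤½ {m} zero {e} refl μ κ j = begin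
      ε * ∣ uniform κ j (dim (whole {m = m})) - uniform κ j m ∣
        ≡⟨ cong (λ d → ε * ∣ uniform κ j d - uniform κ j m ∣) (dim-whole m) ⟩
      ε * ∣ uniform κ j m - uniform κ j m ∣
        ≡⟨ cong (λ t → ε * ∣ t ∣) (ℚ.+-inverseʳ (uniform κ j m)) ⟩
      ε * 0ℚ
        ≡⟨ ℚ.*-zeroʳ ε ⟩
      0ℚ
        ≤⟨ 0≤^ e (p≤q⇒0≤q-p (ℚ.≤-trans ε≤½ (p+r≡q⇒p≤q ½ refl (ℚ.nonNegative⁻¹ ½)))) ⟩
      (1ℚ - ε) ^ e ∎
      where open ℚ.≤-Reasoning
    early-rows {ε} 0≤ε ε≤½ {m} (suc c) {e} c+e≡m μ κ j = begin
      ε * ∣ 𝔼[uniform] μ κ j - uniform κ (suc c ℕ.+ j) m ∣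
        ≤⟨ *-monoˡ-≤ 0≤ε (∣p-r∣≤ (𝔼[uniform] μ κ j) (𝔼[uniform] (μ ∘ suc) κ (suc j)) (uniform κ (suc c ℕ.+ j) m)
             (ℚ.≤-trans (expose-last μ κ j) (deviation-early 0≤ε ε≤½ c+[1+e]≡m μ)) ℚ.≤-refl) ⟩
      ε * (q ^ suc e + ∣ 𝔼[uniform] (μ ∘ suc) κ (suc j) - uniform κ (suc c ℕ.+ j) m ∣)
        ≡⟨ ℚ.*-distribˡ-+ ε (q ^ suc e) _ ⟩
      ε * q ^ suc e + ε * ∣ 𝔼[uniform] (μ ∘ suc) κ (suc j) - uniform κ (suc c ℕ.+ j) m ∣
        ≡⟨ cong (λ i → ε * q ^ suc e + ε * ∣ 𝔼[uniform] (μ ∘ suc) κ (suc j) - uniform κ i m ∣) (ℕ.+-suc c j) ⟨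
      ε * q ^ suc e + ε * ∣ 𝔼[uniform] (μ ∘ suc) κ (suc j) - uniform κ (c ℕ.+ suc j) m ∣
        ≤⟨ ℚ.+-monoʳ-≤ (ε * q ^ suc e) (early-rows 0≤ε ε≤½ c c+[1+e]≡m (μ ∘ suc) κ (suc j)) ⟩
      ε * (q * q ^ e) + q * q ^ e
        ≤⟨ p+r≡q⇒p≤q (ε * ε * q ^ e)
             (solve 2 (λ e x → e :* ((con 1ℚ :- e) :* x) :+ (con 1ℚ :- e) :* x :+ e :* e :* x := x) refl ε (q ^ e))
             (0≤p*q (0≤p*p ε) (0≤^ e (p≤q⇒0≤q-p (ℚ.≤-trans ε≤½ (p+r≡q⇒p≤q ½ refl (ℚ.nonNegative⁻¹ ½)))))) ⟩
      q ^ e ∎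
      where
      open ℚ.≤-Reasoning
      q = 1ℚ - ε
      c+[1+e]≡m : c ℕ.+ suc e ≡ m
      c+[1+e]≡m = trans (ℕ.+-suc c e) c+e≡m

    -- The expected number of light kernel vectors

    ℙ[∈kernel]≤ : ∀ {ε} → ε ≤ 1ℚ → ∀ {m} c (μ : Fin c → Fin m → BalancedLaw ε) w → w ≢ 0ᵥ →
      ∫ (matrixLaw μ) (λ A → 𝟙 (member? (kernel A) w)) ≤ (1ℚ - ε) ^ c
    ℙ[∈kernel]≤ ε≤1 zero    μ w w≢0 = ℚ.≤-refl
    ℙ[∈kernel]≤ {ε} ε≤1 (suc c) μ w w≢0 = begin
      ∫ T (λ A → ∫ (row (μ zero)) (λ x → 𝟙 (member? (kernel A) w ×-dec (w ∙ x Fin.≟ 0ₚ))))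
        ≡⟨ ∫-cong T (λ A → trans (∫-cong (row (μ zero)) (λ x → 𝟙-× (member? (kernel A) w) (w ∙ x Fin.≟ 0ₚ)))
             (∫-* (row (μ zero)) (𝟙 (member? (kernel A) w)) (λ x → 𝟙 (w ∙ x Fin.≟ 0ₚ)))) ⟩
      ∫ T (λ A → 𝟙 (member? (kernel A) w) * ℙ[ w ∙≡ 0ₚ ] (μ zero))
        ≡⟨ ∫-*ʳ T (ℙ[ w ∙≡ 0ₚ ] (μ zero)) (λ A → 𝟙 (member? (kernel A) w)) ⟩
      ∫ T (λ A → 𝟙 (member? (kernel A) w)) * ℙ[ w ∙≡ 0ₚ ] (μ zero)
        ≤⟨ *-mono-≤ (∫-nonneg (row (μ zero)) (λ x → 0≤𝟙 (w ∙ x Fin.≟ 0ₚ))) (0≤^ c (p≤q⇒0≤q-p ε≤1))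
             (ℙ[∈kernel]≤ ε≤1 c (μ ∘ suc) w w≢0) (ℙ[∙≡0]≤ (μ zero) w w≢0) ⟩
      (1ℚ - ε) ^ c * (1ℚ - ε)
        ≡⟨ ℚ.*-comm ((1ℚ - ε) ^ c) (1ℚ - ε) ⟩
      (1ℚ - ε) ^ suc c ∎
      where
      open ℚ.≤-Reasoning
      T = matrixLaw (μ ∘ suc)

    -- The weight generating function factors over the coordinates, with factor `1 + (p - 1) r`.
    -- Rounding this up to `1 + p r` makes the factor exactly `1 + ε` for the `r` used later.
    ∑r^weight≤ : ∀ {r} → 0ℚ ≤ r → ∀ m → ∫ (countingVec p m) (λ w → r ^ weight w) ≤ (1ℚ + ι p * r) ^ m
    ∑r^weight≤ 0≤r zero = ℚ.≤-refl
    ∑r^weight≤ {r} 0≤r (suc m) = begin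
      ∫ V (λ w → sum (λ a → r ^ weight (a ∷ w)))
        ≤⟨ ∫-mono V (λ w → sum-mono (λ a → term w a)) ⟩
      ∫ V (λ w → sum (λ a → r ^ weight w * (𝟙 (a Fin.≟ 0ₚ) + r)))
        ≡⟨ ∫-cong V (λ w → trans (∫-* (counting p) (r ^ weight w) (λ a → 𝟙 (a Fin.≟ 0ₚ) + r))
             (cong (r ^ weight w *_) (trans (∑-distrib-+ (λ a → 𝟙 (a Fin.≟ 0ₚ)) (λ _ → r))
               (cong₂ _+_ (trans (sum-single (λ a → 𝟙 (a Fin.≟ 0ₚ)) 0ₚ (λ a a≢0 → 𝟙-no (a Fin.≟ 0ₚ) a≢0)) (𝟙-yes (0ₚ Fin.≟ 0ₚ) refl))
                 (sum-const p r))))) ⟩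
      ∫ V (λ w → r ^ weight w * (1ℚ + ι p * r))
        ≡⟨ ∫-*ʳ V (1ℚ + ι p * r) (λ w → r ^ weight w) ⟩
      ∫ V (λ w → r ^ weight w) * (1ℚ + ι p * r)
        ≤⟨ *-monoʳ-≤ (0≤p+q 0≤1 (0≤p*q (0≤ι p) 0≤r)) (∑r^weight≤ 0≤r m) ⟩
      (1ℚ + ι p * r) ^ m * (1ℚ + ι p * r)
        ≡⟨ ℚ.*-comm ((1ℚ + ι p * r) ^ m) (1ℚ + ι p * r) ⟩
      (1ℚ + ι p * r) ^ suc m ∎
      where
      open ℚ.≤-Reasoning
      V = countingVec p m
      term : ∀ w a → r ^ weight (a ∷ w) ≤ r ^ weight w * (𝟙 (a Fin.≟ 0ₚ) + r)
      term w a with a Fin.≟ 0ₚ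
      ... | yes _ = p+r≡q⇒p≤q (r ^ weight w * r)
        (solve 2 (λ x r → x :+ x :* r := x :* (con 1ℚ :+ r)) refl (r ^ weight w) r) (0≤p*q (0≤^ (weight w) 0≤r) 0≤r)
      ... | no _  = ℚ.≤-reflexive (solve 2 (λ x r → r :* x := x :* (con 0ℚ :+ r)) refl (r ^ weight w) r)

    -- A first moment bound: after exchanging sum and expectation, every nonzero `w` is charged the
    -- same probability `(1 - ε) ^ c`, whatever its weight, and only `r ^ weight w` tells vectors
    -- apart.
    𝔼[lightness]≤ : ∀ {ε} → ε ≤ 1ℚ → ∀ {m} c (μ : Fin c → Fin m → BalancedLaw ε) {r} → 0ℚ ≤ r →
      ∫ (matrixLaw μ) (λ A → lightness r (kernel A)) ≤ (1ℚ - ε) ^ c * (1ℚ + ι p * r) ^ m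
    𝔼[lightness]≤ {ε} ε≤1 {m} c μ {r} 0≤r = begin
      ∫ T (λ A → ∫ V (λ w → 𝟙 (member? (kernel A) w) * nonzero w * r ^ weight w))
        ≡⟨ ∫-countingVec T p m (λ A w → 𝟙 (member? (kernel A) w) * nonzero w * r ^ weight w) ⟩
      ∫ V (λ w → ∫ T (λ A → 𝟙 (member? (kernel A) w) * nonzero w * r ^ weight w))
        ≤⟨ ∫-mono V (λ w → term w (w ≟ᵥ 0ᵥ)) ⟩
      ∫ V (λ w → (1ℚ - ε) ^ c * r ^ weight w)
        ≡⟨ ∫-* V ((1ℚ - ε) ^ c) (λ w → r ^ weight w) ⟩
      (1ℚ - ε) ^ c * ∫ V (λ w → r ^ weight w)
        ≤⟨ *-monoˡ-≤ (0≤^ c (p≤q⇒0≤q-p ε≤1)) (∑r^weight≤ 0≤r m) ⟩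
      (1ℚ - ε) ^ c * (1ℚ + ι p * r) ^ m ∎
      where
      open ℚ.≤-Reasoning
      T = matrixLaw μ
      V = countingVec p m
      0≤bound : ∀ w → 0ℚ ≤ (1ℚ - ε) ^ c * r ^ weight w
      0≤bound w = 0≤p*q (0≤^ c (p≤q⇒0≤q-p ε≤1)) (0≤^ (weight w) 0≤r)
      term : ∀ w (w≟0 : Dec (w ≡ 0ᵥ)) → ∫ T (λ A → 𝟙 (member? (kernel A) w) * 𝟙 (¬? w≟0) * r ^ weight w) ≤ (1ℚ - ε) ^ c * r ^ weight w
      term w (yes _) = subst (_≤ (1ℚ - ε) ^ c * r ^ weight w)
        (sym (trans (∫-cong T (λ A → solve 2 (λ k x → k :* con 0ℚ :* x := con 0ℚ) refl (𝟙 (member? (kernel A) w)) (r ^ weight w))) (∫-0 T)))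
        (0≤bound w)
      term w (no w≢0) = begin
        ∫ T (λ A → 𝟙 (member? (kernel A) w) * 1ℚ * r ^ weight w)
          ≡⟨ ∫-cong T (λ A → cong (_* r ^ weight w) (ℚ.*-identityʳ (𝟙 (member? (kernel A) w)))) ⟩
        ∫ T (λ A → 𝟙 (member? (kernel A) w) * r ^ weight w)
          ≡⟨ ∫-*ʳ T (r ^ weight w) (λ A → 𝟙 (member? (kernel A) w)) ⟩
        ∫ T (λ A → 𝟙 (member? (kernel A) w)) * r ^ weight w
          ≤⟨ *-monoʳ-≤ (0≤^ (weight w) 0≤r) (ℙ[∈kernel]≤ ε≤1 c μ w w≢0) ⟩
        (1ℚ - ε) ^ c * r ^ weight w ∎

    -- Each of the `i` rows exposed after the first `n` costs `B`. The bound on the early rows is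
    -- assumed for every `j`, because the late rows already replaced wait there as uniform rows.
    late-rows : ∀ {ε m n κ β B} →
      (∀ j (μ : Fin n → Fin m → BalancedLaw ε) → ∣ 𝔼[uniform] μ κ j - uniform κ (n ℕ.+ j) m ∣ ≤ β) →
      (∀ c → n ℕ.≤ c → (μ : Fin (suc c) → Fin m → BalancedLaw ε) → deviation μ ≤ B) →
      ∀ i j (μ : Fin (i ℕ.+ n) → Fin m → BalancedLaw ε) →
      ∣ 𝔼[uniform] μ κ j - uniform κ (i ℕ.+ n ℕ.+ j) m ∣ ≤ β + ι i * B
    late-rows {β = β} {B} early dev≤ zero    j μ = ℚ.≤-trans (early j μ)
      (ℚ.≤-reflexive (solve 2 (λ a b → a := a :+ con 0ℚ :* b) refl β B))
    late-rows {m = m} {n} {κ} {β} {B} early dev≤ (suc i) j μ = begin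
      ∣ 𝔼[uniform] μ κ j - uniform κ (suc i ℕ.+ n ℕ.+ j) m ∣
        ≤⟨ ∣p-r∣≤ (𝔼[uniform] μ κ j) (𝔼[uniform] (μ ∘ suc) κ (suc j)) (uniform κ (suc i ℕ.+ n ℕ.+ j) m)
             (ℚ.≤-trans (expose-last μ κ j) (dev≤ (i ℕ.+ n) (ℕ.m≤n+m n i) μ))
             (subst (λ k → ∣ 𝔼[uniform] (μ ∘ suc) κ (suc j) - uniform κ k m ∣ ≤ β + ι i * B) (ℕ.+-suc (i ℕ.+ n) j)
               (late-rows early dev≤ i (suc j) (μ ∘ suc))) ⟩
      B + (β + ι i * B)
        ≡⟨ solve 3 (λ b a k → b :+ (a :+ k :* b) := a :+ (con 1ℚ :+ k) :* b) refl B β (ι i) ⟩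
      β + (1ℚ + ι i) * B
        ≡⟨ cong (λ t → β + t * B) (ι-suc i) ⟨
      β + ι (suc i) * B ∎
      where open ℚ.≤-Reasoning

    deviation-late : ∀ {ε} → ε ≤ 1ℚ → ∀ {m c} (μ : Fin (suc c) → Fin m → BalancedLaw ε) {η C r} → 0ℚ ≤ η → 0ℚ ≤ C → 0ℚ ≤ r →
      (∀ w → ∣ bias (μ zero) w 0ₚ ∣ ≤ η + C * r ^ weight w) →
      deviation μ ≤ ι 2 * (η + C * ((1ℚ - ε) ^ c * (1ℚ + ι p * r) ^ m))
    deviation-late {ε} ε≤1 {m} {c} μ {η} {C} {r} 0≤η 0≤C 0≤r bias≤ = begin
      deviation μ
        ≤⟨ ∫-mono T (λ A → ℙ[stay]-deviation (μ zero) (kernel A) 0≤η 0≤C 0≤r bias≤) ⟩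
      ∫ T (λ A → ι 2 * (η + C * lightness r (kernel A)))
        ≡⟨ trans (∫-* T (ι 2) (λ A → η + C * lightness r (kernel A))) (cong (ι 2 *_)
             (trans (∫-+ T (λ _ → η) (λ A → C * lightness r (kernel A)))
               (cong₂ _+_ (∫-const T (matrixLaw-isProbability (μ ∘ suc)) η) (∫-* T C (λ A → lightness r (kernel A)))))) ⟩
      ι 2 * (η + C * ∫ T (λ A → lightness r (kernel A)))
        ≤⟨ *-monoˡ-≤ (0≤ι 2) (ℚ.+-monoʳ-≤ η (*-monoˡ-≤ 0≤C (𝔼[lightness]≤ ε≤1 c (μ ∘ suc) 0≤r))) ⟩
      ι 2 * (η + C * ((1ℚ - ε) ^ c * (1ℚ + ι p * r) ^ m)) ∎
      where
      open ℚ.≤-Reasoning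
      T = matrixLaw (μ ∘ suc)

    -- Universality of the nullity over rational balanced laws

    module _ {ε : ℚ} (0<ε : 0ℚ < ε) (ε≤½ : ε ≤ ½) where

      private
        0≤ε : 0ℚ ≤ ε
        0≤ε = ℚ.<⇒≤ 0<ε
        ε≤1 : ε ≤ 1ℚ
        ε≤1 = ℚ.≤-trans ε≤½ (p+r≡q⇒p≤q ½ refl (ℚ.nonNegative⁻¹ ½))
        q ρ r : ℚ
        q = 1ℚ - ε
        ρ = 1ℚ + ε
        -- With this `r` the generating function grows like `(1 + ε) ^ m`, which `(1 - ε) ^ n` still
        -- outweighs since `q * ρ = 1 - ε²`.
        r = ε * p ^- 1
        0≤q : 0ℚ ≤ q
        0≤q = p≤q⇒0≤q-p ε≤1
        q<1 : q < 1ℚ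
        q<1 = p+r≡q⇒p<q ε (solve 1 (λ e → con 1ℚ :- e :+ e := con 1ℚ) refl ε) 0<ε
        0≤ρ : 0ℚ ≤ ρ
        0≤ρ = 0≤p+q 0≤1 0≤ε
        0≤r : 0ℚ ≤ r
        0≤r = 0≤p*q 0≤ε 0≤p^-1
        pr≡ε : ι p * r ≡ ε
        pr≡ε = trans (solve 3 (λ k e y → k :* (e :* y) := e :* (k :* y)) refl (ι p) ε (p ^- 1))
          (trans (cong (ε *_) p*p^-1≡1) (ℚ.*-identityʳ ε))
        0≤qρ : 0ℚ ≤ q * ρ
        0≤qρ = 0≤p*q 0≤q 0≤ρ
        qρ<1 : q * ρ < 1ℚ
        qρ<1 = p+r≡q⇒p<q (ε * ε) (solve 1 (λ e → (con 1ℚ :- e) :* (con 1ℚ :+ e) :+ e :* e := con 1ℚ) refl ε) (0<p*q 0<ε 0<ε)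

        -- The constant `C` may depend on η but must serve all lengths `m` and all laws `μ`.
        BiasBound : ℚ → Set
        BiasBound η =
          ∃[ C ] (0ℚ ≤ C × (∀ {m} (μ : Fin m → BalancedLaw ε) w → ∣ bias μ w 0ₚ ∣ ≤ η + C * r ^ weight w))

        -- Here `C` is the number of late rows, so there are `C + n` rows and `u` further columns;
        -- `c` counts the rows exposed before the one at hand.
        LateBound : ℕ → ℕ → ℚ → Set
        LateBound u C η = ∃[ N ] (∀ n → N ℕ.≤ n → ∀ c → n ℕ.≤ c →
          (μ : Fin (suc c) → Fin (C ℕ.+ n ℕ.+ u) → BalancedLaw ε) → deviation μ ≤ ι 2 * (η + η))

        bias-bound : ∀ η → 0ℚ < η → BiasBound η
        bias-bound η 0<η = go (divide r 1ℚ (0<p*q 0<ε 0<p^-1) 0<1)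
          where
          go : ∃[ s ] (0ℚ < s × r * s ≡ 1ℚ) → BiasBound η
          go (s , 0<s , rs≡1) = proj₁ G , proj₁ (proj₂ G) ,
            λ μ w → proj₂ (proj₂ G) (bias μ w 0ₚ) (weight w) (bias²≤ 0≤ε ε≤1 μ w 0ₚ)
            where
            r≤1 : r ≤ 1ℚ
            r≤1 = ℚ.≤-trans (p*q≤p 0≤ε p^-1≤1) ε≤1
            1≤s : 1ℚ ≤ s
            1≤s = subst₂ _≤_ rs≡1 (ℚ.*-identityˡ s) (*-monoʳ-≤ (ℚ.<⇒≤ 0<s) r≤1)
            G = geometric-split (0≤decay 0≤ε ε≤1) (decay<1 0<ε) 1≤s 0≤r (trans (ℚ.*-comm s r) rs≡1) η 0<η

        late-bound : ∀ u C η → 0ℚ < η → LateBound u C η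
        late-bound u C η 0<η = go (bias-bound η 0<η)
          where
          go : BiasBound η → LateBound u C η
          -- `δ` is chosen so that `D * R * δ ≤ η`, where `R` is the excess of powers of ρ over
          -- powers of q; the summand 1 keeps the divisor positive if `D` is 0.
          go (D , 0≤D , bias≤) = go′ (divide (D * ρ ^ (C ℕ.+ u) + 1ℚ) η (ℚ.+-mono-≤-< (0≤p*q 0≤D (0≤^ (C ℕ.+ u) 0≤ρ)) 0<1) 0<η)
            where
            open ℚ.≤-Reasoning
            R = ρ ^ (C ℕ.+ u)
            go′ : ∃[ δ ] (0ℚ < δ × (D * R + 1ℚ) * δ ≡ η) → LateBound u C η
            go′ (δ , 0<δ , Gδ≡η) = proj₁ decays , λ n N≤n c n≤c μ → begin
              deviation μ
                ≤⟨ deviation-late ε≤1 μ (ℚ.<⇒≤ 0<η) 0≤D 0≤r (bias≤ (μ zero)) ⟩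
              ι 2 * (η + D * (q ^ c * (1ℚ + ι p * r) ^ (C ℕ.+ n ℕ.+ u)))
                ≡⟨ cong (λ t → ι 2 * (η + D * (q ^ c * (1ℚ + t) ^ (C ℕ.+ n ℕ.+ u)))) pr≡ε ⟩
              ι 2 * (η + D * (q ^ c * ρ ^ (C ℕ.+ n ℕ.+ u)))
                ≤⟨ *-monoˡ-≤ (0≤ι 2) (ℚ.+-monoʳ-≤ η (small n N≤n c n≤c)) ⟩
              ι 2 * (η + η) ∎
              where
              decays = q^n→0 0≤qρ qρ<1 δ 0<δ
              exponent : ∀ n → C ℕ.+ n ℕ.+ u ≡ C ℕ.+ u ℕ.+ n
              exponent n = trans (ℕ.+-assoc C n u) (trans (cong (C ℕ.+_) (ℕ.+-comm n u)) (sym (ℕ.+-assoc C u n)))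
              small : ∀ n → proj₁ decays ℕ.≤ n → ∀ c → n ℕ.≤ c → D * (q ^ c * ρ ^ (C ℕ.+ n ℕ.+ u)) ≤ η
              small n N≤n c n≤c = begin
                D * (q ^ c * ρ ^ (C ℕ.+ n ℕ.+ u))
                  ≤⟨ *-monoˡ-≤ 0≤D (*-monoʳ-≤ (0≤^ (C ℕ.+ n ℕ.+ u) 0≤ρ) (^-anti 0≤q (ℚ.<⇒≤ q<1) n≤c)) ⟩
                D * (q ^ n * ρ ^ (C ℕ.+ n ℕ.+ u))
                  ≡⟨ cong (λ t → D * (q ^ n * t)) (trans (cong (ρ ^_) (exponent n)) (^-homo-* ρ (C ℕ.+ u) n)) ⟩
                D * (q ^ n * (R * ρ ^ n))
                  ≡⟨ solve 4 (λ d x y z → d :* (x :* (y :* z)) := d :* y :* (x :* z)) refl D (q ^ n) R (ρ ^ n) ⟩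
                D * R * (q ^ n * ρ ^ n)
                  ≡⟨ cong (D * R *_) (^-distrib-* q ρ n) ⟨
                D * R * (q * ρ) ^ n
                  ≤⟨ *-monoˡ-≤ (0≤p*q 0≤D (0≤^ (C ℕ.+ u) 0≤ρ)) (proj₂ decays n N≤n) ⟩
                D * R * δ
                  ≤⟨ *-monoʳ-≤ (ℚ.<⇒≤ 0<δ) (p≤p+q {D * R} 0≤1) ⟩
                (D * R + 1ℚ) * δ
                  ≡⟨ Gδ≡η ⟩
                η ∎

      -- The threshold is found before the law `μ`. This uniformity allows an application to
      -- rational approximations that vary with n and with the index of the real sequences.
      kernel-universality : ∀ u κ δ → 0ℚ < δ → ∃[ N ] (∀ n → N ℕ.≤ n →
        (μ : Fin n → Fin (n ℕ.+ u) → BalancedLaw ε) → ∣ 𝔼[uniform] μ κ 0 - uniform κ n (n ℕ.+ u) ∣ ≤ δ)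
      kernel-universality u κ δ 0<δ = C ℕ.+ N , bound
        where
        open ℚ.≤-Reasoning
        δ₁ : ℚ
        δ₁ = ½ * δ
        0<δ₁ : 0ℚ < δ₁
        0<δ₁ = 0<p*q (ℚ.positive⁻¹ ½) 0<δ
        -- The number `C` of late rows is fixed here, so that the early rows together cost at most
        -- `δ / 2` for all `n`; the factor ε compensates the one in `early-rows`.
        early = q^n→0 0≤q q<1 (ε * δ₁) (0<p*q 0<ε 0<δ₁)
        C = proj₁ early
        t η : ℚ
        t = ℤ.+ 1 ℚ./ suc C
        -- Each of the `C` late rows costs at most `4 η`, which is `δ / 2` divided by `C + 1`;
        -- together they cost at most `δ / 2`.
        η = ½ * ½ * ½ * δ * t
        0<t : 0ℚ < t
        0<t = ℚ.positive⁻¹ t {{ℚ.normalize-pos 1 (suc C)}}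
        0<η : 0ℚ < η
        0<η = 0<p*q (0<p*q (ℚ.positive⁻¹ (½ * ½ * ½)) 0<δ) 0<t
        late = late-bound u C η 0<η
        N = proj₁ late
        total′ : δ₁ + ι C * (ι 2 * (η + η)) ≤ δ
        total′ = begin
          δ₁ + ι C * (ι 2 * (η + η))
            ≡⟨ solve 3 (λ d k t → con ½ :* d :+ k :* (con (ι 2) :* (con (½ * ½ * ½) :* d :* t :+ con (½ * ½ * ½) :* d :* t))
                 := con ½ :* d :+ con ½ :* d :* (k :* t)) refl δ (ι C) t ⟩
          δ₁ + δ₁ * (ι C * t)
            ≤⟨ ℚ.+-monoʳ-≤ δ₁ (p*q≤p (ℚ.<⇒≤ 0<δ₁) (ℚ.≤-trans (*-monoʳ-≤ (ℚ.<⇒≤ 0<t) (ι-mono (ℕ.n≤1+n C))) (ℚ.≤-reflexive (ι*1/ (suc C))))) ⟩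
          δ₁ + δ₁
            ≡⟨ solve 1 (λ d → con ½ :* d :+ con ½ :* d := d) refl δ ⟩
          δ ∎
        split : ∀ n′ → N ℕ.≤ n′ → (μ : Fin (C ℕ.+ n′) → Fin (C ℕ.+ n′ ℕ.+ u) → BalancedLaw ε) →
          ∣ 𝔼[uniform] μ κ 0 - uniform κ (C ℕ.+ n′) (C ℕ.+ n′ ℕ.+ u) ∣ ≤ δ
        split n′ N≤n′ μ = ℚ.≤-trans
          (subst (λ k → ∣ 𝔼[uniform] μ κ 0 - uniform κ k (C ℕ.+ n′ ℕ.+ u) ∣ ≤ δ₁ + ι C * (ι 2 * (η + η)))
            (ℕ.+-identityʳ (C ℕ.+ n′))
            (late-rows {β = δ₁} {B = ι 2 * (η + η)} early′ (proj₂ late n′ N≤n′) C 0 μ))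
          total′
          where
          dims : n′ ℕ.+ (C ℕ.+ u) ≡ C ℕ.+ n′ ℕ.+ u
          dims = trans (sym (ℕ.+-assoc n′ C u)) (cong (ℕ._+ u) (ℕ.+-comm n′ C))
          early′ : ∀ j (ν : Fin n′ → Fin (C ℕ.+ n′ ℕ.+ u) → BalancedLaw ε) →
            ∣ 𝔼[uniform] ν κ j - uniform κ (n′ ℕ.+ j) (C ℕ.+ n′ ℕ.+ u) ∣ ≤ δ₁
          early′ j ν = *-cancelˡ-≤ ε 0<ε (ℚ.≤-trans (early-rows 0≤ε ε≤½ n′ dims ν κ j) (proj₂ early (C ℕ.+ u) (ℕ.m≤m+n C u)))
        bound : ∀ n → C ℕ.+ N ℕ.≤ n → (μ : Fin n → Fin (n ℕ.+ u) → BalancedLaw ε) →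
          ∣ 𝔼[uniform] μ κ 0 - uniform κ n (n ℕ.+ u) ∣ ≤ δ
        bound n C+N≤n = shift (ℕ.m≤n⇒∃[o]m+o≡n (ℕ.≤-trans (ℕ.m≤m+n C N) C+N≤n)) C+N≤n
          where
          shift : ∀ {n} → ∃[ n′ ] C ℕ.+ n′ ≡ n → C ℕ.+ N ℕ.≤ n → (μ : Fin n → Fin (n ℕ.+ u) → BalancedLaw ε) →
            ∣ 𝔼[uniform] μ κ 0 - uniform κ n (n ℕ.+ u) ∣ ≤ δ
          shift (n′ , refl) C+N≤n = split n′ (ℕ.+-cancelˡ-≤ C N n′ C+N≤n)

  -- Partial products of 1 - p⁻ⁱ and the limit law

  module _ (p : ℕ) {{isPrime : Prime p}} where

    private
      instance
        p≢0 : ℕ.NonZero p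
        p≢0 = prime⇒nonZero isPrime

      y : ℚ
      y = p ^- 1

      y^m<1 : ∀ m → y ^ suc m < 1ℚ
      y^m<1 m = ℚ.≤-<-trans (p*q≤p 0≤p^-1 (^≤1 m 0≤p^-1 p^-1≤1)) (ℚ.≤-<-trans p^-1≤½ (p+r≡q⇒p<q ½ refl (ℚ.positive⁻¹ ½)))

      P : ℕ → ℚ
      P m = ∏₁ m (λ i → 1ℚ - p ^- i)

    p^-≡^ : ∀ m → p ^- m ≡ p ^- 1 ^ m
    p^-≡^ m = *-cancelˡ-≡ (ι (p ℕ.^ m)) (0<ι (p ℕ.^ m) {{ℕ.m^n≢0 p m}})
      (trans (ι*1/ (p ℕ.^ m) {{ℕ.m^n≢0 p m}}) (sym (trans (cong (_* y ^ m) (ι-^ m)) (a^n*b^n≡1 m p*p^-1≡1))))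
      where
      ι-^ : ∀ m → ι (p ℕ.^ m) ≡ ι p ^ m
      ι-^ zero    = refl
      ι-^ (suc m) = trans (ι-* p (p ℕ.^ m)) (cong (ι p *_) (ι-^ m))

    private

      P-suc : ∀ m → P (suc m) ≡ P m * (1ℚ - y ^ suc m)
      P-suc m = cong (λ t → P m * (1ℚ - t)) (p^-≡^ (suc m))

      0<P : ∀ m → 0ℚ < P m
      0<P zero    = 0<1
      0<P (suc m) = subst (0ℚ <_) (sym (P-suc m)) (0<p*q (0<P m) (p<q⇒0<q-p (y^m<1 m)))

      P-anti : ∀ m d → P (d ℕ.+ m) ≤ P m
      P-anti m zero    = ℚ.≤-refl
      P-anti m (suc d) = ℚ.≤-trans (ℚ.≤-trans (ℚ.≤-reflexive (P-suc (d ℕ.+ m))) (p*q≤p (ℚ.<⇒≤ (0<P (d ℕ.+ m)))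
        (p+r≡q⇒p≤q (y ^ suc (d ℕ.+ m)) (solve 1 (λ x → con 1ℚ :- x :+ x := con 1ℚ) refl (y ^ suc (d ℕ.+ m)))
          (0≤^ (suc (d ℕ.+ m)) 0≤p^-1)))) (P-anti m d)

      ∏inverse : ∀ m → ∏₁ m (λ i → [1- p ^- i ]⁻¹) * P m ≡ 1ℚ
      ∏inverse zero    = refl
      ∏inverse (suc m) = begin
        I * c * (P m * d)     ≡⟨ solve 4 (λ i c x d → i :* c :* (x :* d) := (i :* x) :* (c :* d)) refl I c (P m) d ⟩
        (I * P m) * (c * d)   ≡⟨ cong₂ _*_ (∏inverse m) (ℚ.*-inverseˡ d {{d≢0}}) ⟩
        1ℚ * 1ℚ               ≡⟨⟩
        1ℚ                    ∎
        where
        open ≡-Reasoning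
        I c d : ℚ
        I = ∏₁ m (λ i → [1- p ^- i ]⁻¹)
        c = [1- p ^- suc m ]⁻¹
        d = 1ℚ - p ^- suc m
        d≢0 : ℚ.NonZero d
        d≢0 = ℚ.pos⇒nonZero d {{ℚ.positive (p<q⇒0<q-p (subst (_< 1ℚ) (sym (p^-≡^ (suc m))) (y^m<1 m)))}}

    -- The limiting distribution

    uniform-below : ∀ κ j d → d ℕ.< κ → uniform κ j d ≡ 0ℚ
    uniform-below κ zero    d d<κ = 𝟙-no (d ℕ.≟ κ) (ℕ.<⇒≢ d<κ)
    uniform-below κ (suc j) d d<κ = trans
      (cong₂ (λ a b → y ^ d * a + (1ℚ - y ^ d) * b) (uniform-below κ j d d<κ)
        (uniform-below κ j (ℕ.pred d) (ℕ.≤-<-trans ℕ.pred[n]≤n d<κ)))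
      (solve 1 (λ z → z :* con 0ℚ :+ (con 1ℚ :- z) :* con 0ℚ := con 0ℚ) refl (y ^ d))

    uniform-above : ∀ κ j d → j ℕ.+ κ ℕ.< d → uniform κ j d ≡ 0ℚ
    uniform-above κ zero    d       κ<d = 𝟙-no (d ℕ.≟ κ) (ℕ.<⇒≢ κ<d ∘ sym)
    uniform-above κ (suc j) (suc d) (ℕ.s≤s j+κ<d) = trans
      (cong₂ (λ a b → y ^ suc d * a + (1ℚ - y ^ suc d) * b) (uniform-above κ j (suc d) (ℕ.<-trans j+κ<d (ℕ.n<1+n d)))
        (uniform-above κ j d j+κ<d))
      (solve 1 (λ z → z :* con 0ℚ :+ (con 1ℚ :- z) :* con 0ℚ := con 0ℚ) refl (y ^ suc d))

    private

      uniform-bottom : ∀ κ j → uniform κ (suc j) κ ≡ y ^ κ * uniform κ j κ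
      -- From dimension 0 the descending term of `uniform` has coefficient `1 - y ^ 0 = 0`, so the
      -- default `pred 0 = 0` has no effect.
      uniform-bottom zero    j = solve 1 (λ u → con 1ℚ :* u :+ (con 1ℚ :- con 1ℚ) :* u := con 1ℚ :* u) refl (uniform 0 j 0)
      uniform-bottom (suc κ) j = trans
        (cong (λ t → y ^ suc κ * uniform (suc κ) j (suc κ) + (1ℚ - y ^ suc κ) * t) (uniform-below (suc κ) j κ (ℕ.n<1+n κ)))
        (solve 2 (λ z u → z :* u :+ (con 1ℚ :- z) :* con 0ℚ := z :* u) refl (y ^ suc κ) (uniform (suc κ) j (suc κ)))

    -- The formula p^(-κb) P (a + κ) P j / (P a P b P κ), with the denominators cleared.
    uniform-closed : ∀ κ j a b → a ℕ.+ b ≡ j →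
      P a * P b * P κ * uniform κ j (a ℕ.+ κ) ≡ (y ^ κ) ^ b * P (a ℕ.+ κ) * P j
    uniform-closed κ .zero zero zero refl = trans
      (cong (λ t → 1ℚ * 1ℚ * P κ * t) (𝟙-yes (κ ℕ.≟ κ) refl))
      (solve 1 (λ x → con 1ℚ :* con 1ℚ :* x :* con 1ℚ := con 1ℚ :* x :* con 1ℚ) refl (P κ))
    uniform-closed κ .(suc b) zero (suc b) refl = begin
      1ℚ * P (suc b) * P κ * uniform κ (suc b) κ
        ≡⟨ cong₂ (λ s u → 1ℚ * s * P κ * u) (P-suc b) (uniform-bottom κ b) ⟩
      1ℚ * (P b * c) * P κ * (k * uniform κ b κ)
        ≡⟨ solve 5 (λ s c x k u → con 1ℚ :* (s :* c) :* x :* (k :* u) := c :* k :* (con 1ℚ :* s :* x :* u)) refl (P b) c (P κ) k (uniform κ b κ) ⟩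
      c * k * (1ℚ * P b * P κ * uniform κ b κ)
        ≡⟨ cong (c * k *_) (uniform-closed κ b zero b refl) ⟩
      c * k * (k ^ b * P κ * P b)
        ≡⟨ solve 5 (λ s c x k z → c :* k :* (z :* x :* s) := k :* z :* x :* (s :* c)) refl (P b) c (P κ) k (k ^ b) ⟩
      k * k ^ b * P κ * (P b * c)
        ≡⟨ cong (k * k ^ b * P κ *_) (P-suc b) ⟨
      k * k ^ b * P κ * P (suc b) ∎
      where
      open ≡-Reasoning
      k c : ℚ
      k = y ^ κ
      c = 1ℚ - y ^ suc b
    uniform-closed κ .(suc (a ℕ.+ 0)) (suc a) zero refl = begin
      P (suc a) * 1ℚ * P κ * (y ^ suc (a ℕ.+ κ) * uniform κ j (suc (a ℕ.+ κ)) + (1ℚ - y ^ suc (a ℕ.+ κ)) * u)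
        ≡⟨ cong₂ (λ s v → s * 1ℚ * P κ * (y ^ suc (a ℕ.+ κ) * v + (1ℚ - y ^ suc (a ℕ.+ κ)) * u)) (P-suc a)
             (uniform-above κ j (suc (a ℕ.+ κ)) (ℕ.s≤s (ℕ.≤-reflexive (cong (ℕ._+ κ) (ℕ.+-identityʳ a))))) ⟩
      P a * c * 1ℚ * P κ * (y ^ suc (a ℕ.+ κ) * 0ℚ + (1ℚ - y ^ suc (a ℕ.+ κ)) * u)
        ≡⟨ solve 5 (λ s c x z u → s :* c :* con 1ℚ :* x :* (z :* con 0ℚ :+ (con 1ℚ :- z) :* u) := c :* (con 1ℚ :- z) :* (s :* con 1ℚ :* x :* u))
             refl (P a) c (P κ) (y ^ suc (a ℕ.+ κ)) u ⟩
      c * e * (P a * 1ℚ * P κ * u)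
        ≡⟨ cong (c * e *_) (uniform-closed κ j a zero refl) ⟩
      c * e * (1ℚ * P (a ℕ.+ κ) * P j)
        ≡⟨ solve 4 (λ c e d s → c :* e :* (con 1ℚ :* d :* s) := con 1ℚ :* (d :* e) :* (s :* c)) refl c e (P (a ℕ.+ κ)) (P j) ⟩
      1ℚ * (P (a ℕ.+ κ) * e) * (P j * c)
        ≡⟨ cong₂ (λ s t → 1ℚ * s * t) (P-suc (a ℕ.+ κ))
             (trans (P-suc j) (cong (λ i → P j * (1ℚ - y ^ suc i)) (ℕ.+-identityʳ a))) ⟨
      1ℚ * P (suc (a ℕ.+ κ)) * P (suc j) ∎
      where
      open ≡-Reasoning
      j = a ℕ.+ 0
      u c e : ℚ
      u = uniform κ j (a ℕ.+ κ)
      c = 1ℚ - y ^ suc a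
      e = 1ℚ - y ^ suc (a ℕ.+ κ)
    uniform-closed κ .(suc (a ℕ.+ suc b)) (suc a) (suc b) refl = begin
      P (suc a) * P (suc b) * P κ * (y ^ suc (a ℕ.+ κ) * h₁ + (1ℚ - y ^ suc (a ℕ.+ κ)) * h₂)
        ≡⟨ cong (λ z → P (suc a) * P (suc b) * P κ * (z * h₁ + (1ℚ - z) * h₂)) (^-homo-* y (suc a) κ) ⟩
      P (suc a) * P (suc b) * P κ * (α * k * h₁ + (1ℚ - α * k) * h₂)
        ≡⟨ cong₂ (λ s t → s * t * P κ * (α * k * h₁ + (1ℚ - α * k) * h₂)) (P-suc a) (P-suc b) ⟩
      P a * (1ℚ - α) * (P b * (1ℚ - β)) * P κ * (α * k * h₁ + (1ℚ - α * k) * h₂)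
        ≡⟨ solve 8 (λ A B K α β k h₁ h₂ →
             A :* (con 1ℚ :- α) :* (B :* (con 1ℚ :- β)) :* K :* (α :* k :* h₁ :+ (con 1ℚ :- α :* k) :* h₂)
             := (con 1ℚ :- β) :* α :* k :* (A :* (con 1ℚ :- α) :* B :* K :* h₁)
                :+ (con 1ℚ :- α) :* (con 1ℚ :- α :* k) :* (A :* (B :* (con 1ℚ :- β)) :* K :* h₂))
             refl (P a) (P b) (P κ) α β k h₁ h₂ ⟩
      (1ℚ - β) * α * k * (P a * (1ℚ - α) * P b * P κ * h₁) + (1ℚ - α) * (1ℚ - α * k) * (P a * (P b * (1ℚ - β)) * P κ * h₂)
        ≡⟨ cong₂ (λ s t → (1ℚ - β) * α * k * s + (1ℚ - α) * (1ℚ - α * k) * t) first second ⟩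
      (1ℚ - β) * α * k * (z * (Q * (1ℚ - α * k)) * S) + (1ℚ - α) * (1ℚ - α * k) * (k * z * Q * S)
        -- Apart from common factors this is the q-Pascal rule `α (1 - β) + (1 - α) = 1 - α β`.
        ≡⟨ solve 6 (λ α β k z Q S →
             (con 1ℚ :- β) :* α :* k :* (z :* (Q :* (con 1ℚ :- α :* k)) :* S) :+ (con 1ℚ :- α) :* (con 1ℚ :- α :* k) :* (k :* z :* Q :* S)
             := k :* z :* (Q :* (con 1ℚ :- α :* k)) :* (S :* (con 1ℚ :- α :* β))) refl α β k z Q S ⟩
      k * z * (Q * (1ℚ - α * k)) * (S * (1ℚ - α * β))
        ≡⟨ cong₂ (λ s t → k * z * s * t) P-top (trans (P-suc j) (cong (λ t → S * (1ℚ - t)) (^-homo-* y (suc a) (suc b)))) ⟨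
      k * z * P (suc (a ℕ.+ κ)) * P (suc j) ∎
      where
      open ≡-Reasoning
      j = a ℕ.+ suc b
      k α β z Q S h₁ h₂ : ℚ
      k = y ^ κ
      α = y ^ suc a
      β = y ^ suc b
      z = k ^ b
      Q = P (a ℕ.+ κ)
      S = P j
      h₁ = uniform κ j (suc (a ℕ.+ κ))
      h₂ = uniform κ j (a ℕ.+ κ)
      P-top : P (suc (a ℕ.+ κ)) ≡ Q * (1ℚ - α * k)
      P-top = trans (P-suc (a ℕ.+ κ)) (cong (λ t → Q * (1ℚ - t)) (^-homo-* y (suc a) κ))
      first : P a * (1ℚ - α) * P b * P κ * h₁ ≡ z * (Q * (1ℚ - α * k)) * S
      first = trans (cong (λ s → s * P b * P κ * h₁) (sym (P-suc a)))
        (trans (uniform-closed κ j (suc a) b (sym (ℕ.+-suc a b))) (cong (λ s → z * s * S) P-top))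
      second : P a * (P b * (1ℚ - β)) * P κ * h₂ ≡ k * z * Q * S
      second = trans (cong (λ s → P a * s * P κ * h₂) (sym (P-suc b))) (uniform-closed κ j a (suc b) refl)

    limit-factor : ℕ → ℕ → ℚ
    limit-factor u k = p ^- (k ℕ.* (k ℕ.+ u)) * ∏₁ k (λ i → [1- p ^- i ]⁻¹) * ∏₁ (k ℕ.+ u) (λ i → [1- p ^- i ]⁻¹)

    -- The closed form with `b = k`: of the `a + k` rows, `a` lower the dimension and `k` are
    -- redundant. The exponent `k (k + u)` is `k` times the final dimension, and the products over
    -- `k` and `k + u` become the inverse factors of the limit.
    uniform-factor : ∀ u k a → P a * uniform (k ℕ.+ u) (a ℕ.+ k) (a ℕ.+ (k ℕ.+ u)) ≡
      limit-factor u k * P (a ℕ.+ (k ℕ.+ u)) * P (a ℕ.+ k)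
    uniform-factor u k a = begin
      P a * h
        ≡⟨ solve 2 (λ x h → x :* h := con 1ℚ :* con 1ℚ :* (x :* h)) refl (P a) h ⟩
      1ℚ * 1ℚ * (P a * h)
        ≡⟨ cong₂ (λ s t → s * t * (P a * h)) (∏inverse k) (∏inverse κ) ⟨
      I * P k * (I′ * P κ) * (P a * h)
        ≡⟨ solve 6 (λ i b j c x h → i :* b :* (j :* c) :* (x :* h) := i :* j :* (x :* b :* c :* h)) refl I (P k) I′ (P κ) (P a) h ⟩
      I * I′ * (P a * P k * P κ * h)
        ≡⟨ cong (I * I′ *_) (uniform-closed κ (a ℕ.+ k) a k refl) ⟩
      I * I′ * ((y ^ κ) ^ k * P (a ℕ.+ κ) * P (a ℕ.+ k))
        ≡⟨ cong (λ t → I * I′ * (t * P (a ℕ.+ κ) * P (a ℕ.+ k))) (trans (p^-≡^ (k ℕ.* κ)) (^-* y k κ)) ⟨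
      I * I′ * (p ^- (k ℕ.* κ) * P (a ℕ.+ κ) * P (a ℕ.+ k))
        ≡⟨ solve 5 (λ i j t b c → i :* j :* (t :* b :* c) := t :* i :* j :* b :* c) refl I I′ (p ^- (k ℕ.* κ)) (P (a ℕ.+ κ)) (P (a ℕ.+ k)) ⟩
      limit-factor u k * P (a ℕ.+ κ) * P (a ℕ.+ k) ∎
      where
      open ≡-Reasoning
      κ = k ℕ.+ u
      h I I′ : ℚ
      h = uniform κ (a ℕ.+ k) (a ℕ.+ κ)
      I = ∏₁ k (λ i → [1- p ^- i ]⁻¹)
      I′ = ∏₁ κ (λ i → [1- p ^- i ]⁻¹)

    -- Up to positive factors it is a probability, namely the case `a = 0` of `uniform-factor`.
    0≤limit-factor : ∀ u k → 0ℚ ≤ limit-factor u k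
    0≤limit-factor u k = *-cancelˡ-≤ D (0<p*q (0<P (k ℕ.+ u)) (0<P k)) (begin
      D * 0ℚ                                                  ≡⟨ ℚ.*-zeroʳ D ⟩
      0ℚ                                                      ≤⟨ 0≤p*q (ℚ.<⇒≤ (0<P 0)) (0≤uniform (k ℕ.+ u) k (k ℕ.+ u)) ⟩
      P 0 * uniform (k ℕ.+ u) k (k ℕ.+ u)                     ≡⟨ uniform-factor u k 0 ⟩
      limit-factor u k * P (k ℕ.+ u) * P k                    ≡⟨ solve 3 (λ f x z → f :* x :* z := x :* z :* f) refl (limit-factor u k) (P (k ℕ.+ u)) (P k) ⟩
      D * limit-factor u k                                    ∎)
      where
      open ℚ.≤-Reasoning
      D : ℚ
      D = P (k ℕ.+ u) * P k

    -- By `uniform-factor` with `n = a + k`, the probability is the limit factor times `P (a + k)`,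
    -- up to the quotient `P (a + k + u + k) / P a` without its middle shift: both `P (a + (k + u))`
    -- and `P a` converge to the same product. The index `t` of the real limit varies independently
    -- of `n`.
    uniform-limit : ∀ u k δ → 0ℚ < δ → ∃[ N ] (∀ n t → N ℕ.≤ n → N ℕ.≤ t →
      ∣ uniform (k ℕ.+ u) n (n ℕ.+ u) - limit-factor u k * seq ∏₁∞[1- p ^-] t ∣ ≤ δ)
    uniform-limit u k δ 0<δ = go (divide (F + F + 1ℚ) δ (ℚ.+-mono-≤-< (0≤p+q 0≤F 0≤F) 0<1) 0<δ)
      where
      open ℚ.≤-Reasoning
      F : ℚ
      F = limit-factor u k
      0≤F : 0ℚ ≤ F
      0≤F = 0≤limit-factor u k
      κ = k ℕ.+ u
      go : ∃[ τ ] (0ℚ < τ × (F + F + 1ℚ) * τ ≡ δ) → ∃[ N ] (∀ n t → N ℕ.≤ n → N ℕ.≤ t →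
        ∣ uniform (k ℕ.+ u) n (n ℕ.+ u) - limit-factor u k * P t ∣ ≤ δ)
      go (τ , 0<τ , Gτ≡δ) = k ℕ.+ N , λ n t k+N≤n k+N≤t →
        shift n t (ℕ.m≤n⇒∃[o]m+o≡n (ℕ.≤-trans (ℕ.m≤m+n k N) k+N≤n)) k+N≤n (ℕ.≤-trans (ℕ.m≤n+m N k) k+N≤t)
        where
        N = proj₁ (cauchy ∏₁∞[1- p ^-] τ 0<τ)
        close : ∀ m n → N ℕ.≤ m → N ℕ.≤ n → ∣ P m - P n ∣ ≤ τ
        close m n N≤m N≤n = ℚ.<⇒≤ (proj₂ (cauchy ∏₁∞[1- p ^-] τ 0<τ) m n N≤m N≤n)
        shifted : ∀ a t → N ℕ.≤ a → N ℕ.≤ t → ∣ uniform κ (a ℕ.+ k) (a ℕ.+ κ) - F * P t ∣ ≤ δ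
        shifted a t N≤a N≤t = begin
          ∣ h - F * P t ∣         ≤⟨ ∣p-r∣≤ h (F * P (a ℕ.+ k)) (F * P t) near far ⟩
          F * τ + F * τ           ≤⟨ p+r≡q⇒p≤q τ (solve 2 (λ f t → f :* t :+ f :* t :+ t := (f :+ f :+ con 1ℚ) :* t) refl F τ) (ℚ.<⇒≤ 0<τ) ⟩
          (F + F + 1ℚ) * τ        ≡⟨ Gτ≡δ ⟩
          δ                       ∎
          where
          h : ℚ
          h = uniform κ (a ℕ.+ k) (a ℕ.+ κ)
          N≤a+ : ∀ i → N ℕ.≤ a ℕ.+ i
          N≤a+ i = ℕ.≤-trans N≤a (ℕ.m≤m+n a i)
          ∣F*∣ : ∀ d → ∣ F * d ∣ ≡ F * ∣ d ∣
          ∣F*∣ d = trans (ℚ.∣p*q∣≡∣p∣*∣q∣ F d) (cong (_* ∣ d ∣) (ℚ.0≤p⇒∣p∣≡p 0≤F))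
          far : ∣ F * P (a ℕ.+ k) - F * P t ∣ ≤ F * τ
          far = begin
            ∣ F * P (a ℕ.+ k) - F * P t ∣     ≡⟨ cong ∣_∣ (solve 3 (λ f x y → f :* x :- f :* y := f :* (x :- y)) refl F (P (a ℕ.+ k)) (P t)) ⟩
            ∣ F * (P (a ℕ.+ k) - P t) ∣       ≡⟨ ∣F*∣ (P (a ℕ.+ k) - P t) ⟩
            F * ∣ P (a ℕ.+ k) - P t ∣         ≤⟨ *-monoˡ-≤ 0≤F (close (a ℕ.+ k) t (N≤a+ k) N≤t) ⟩
            F * τ                             ∎
          near : ∣ h - F * P (a ℕ.+ k) ∣ ≤ F * τ
          -- The denominator `P a` is cancelled against `P (a + k) ≤ P a`, so the estimate does not
          -- depend on a lower bound for the infinite product.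
          near = *-cancelˡ-≤ (P a) (0<P a) (begin
            P a * ∣ h - F * P (a ℕ.+ k) ∣
              ≡⟨ cong (_* ∣ h - F * P (a ℕ.+ k) ∣) (ℚ.0≤p⇒∣p∣≡p (ℚ.<⇒≤ (0<P a))) ⟨
            ∣ P a ∣ * ∣ h - F * P (a ℕ.+ k) ∣
              ≡⟨ ℚ.∣p*q∣≡∣p∣*∣q∣ (P a) (h - F * P (a ℕ.+ k)) ⟨
            ∣ P a * (h - F * P (a ℕ.+ k)) ∣
              ≡⟨ cong ∣_∣ (trans (solve 4 (λ x h f z → x :* (h :- f :* z) := x :* h :- f :* x :* z) refl (P a) h F (P (a ℕ.+ k)))
                   (cong (λ s → s - F * P a * P (a ℕ.+ k)) (uniform-factor u k a))) ⟩
            ∣ F * P (a ℕ.+ κ) * P (a ℕ.+ k) - F * P a * P (a ℕ.+ k) ∣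
              ≡⟨ cong ∣_∣ (solve 4 (λ f w x z → f :* w :* z :- f :* x :* z := z :* (f :* (w :- x))) refl F (P (a ℕ.+ κ)) (P a) (P (a ℕ.+ k))) ⟩
            ∣ P (a ℕ.+ k) * (F * (P (a ℕ.+ κ) - P a)) ∣
              ≡⟨ trans (ℚ.∣p*q∣≡∣p∣*∣q∣ (P (a ℕ.+ k)) (F * (P (a ℕ.+ κ) - P a)))
                   (cong₂ _*_ (ℚ.0≤p⇒∣p∣≡p (ℚ.<⇒≤ (0<P (a ℕ.+ k)))) (∣F*∣ (P (a ℕ.+ κ) - P a))) ⟩
            P (a ℕ.+ k) * (F * ∣ P (a ℕ.+ κ) - P a ∣)
              ≤⟨ *-mono-≤ (0≤p*q 0≤F (ℚ.0≤∣p∣ (P (a ℕ.+ κ) - P a))) (ℚ.<⇒≤ (0<P a))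
                   (subst (λ i → P i ≤ P a) (ℕ.+-comm k a) (P-anti a k)) (*-monoˡ-≤ 0≤F (close (a ℕ.+ κ) a (N≤a+ κ) N≤a)) ⟩
            P a * (F * τ) ∎)
        shift : ∀ n t → ∃[ a ] k ℕ.+ a ≡ n → k ℕ.+ N ℕ.≤ n → N ℕ.≤ t → ∣ uniform κ n (n ℕ.+ u) - F * P t ∣ ≤ δ
        shift .(k ℕ.+ a) t (a , refl) k+N≤ N≤t = subst₂ (λ i d → ∣ uniform κ i d - F * P t ∣ ≤ δ)
          (ℕ.+-comm a k) (trans (sym (ℕ.+-assoc a k u)) (cong (ℕ._+ u) (ℕ.+-comm a k)))
          (shifted a t (ℕ.+-cancelˡ-≤ k N a k+N≤) N≤t)

  module _ {p : ℕ} {{isPrime : Prime p}} where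

    -- Rational laws approximating real ones

    balancedLaw : ∀ {ε} (ν : Weights p) → (∀ r → mass ν r ≤ 1ℚ - ε) → BalancedLaw ε
    balancedLaw {ε} ν mass≤ = record
      { integral      = weighted (mass ν) (0≤mass ν)
      ; isProbability = trans (sum-cong-≗ (λ r → ℚ.*-identityʳ (mass ν r))) (total≡ ν)
      ; bounded       = λ a → subst (_≤ 1ℚ - ε) (sym (trans
          (sum-single (λ r → mass ν r * 𝟙 (r Fin.≟ a)) a
            (λ r r≢a → trans (cong (mass ν r *_) (𝟙-no (r Fin.≟ a) r≢a)) (ℚ.*-zeroʳ (mass ν r))))
          (trans (cong (mass ν a *_) (𝟙-yes (a Fin.≟ a) refl)) (ℚ.*-identityʳ (mass ν a))))) (mass≤ a)
      }

    matrixLaw-expand : ∀ {ε c m} (ν : Fin c → Fin m → Weights p) (mass≤ : ∀ i j r → mass (ν i j) r ≤ 1ℚ - ε) f →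
      ∫ (matrixLaw (λ i j → balancedLaw {ε = ε} (ν i j) (mass≤ i j))) f ≡
      ∑ₗ (matrices p c m) (λ A → ∏ (λ i → ∏ (λ j → mass (ν i j) (entry A i j))) * f A)
    matrixLaw-expand {m = m} ν mass≤ = iterated-expand (vectors (allFin p) m) _ (λ i x → ∏ (λ j → mass (ν i j) (lookup x j)))
      (λ i → iterated-expand (allFin p) _ (λ j → mass (ν i j)) (λ j f → sym (∑ₗ-allFin p (λ a → mass (ν i j) a * f a))))

    module _ {c m : ℕ} (M : RandomMatrix p c m) where

      private
        Ms = matrices p c m
        size′ = ι (length Ms)
        lawₜ : ℕ → Matrix p c m → ℚ
        lawₜ t A = seq (law M A) t
        marginal : ℕ → Fin c → Fin m → Fin p → ℚ
        marginal t i j r = seq (ℙ[entry≡] M i j r) t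

      seq-ℙ : ∀ {E : Pred (Matrix p c m) 0ℓ} (E? : Decidable E) t →
        seq (ℙ M E?) t ≡ ∑ₗ (matrices p c m) (λ A → 𝟙 (E? A) * seq (law M A) t)
      seq-ℙ E? t = trans (seq-∑ℝ (law M) (filter E? Ms) t) (∑ₗ-filter E? Ms (lawₜ t))

      -- This holds exactly at every index, as the operations on reals act termwise on their
      -- sequences; the marginals therefore inherit their approximate total mass from `total`.
      sum-marginal : ∀ t i j → sum (marginal t i j) ≡ seq (∑ℝ (List.map (law M) Ms)) t
      sum-marginal t i j = begin
        sum (λ r → marginal t i j r)
          ≡⟨ sum-cong-≗ (λ r → seq-ℙ (λ A → entry A i j Fin.≟ r) t) ⟩
        sum (λ r → ∑ₗ Ms (λ A → 𝟙 (entry A i j Fin.≟ r) * lawₜ t A))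
          ≡⟨ sum-∑ₗ Ms (λ r A → 𝟙 (entry A i j Fin.≟ r) * lawₜ t A) ⟩
        ∑ₗ Ms (λ A → sum (λ r → 𝟙 (entry A i j Fin.≟ r) * lawₜ t A))
          ≡⟨ ∑ₗ-cong Ms (λ A → trans
               (sum-single (λ r → 𝟙 (entry A i j Fin.≟ r) * lawₜ t A) (entry A i j)
                 (λ r r≢ → trans (cong (_* lawₜ t A) (𝟙-no (entry A i j Fin.≟ r) (r≢ ∘ sym))) (ℚ.*-zeroˡ (lawₜ t A))))
               (trans (cong (_* lawₜ t A) (𝟙-yes (entry A i j Fin.≟ entry A i j) refl)) (ℚ.*-identityˡ (lawₜ t A)))) ⟩
        ∑ₗ Ms (lawₜ t)
          ≡⟨ seq-∑ℝ (law M) Ms t ⟨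
        seq (∑ℝ (List.map (law M) Ms)) t ∎
        where open ≡-Reasoning

      eventually-total : ∀ σ → 0ℚ < σ → Eventually (λ t → ∀ i j → ∣ sum (marginal t i j) - 1ℚ ∣ ≤ σ)
      eventually-total σ 0<σ = eventually-map
        (λ {t} close i j → ℚ.<⇒≤ (subst (λ s → ∣ s - 1ℚ ∣ < σ) (sym (sum-marginal t i j)) close))
        (≃-close (total M) σ 0<σ)

      eventually-nonneg : ∀ σ → 0ℚ < σ → Eventually (λ t → ∀ i j r → 0ℚ ≤ marginal t i j r + σ)
      -- A marginal is a sum of at most `length Ms` values of the law, each eventually above `- τ`,
      -- so τ is σ divided by one more than that number.
      eventually-nonneg σ 0<σ = go (divide (size′ + 1ℚ) σ (ℚ.+-mono-≤-< (0≤ι (length Ms)) 0<1) 0<σ)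
        where
        go : ∃[ τ ] (0ℚ < τ × (size′ + 1ℚ) * τ ≡ σ) → Eventually (λ t → ∀ i j r → 0ℚ ≤ marginal t i j r + σ)
        go (τ , 0<τ , eq) = eventually-map bound (eventually-All (λ A → ≤-close (nonneg M A) τ 0<τ) Ms)
          where
          open ℚ.≤-Reasoning
          bound : ∀ {t} → All (λ A → 0ℚ < lawₜ t A + τ) Ms → ∀ i j r → 0ℚ ≤ marginal t i j r + σ
          bound {t} 0<law i j r = begin
            0ℚ
              ≤⟨ ℚ.<⇒≤ 0<τ ⟩
            τ
              ≡⟨ trans (solve 2 (λ k t → t := k :* (:- t) :+ (k :+ con 1ℚ) :* t) refl size′ τ) (cong (size′ * (- τ) +_) eq) ⟩
            size′ * (- τ) + σ
              ≡⟨ cong (_+ σ) (∑ₗ-const Ms (- τ)) ⟨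
            ∑ₗ Ms (λ _ → - τ) + σ
              ≤⟨ ℚ.+-monoˡ-≤ σ (∑ₗ-mono (All.map (λ {A} → term A) 0<law)) ⟩
            ∑ₗ Ms (λ A → 𝟙 (entry A i j Fin.≟ r) * lawₜ t A) + σ
              ≡⟨ cong (_+ σ) (seq-ℙ (λ A → entry A i j Fin.≟ r) t) ⟨
            marginal t i j r + σ ∎
            where
            scale : ∀ {P : Set} (P? : Dec P) x → 0ℚ < x + τ → - τ ≤ 𝟙 P? * x
            scale (yes _) x 0<x+τ = subst (- τ ≤_) (sym (ℚ.*-identityˡ x)) (0≤q-p⇒p≤q
              (subst (0ℚ ≤_) (solve 2 (λ x t → x :+ t := x :- (:- t)) refl x τ) (ℚ.<⇒≤ 0<x+τ)))
            scale (no _)  x 0<x+τ = subst (- τ ≤_) (sym (ℚ.*-zeroˡ x)) (ℚ.neg-antimono-≤ (ℚ.<⇒≤ 0<τ))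
            term : ∀ A → 0ℚ < lawₜ t A + τ → - τ ≤ 𝟙 (entry A i j Fin.≟ r) * lawₜ t A
            term A = scale (entry A i j Fin.≟ r) (lawₜ t A)

      module _ {ε : ℝ} (balanced : IsBalanced ε M) (0<ε : 0ℝ <ℝ ε) where

        open IsBalanced balanced renaming (bounded to entry-bounded)

        -- The rational witness of `0ℝ <ℝ ε` bounds the sequence of ε from below and takes the place
        -- of the real ε.
        eventually-bounded : ∀ σ → 0ℚ < σ → Eventually (λ t → ∀ i j r → marginal t i j r ≤ 1ℚ - gap 0<ε + σ)
        eventually-bounded σ 0<σ = eventually-map bound (eventually-× (<-separation 0<ε)
          (eventually-∀ λ i → eventually-∀ λ j → eventually-∀ λ r → ≤-close (entry-bounded i j r) σ 0<σ))
          where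
          bound : ∀ {t} → 0ℚ + gap 0<ε < seq ε t × (∀ i j r → marginal t i j r < 1ℚ + - seq ε t + σ) →
            ∀ i j r → marginal t i j r ≤ 1ℚ - gap 0<ε + σ
          bound (g<ε , m<) i j r = ℚ.≤-trans (ℚ.<⇒≤ (m< i j r)) (ℚ.+-monoˡ-≤ σ (ℚ.+-monoʳ-≤ 1ℚ (ℚ.neg-antimono-≤
            (subst (_≤ _) (ℚ.+-identityˡ (gap 0<ε)) (ℚ.<⇒≤ g<ε)))))

        eventually-product : ∀ σ → 0ℚ < σ → Eventually (λ t →
          All (λ A → ∣ lawₜ t A - ∏ (λ i → ∏ (λ j → marginal t i j (entry A i j))) ∣ ≤ σ) Ms)
        eventually-product σ 0<σ = eventually-map
          (λ {t} → All.map (λ {A} close → ℚ.<⇒≤ (subst (λ x → ∣ lawₜ t A - x ∣ < σ) (expand t A) close)))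
          (eventually-All (λ A → ≃-close (independent A) σ 0<σ) Ms)
          where
          expand : ∀ t A → seq (∏ℝ (λ i → ∏ℝ (λ j → ℙ[entry≡] M i j (entry A i j)))) t
            ≡ ∏ (λ i → ∏ (λ j → marginal t i j (entry A i j)))
          expand t A = trans (seq-∏ℝ (λ i → ∏ℝ (λ j → ℙ[entry≡] M i j (entry A i j))) t)
            (∏-cong (λ i → seq-∏ℝ (λ j → ℙ[entry≡] M i j (entry A i j)) t))

        module _ {E : Pred (Matrix p c m) 0ℓ} (E? : Decidable E) where

          -- The entries of μ are the marginals of M at index t of their Cauchy sequences, normalised
          -- because at a single index they need be neither nonnegative nor of total mass 1.
          Approximated : ℚ → ℚ → ℕ → Set
          Approximated ε₀ τ t = ∃[ μ ] ∣ seq (ℙ M E?) t - ∫ (matrixLaw {ε = ε₀} μ) (λ A → 𝟙 (E? A)) ∣ ≤ τ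

          -- Normalising moves a marginal by `(p + 2) σ`, and `∏-close` multiplies this by `3 ^ m`
          -- for a row and by `3 ^ c` for the matrix; approximate independence adds one σ per
          -- matrix. The mass bound `1 - gap + σ` rises by the same `(p + 2) σ`, so `(p + 3) σ` must
          -- fit between `ε₀` and the gap.
          approximate : ∀ {ε₀ τ σ t} → 0ℚ ≤ σ →
            (ι p + ι 3) * σ ≤ ½ → (ι p + ι 3) * σ ≤ gap 0<ε - ε₀ → ι 3 ^ m * (ι p + ι 2) * σ ≤ 1ℚ →
            size′ * ((1ℚ + ι 3 ^ c * (ι 3 ^ m * (ι p + ι 2))) * σ) ≤ τ →
            (∀ i j → ∣ sum (marginal t i j) - 1ℚ ∣ ≤ σ) → (∀ i j r → 0ℚ ≤ marginal t i j r + σ) →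
            (∀ i j r → marginal t i j r ≤ 1ℚ - gap 0<ε + σ) →
            All (λ A → ∣ lawₜ t A - ∏ (λ i → ∏ (λ j → marginal t i j (entry A i j))) ∣ ≤ σ) Ms →
            Approximated ε₀ τ t
          approximate {ε₀} {τ} {σ} {t} 0≤σ small₁ small₂ small₃ small₄ total≈1 0≤μ+σ μ≤ product≈ =
            (λ i j → balancedLaw {ε = ε₀} (ν i j) (mass≤ i j)) , (begin
              ∣ seq (ℙ M E?) t - ∫ (matrixLaw (λ i j → balancedLaw {ε = ε₀} (ν i j) (mass≤ i j))) (λ A → 𝟙 (E? A)) ∣
                ≡⟨ cong₂ (λ x y → ∣ x - y ∣) (seq-ℙ E? t) (matrixLaw-expand {ε = ε₀} ν mass≤ (λ A → 𝟙 (E? A))) ⟩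
              ∣ ∑ₗ Ms (λ A → 𝟙 (E? A) * lawₜ t A) - ∑ₗ Ms (λ A → Πν A * 𝟙 (E? A)) ∣
                ≤⟨ ∣∑ₗ-∑ₗ∣≤ (All.map (λ {A} → term A) product≈) ⟩
              size′ * ((1ℚ + V) * σ)
                ≤⟨ small₄ ⟩
              τ ∎)
            where
            open ℚ.≤-Reasoning
            W V : ℚ
            W = ι 3 ^ m * (ι p + ι 2)
            V = ι 3 ^ c * W
            μ : Fin c → Fin m → Fin p → ℚ
            μ = marginal t
            weights : ∀ i j → ∃[ ν ] (∀ r → ∣ μ i j r - mass ν r ∣ ≤ (ι p + ι 2) * σ)
            weights i j = normalised-weights (μ i j) σ 0≤σ (ℚ.≤-trans
              (*-monoʳ-≤ 0≤σ (ℚ.+-monoʳ-≤ (ι p) (ι-mono {1} {3} (ℕ.s≤s ℕ.z≤n)))) small₁) (0≤μ+σ i j) (total≈1 i j)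
            ν : Fin c → Fin m → Weights p
            ν i j = proj₁ (weights i j)
            Πν : Matrix p c m → ℚ
            Πν A = ∏ (λ i → ∏ (λ j → mass (ν i j) (entry A i j)))
            mass≤ : ∀ i j r → mass (ν i j) r ≤ 1ℚ - ε₀
            mass≤ i j r = begin
              mass (ν i j) r
                ≤⟨ ∣p-q∣≤r⇒p≤q+r (mass (ν i j) r) (μ i j r) (ℚ.≤-trans (ℚ.≤-reflexive (∣p-q∣≡∣q-p∣ (mass (ν i j) r) (μ i j r))) (proj₂ (weights i j) r)) ⟩
              μ i j r + (ι p + ι 2) * σ
                ≤⟨ ℚ.+-monoˡ-≤ ((ι p + ι 2) * σ) (μ≤ i j r) ⟩
              1ℚ - gap 0<ε + σ + (ι p + ι 2) * σ
                ≡⟨ solve 3 (λ g s k → con 1ℚ :- g :+ s :+ (k :+ con (ι 2)) :* s := con 1ℚ :- g :+ (k :+ con (ι 3)) :* s) refl (gap 0<ε) σ (ι p) ⟩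
              1ℚ - gap 0<ε + (ι p + ι 3) * σ
                ≤⟨ ℚ.+-monoʳ-≤ (1ℚ - gap 0<ε) small₂ ⟩
              1ℚ - gap 0<ε + (gap 0<ε - ε₀)
                ≡⟨ solve 2 (λ g e → con 1ℚ :- g :+ (g :- e) := con 1ℚ :- e) refl (gap 0<ε) ε₀ ⟩
              1ℚ - ε₀ ∎
            [p+2]σ≤1 : (ι p + ι 2) * σ ≤ 1ℚ
            [p+2]σ≤1 = ℚ.≤-trans (*-monoʳ-≤ 0≤σ (ℚ.+-monoʳ-≤ (ι p) (ι-mono {2} {3} (ℕ.s≤s (ℕ.s≤s ℕ.z≤n)))))
              (ℚ.≤-trans small₁ (p+r≡q⇒p≤q ½ refl (ℚ.nonNegative⁻¹ ½)))
            0≤[p+2]σ : 0ℚ ≤ (ι p + ι 2) * σ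
            0≤[p+2]σ = 0≤p*q (0≤p+q (0≤ι p) (0≤ι 2)) 0≤σ
            Wσ≡ : ι 3 ^ m * ((ι p + ι 2) * σ) ≡ W * σ
            Wσ≡ = sym (ℚ.*-assoc (ι 3 ^ m) (ι p + ι 2) σ)
            row-close : ∀ A i → ∣ ∏ (λ j → μ i j (entry A i j)) - ∏ (λ j → mass (ν i j) (entry A i j)) ∣ ≤ W * σ
            row-close A i = subst (∣ ∏ (λ j → μ i j (entry A i j)) - ∏ (λ j → mass (ν i j) (entry A i j)) ∣ ≤_) Wσ≡ (∏-close 0≤[p+2]σ [p+2]σ≤1
              (λ j → 0≤mass (ν i j) (entry A i j)) (λ j → mass≤1 (ν i j) (entry A i j)) (λ j → proj₂ (weights i j) (entry A i j)))
            matrix-close : ∀ A → ∣ ∏ (λ i → ∏ (λ j → μ i j (entry A i j))) - Πν A ∣ ≤ V * σ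
            matrix-close A = subst (∣ ∏ (λ i → ∏ (λ j → μ i j (entry A i j))) - Πν A ∣ ≤_) (sym (ℚ.*-assoc (ι 3 ^ c) W σ))
              (∏-close (0≤p*q (0≤p*q (0≤^ m (0≤ι 3)) (0≤p+q (0≤ι p) (0≤ι 2))) 0≤σ) small₃
                (λ i → 0≤∏ (λ j → 0≤mass (ν i j) (entry A i j)))
                (λ i → ∏≤1 (λ j → 0≤mass (ν i j) (entry A i j)) (λ j → mass≤1 (ν i j) (entry A i j)))
                (row-close A))
            term : ∀ A → ∣ lawₜ t A - ∏ (λ i → ∏ (λ j → μ i j (entry A i j))) ∣ ≤ σ →
              ∣ 𝟙 (E? A) * lawₜ t A - Πν A * 𝟙 (E? A) ∣ ≤ (1ℚ + V) * σ
            term A close = begin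
              ∣ 𝟙 (E? A) * lawₜ t A - Πν A * 𝟙 (E? A) ∣
                ≡⟨ cong ∣_∣ (solve 3 (λ i x y → i :* x :- y :* i := (x :- y) :* i) refl (𝟙 (E? A)) (lawₜ t A) (Πν A)) ⟩
              ∣ (lawₜ t A - Πν A) * 𝟙 (E? A) ∣
                ≡⟨ trans (ℚ.∣p*q∣≡∣p∣*∣q∣ (lawₜ t A - Πν A) (𝟙 (E? A))) (cong (∣ lawₜ t A - Πν A ∣ *_) (ℚ.0≤p⇒∣p∣≡p (0≤𝟙 (E? A)))) ⟩
              ∣ lawₜ t A - Πν A ∣ * 𝟙 (E? A)
                ≤⟨ p*q≤p (ℚ.0≤∣p∣ (lawₜ t A - Πν A)) (𝟙≤1 (E? A)) ⟩
              ∣ lawₜ t A - Πν A ∣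
                ≤⟨ ∣p-r∣≤ (lawₜ t A) (∏ (λ i → ∏ (λ j → μ i j (entry A i j)))) (Πν A) close (matrix-close A) ⟩
              σ + V * σ
                ≡⟨ solve 2 (λ s v → s :+ v :* s := (con 1ℚ :+ v) :* s) refl σ V ⟩
              (1ℚ + V) * σ ∎

          eventually-approximated : ∀ ε₀ → ε₀ < gap 0<ε → ∀ τ → 0ℚ < τ → Eventually (Approximated ε₀ τ)
          eventually-approximated ε₀ ε₀<gap τ 0<τ = go (below-both 0<τ (p<q⇒0<q-p ε₀<gap))
            where
            W B S G : ℚ
            W = ι 3 ^ m * (ι p + ι 2)
            B = ι p + ι 3
            S = size′ * (1ℚ + ι 3 ^ c * W)
            -- All smallness conditions on σ are linear with coefficients `S`, `W` and `B`, so a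
            -- single σ with `G * σ = z` meets them at once; `B` makes `G` positive.
            G = S + (W + B)
            0≤W : 0ℚ ≤ W
            0≤W = 0≤p*q (0≤^ m (0≤ι 3)) (0≤p+q (0≤ι p) (0≤ι 2))
            0≤S : 0ℚ ≤ S
            0≤S = 0≤p*q (0≤ι (length Ms)) (0≤p+q 0≤1 (0≤p*q (0≤^ c (0≤ι 3)) 0≤W))
            0<B : 0ℚ < B
            0<B = ℚ.+-mono-≤-< (0≤ι p) (0<ι 3)
            go : ∃[ x ] (0ℚ < x × x ≤ τ × x ≤ gap 0<ε - ε₀) → Eventually (Approximated ε₀ τ)
            go (x , 0<x , x≤τ , x≤gap) = go′ (below-both 0<x (ℚ.positive⁻¹ ½))
              where
              go′ : ∃[ z ] (0ℚ < z × z ≤ x × z ≤ ½) → Eventually (Approximated ε₀ τ)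
              go′ (z , 0<z , z≤x , z≤½) = go″ (divide G z (ℚ.+-mono-≤-< 0≤S (ℚ.+-mono-≤-< 0≤W 0<B)) 0<z)
                where
                go″ : ∃[ σ ] (0ℚ < σ × G * σ ≡ z) → Eventually (Approximated ε₀ τ)
                go″ (σ , 0<σ , Gσ≡z) = eventually-map
                  (λ (total≈1 , 0≤μ+σ , μ≤ , product≈) → approximate 0≤σ
                    (ℚ.≤-trans Bσ≤z z≤½) (ℚ.≤-trans Bσ≤z (ℚ.≤-trans z≤x x≤gap))
                    (ℚ.≤-trans Wσ≤z (ℚ.≤-trans z≤½ (p+r≡q⇒p≤q ½ refl (ℚ.nonNegative⁻¹ ½))))
                    (ℚ.≤-trans (ℚ.≤-reflexive (sym (ℚ.*-assoc size′ (1ℚ + ι 3 ^ c * W) σ))) (ℚ.≤-trans Sσ≤z (ℚ.≤-trans z≤x x≤τ)))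
                    total≈1 0≤μ+σ μ≤ product≈)
                  (eventually-× (eventually-total σ 0<σ) (eventually-× (eventually-nonneg σ 0<σ)
                    (eventually-× (eventually-bounded σ 0<σ) (eventually-product σ 0<σ))))
                  where
                  0≤σ : 0ℚ ≤ σ
                  0≤σ = ℚ.<⇒≤ 0<σ
                  ≤G : ∀ K → K ≤ G → K * σ ≤ z
                  ≤G K K≤G = ℚ.≤-trans (*-monoʳ-≤ 0≤σ K≤G) (ℚ.≤-reflexive Gσ≡z)
                  Sσ≤z : S * σ ≤ z
                  Sσ≤z = ≤G S (p≤p+q (0≤p+q 0≤W (ℚ.<⇒≤ 0<B)))
                  Wσ≤z : W * σ ≤ z
                  Wσ≤z = ≤G W (ℚ.≤-trans (p≤p+q (ℚ.<⇒≤ 0<B)) (p≤q+p 0≤S))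
                  Bσ≤z : B * σ ≤ z
                  Bσ≤z = ≤G B (ℚ.≤-trans (p≤q+p 0≤W) (p≤q+p 0≤S))

    -- Transfer of the limit to real laws

    rank-event : ∀ {ε u k n} (μ : Fin n → Fin (n ℕ.+ u) → BalancedLaw ε) →
      ∫ (matrixLaw μ) (λ A → 𝟙 (rank A ℕ.+ k ℕ.≟ n)) ≡ 𝔼[uniform] μ (k ℕ.+ u) 0
    rank-event {u = u} {k} {n} μ = ∫-cong (matrixLaw μ) (λ A → 𝟙-cong (rank A ℕ.+ k ℕ.≟ n) (nullity A ℕ.≟ k ℕ.+ u)
      (λ r+k≡n → ℕ.+-cancelˡ-≡ (rank A) (nullity A) (k ℕ.+ u)
        (trans (rank+nullity A) (trans (cong (ℕ._+ u) (sym r+k≡n)) (ℕ.+-assoc (rank A) k u))))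
      (λ null≡ → ℕ.+-cancelʳ-≡ u (rank A ℕ.+ k) n
        (trans (ℕ.+-assoc (rank A) k u) (trans (cong (rank A ℕ.+_) (sym null≡)) (rank+nullity A)))))

    -- At each large index `t` the real probability is compared with a rational law found for that
    -- `t`, this with the uniform model, and the model with `L t`. The threshold for `n` comes only
    -- from the last two comparisons, so it does not move with `t`.
    rank-limit : ∀ (ε : ℝ) → 0ℝ <ℝ ε → (u : ℕ) →
      (M : ∀ n → RandomMatrix p n (n ℕ.+ u)) → (∀ n → IsBalanced ε (M n)) → (k : ℕ) → (L : ℕ → ℚ) →
      (∀ δ → 0ℚ < δ → ∃[ N ] (∀ n t → N ℕ.≤ n → N ℕ.≤ t → ∣ uniform (k ℕ.+ u) n (n ℕ.+ u) - L t ∣ ≤ δ)) →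
      ∀ e → 0ℝ <ℝ e → ∃[ N ] (∀ n → N ℕ.≤ n → ∃[ g ] (0ℚ < g ×
        Eventually (λ t → ∣ seq (ℙ (M n) (λ A → rank A ℕ.+ k ℕ.≟ n)) t - L t ∣ + g < seq e t)))
    rank-limit ε 0<ε u M balanced k L uniform⟶L e 0<e = choose
      -- `ε₀` lies strictly below the gap to leave room for the approximation, and below ½ for the
      -- early rows. A quarter of the gap of `e` goes to each of the three comparisons, and the last
      -- quarter is the separation that `_<ℝ_` demands.
      (below-both (0<p*q (ℚ.positive⁻¹ ½) (0<gap 0<ε)) (ℚ.positive⁻¹ ½)) (divide (ι 4) (gap 0<e) (0<ι 4) (0<gap 0<e))
      where
      open ℚ.≤-Reasoning
      close : ∀ {δ} → ι 4 * δ ≡ gap 0<e → ∀ x y z b {t} →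
        ∣ x - y ∣ ≤ δ → ∣ y - z ∣ ≤ δ → ∣ z - b ∣ ≤ δ → 0ℚ + gap 0<e < seq e t → ∣ x - b ∣ + δ < seq e t
      close {δ} 4δ≡gap x y z b {t} xy yz zb gap<e = begin-strict
        ∣ x - b ∣ + δ           ≤⟨ ℚ.+-monoˡ-≤ δ (∣p-r∣≤ x y b xy (∣p-r∣≤ y z b yz zb)) ⟩
        δ + (δ + δ) + δ         ≡⟨ solve 1 (λ d → d :+ (d :+ d) :+ d := con (ι 4) :* d) refl δ ⟩
        ι 4 * δ                 ≡⟨ 4δ≡gap ⟩
        gap 0<e                 ≡⟨ ℚ.+-identityˡ (gap 0<e) ⟨
        0ℚ + gap 0<e            <⟨ gap<e ⟩
        seq e t                 ∎
      combine : ∀ {ε₀ δ} → ε₀ < gap 0<ε → 0ℚ < δ → ι 4 * δ ≡ gap 0<e →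
        ∃[ N ] (∀ n → N ℕ.≤ n → (μ : Fin n → Fin (n ℕ.+ u) → BalancedLaw ε₀) →
          ∣ 𝔼[uniform] μ (k ℕ.+ u) 0 - uniform (k ℕ.+ u) n (n ℕ.+ u) ∣ ≤ δ) →
        ∃[ N ] (∀ n t → N ℕ.≤ n → N ℕ.≤ t → ∣ uniform (k ℕ.+ u) n (n ℕ.+ u) - L t ∣ ≤ δ) →
        ∃[ N ] (∀ n → N ℕ.≤ n → ∃[ g ] (0ℚ < g ×
          Eventually (λ t → ∣ seq (ℙ (M n) (λ A → rank A ℕ.+ k ℕ.≟ n)) t - L t ∣ + g < seq e t)))
      combine {ε₀} {δ} ε₀<gap 0<δ 4δ≡gap (N₁ , h₁) (N₂ , h₂) = N₁ ℕ.⊔ N₂ , λ n N≤n → δ , 0<δ ,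
        eventually-map (λ {t} ((μ , approx) , gap<e , N₂≤t) → close 4δ≡gap
            (seq (ℙ (M n) (λ A → rank A ℕ.+ k ℕ.≟ n)) t) (𝔼[uniform] μ (k ℕ.+ u) 0) (uniform (k ℕ.+ u) n (n ℕ.+ u))
            (L t)
            (subst (λ x → ∣ seq (ℙ (M n) (λ A → rank A ℕ.+ k ℕ.≟ n)) t - x ∣ ≤ δ) (rank-event μ) approx)
            (h₁ n (ℕ.m⊔n≤o⇒m≤o N₁ N₂ N≤n) μ) (h₂ n t (ℕ.m⊔n≤o⇒n≤o N₁ N₂ N≤n) N₂≤t) gap<e)
          (eventually-× (eventually-approximated (M n) (balanced n) 0<ε (λ A → rank A ℕ.+ k ℕ.≟ n) ε₀ ε₀<gap δ 0<δ)
            (eventually-× (<-separation 0<e) (N₂ , λ _ N₂≤t → N₂≤t)))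
      choose : ∃[ ε₀ ] (0ℚ < ε₀ × ε₀ ≤ ½ * gap 0<ε × ε₀ ≤ ½) → ∃[ δ ] (0ℚ < δ × ι 4 * δ ≡ gap 0<e) →
        ∃[ N ] (∀ n → N ℕ.≤ n → ∃[ g ] (0ℚ < g ×
          Eventually (λ t → ∣ seq (ℙ (M n) (λ A → rank A ℕ.+ k ℕ.≟ n)) t - L t ∣ + g < seq e t)))
      choose (ε₀ , 0<ε₀ , ε₀≤½gap , ε₀≤½) (δ , 0<δ , 4δ≡gap) = combine
        (ℚ.≤-<-trans ε₀≤½gap (p+r≡q⇒p<q (½ * gap 0<ε) (solve 1 (λ g → con ½ :* g :+ con ½ :* g := g) refl (gap 0<ε))
          (0<p*q (ℚ.positive⁻¹ ½) (0<gap 0<ε))))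
        0<δ 4δ≡gap (kernel-universality 0<ε₀ ε₀≤½ u (k ℕ.+ u) δ 0<δ) (uniform⟶L δ 0<δ)

open import Data.Nat.Base using (ℕ; _+_; _*_)
open import Data.Nat.Properties using (_≟_)
open import Data.Nat.Primality using (Prime)
import Data.Rational.Base as ℚ
open import Data.Product.Base using (_,_)
open RankDistribution using (rank-limit; uniform-limit)

corollary3p5 :
  ∀ (p : ℕ) {{_ : Prime p}} (ε : ℝ) → 0ℝ <ℝ ε → (u : ℕ) →
  (M : ∀ n → RandomMatrix p n (n + u)) → (∀ n → IsBalanced ε (M n)) →
  (k : ℕ) →
  (λ n → ℙ (M n) (λ A → rank A + k ≟ n))
    ⟶ fromℚ (p ^- (k * (k + u))
               ℚ.* ∏₁ k (λ i → [1- p ^- i ]⁻¹)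
               ℚ.* ∏₁ (k + u) (λ i → [1- p ^- i ]⁻¹))
       *ℝ ∏₁∞[1- p ^-]
corollary3p5 p ε 0<ε u M balanced k e 0<e =
  let (N , close) = rank-limit ε 0<ε u M balanced k _ (uniform-limit p u k) e 0<e
  in N , λ n N≤n → let (g , 0<g , separated) = close n N≤n in mk< g 0<g separated
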